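{- Let $a=(a_i)_{i\in\mathbb Z}$ be any sequence of complex numbers and $\mu$ a Young diagram. For all $x=(x_1,x_2,\dots)$, $y=(y_1,y_2,\dots)$ with finitely many nonzero coordinates, $$s_{\mu;a}(x;y)=\sum_{\mathcal T}\prod_{k\ge1}f_{\mathcal T^{ -1}(k);a}(x_k,y_k),$$ summed over all diagonal-strict tableaux $\mathcal T$ of shape $\mu$.
   Context: $\Lambda$ is the algebra of symmetric functions over $\mathbb C$ with complete homogeneous $h_k$, elementary $e_k$, power sums $\mathbf p_k$. For a sequence $a$ define $h_{k;a}=\sum_{i=1}^k(-1)^{k-i}e_{k-i}(a_1,\dots,a_{k-1})h_i$ ($k\ge1$), $h_{0;a}=1$, $h_{k;a}=0$ ($k<0$); $(\tau^ra)_i=a_{i+r}$; $s_{\mu;a}=\det[h_{\mu_i-i+j;\,\tau^{1-j}a}]_{i,j=1}^N$ for any $N\ge\ell(\mu)$. Each $f\in\Lambda$ is a function $f(x;y)$ via $\mathbf p_k\mapsto\sum_ix_i^k+(-1)^{k-1}\sum_jy_j^k$. Let $\mathbb Z'=\mathbb Z+\tfrac12$ and $a'_\varepsilon=a_{\varepsilon+1/2}$ for $\varepsilon\in\mathbb Z'$. The box $(i,j)$ (row $i$, column $j$) is the unit square $[i-1,i]\times[j-1,j]$ in coordinates where the first axis points down and the second to the right. For a skew hook $\nu$ (a connected skew diagram with no $2\times2$ block of boxes), an interior side is a unit segment shared by two boxes of $\nu$ (there are $|\nu|-1$ of them); write $s=(\varepsilon,\delta)$ for its midpoint; it is vertical if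 $\varepsilon\in\mathbb Z'$, $\delta\in\mathbb Z$ and horizontal if $\varepsilon\in\mathbb Z$, $\delta\in\mathbb Z'$; in both cases $\delta-\varepsilon\in\mathbb Z'$. Define $f_{\nu;a}(u,v)=(u+v)\prod_{\text{vertical }s=(\varepsilon,\delta)}(u-a'_{\delta-\varepsilon})\prod_{\text{horizontal }s=(\varepsilon,\delta)}(v+a'_{\delta-\varepsilon})$. For a skew diagram $\nu$ with no $2\times2$ block, $f_{\nu;a}$ is the product of the polynomials of its connected components (skew hooks), and $f_{\varnothing;a}=1$. A diagonal-strict tableau of shape $\mu$ is a map $\mathcal T$ from the boxes of $\mu$ to $\{1,2,\dots\}$ weakly increasing along each row (left to right) and down each column, and strictly increasing along each diagonal $j-i=\mathrm{const}$; each $\mathcal T^{ -1}(k)$ is then a skew diagram with no $2\times 2$ block. -}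

module Defs where

open import Algebra.Bundles using (CommutativeRing)
import Algebra.Properties.CommutativeMonoid.Sum as Sum
import Algebra.Properties.Semiring.Exp as Exp
import Algebra.Properties.Semiring.Mult as Mult
import Algebra.Properties.Semiring.Sum as SemiringSum
open import Data.Fin.Base using (Fin; toℕ; punchIn) renaming (zero to fzero; suc to fsuc)
open import Data.Integer.Base as ℤ using (ℤ; +_; -[1+_])
open import Data.List.Base as List
  using (List; []; _∷_; _++_; map; concat; concatMap; filter; partition; length; foldr; allFin; upTo)
open import Data.List.Membership.DecPropositional using () renaming (_∈?_ to mem?)
import Data.List.Membership.Setoid as Membership
open import Data.List.Relation.Unary.All using (All)
open import Data.List.Relation.Unary.Any using (any?)
open import Data.List.Relation.Unary.Linked using (Linked)
import Data.List.Relation.Unary.Unique.Setoid as UniqueSetoid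
open import Data.Nat.Base as ℕ using (ℕ; zero; suc; _≤_; _<_; _≥_; _>_; _∸_)
import Data.Nat.Properties as ℕ
open import Data.Product.Base using (Σ-syntax; _×_; _,_)
open import Data.Product.Properties using (≡-dec)
open import Data.Sum.Base using (_⊎_)
open import Data.Maybe.Base using (nothing)
open import Data.Vec.Base as Vec using (Vec)
open import Level using (_⊔_)
open import Relation.Binary.Bundles using (Setoid)
open import Relation.Binary.Definitions using (Decidable; DecidableEquality)
import Relation.Binary.Reasoning.Setoid as SetoidReasoning
open import Relation.Binary.PropositionalEquality as ≡ using (_≡_)
open import Relation.Nullary.Decidable using (_⊎-dec_)
open import Relation.Nullary.Negation using (¬_)
import Tactic.RingSolver.Core.AlmostCommutativeRing as ACR
import Tactic.RingSolver.NonReflective as RingSolver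

------------------------------------------------------------------------
-- Rings

-- A stand-in for the field of complex numbers: a commutative ring in which
-- every positive integer is invertible.
record IsℚAlgebra {c ℓ} (K : CommutativeRing c ℓ) : Set (c ⊔ ℓ) where
  open CommutativeRing K
  open Mult semiring using () renaming (_×_ to _·_)
  field
    1/suc   : ℕ → Carrier
    inverse : ∀ n → (suc n · 1#) * 1/suc n ≈ 1#

module RingOps {c ℓ} (R : CommutativeRing c ℓ) where
  open CommutativeRing R
  open Exp semiring using (_^_) public
  open Sum +-commutativeMonoid using (sum; sum-syntax) public

  sumList prodList : List Carrier → Carrier
  sumList  = foldr _+_ 0#
  prodList = foldr _*_ 1#

  -- Laplace expansion along the first row.
  det : ∀ {n} → (Fin n → Fin n → Carrier) → Carrier
  det {zero}  A = 1#
  det {suc n} A = ∑[ j < suc n ]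
    (((- 1#) ^ toℕ j * A fzero j) * det (λ i k → A (fsuc i) (punchIn j k)))

  -- Elementary and complete homogeneous polynomials in a finite list of
  -- variables.
  elementary : ℕ → List Carrier → Carrier
  elementary zero    xs       = 1#
  elementary (suc k) []       = 0#
  elementary (suc k) (x ∷ xs) = x * elementary k xs + elementary (suc k) xs

  complete : ℕ → List Carrier → Carrier
  complete zero    xs       = 1#
  complete (suc k) []       = 0#
  complete (suc k) (x ∷ xs) = x * complete k (x ∷ xs) + complete (suc k) xs

  -- Σ f = s for a family f of finite support: s is the sum of f over the
  -- elements of a repetition-free list outside of which f vanishes.
  HasSum : ∀ {i ℓᵢ} (I : Setoid i ℓᵢ) → (Setoid.Carrier I → Carrier) → Carrier → Set _
  HasSum I f s = Σ[ L ∈ List (Setoid.Carrier I) ]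
      (UniqueSetoid.Unique I L)
    × (∀ t → ¬ (t ∈ L) → f t ≈ 0#)
    × (sumList (map f L) ≈ s)
    where open Membership I using (_∈_)

------------------------------------------------------------------------
-- Diagrams

-- μ₁ ≥ μ₂ ≥ … > 0
record YoungDiagram : Set where
  field
    parts      : List ℕ
    decreasing : Linked _≥_ parts
    positive   : All (_> 0) parts

-- (r , c) is the unit square [r, r+1] × [c, c+1], that is, the box in row
-- r + 1 and column c + 1.
Cell : Set
Cell = ℕ × ℕ

_≟ᶜ_ : DecidableEquality Cell
_≟ᶜ_ = ≡-dec ℕ._≟_ ℕ._≟_

right below : Cell → Cell
right (r , c) = r , suc c
below (r , c) = suc r , c

Adjacent : Cell → Cell → Set
Adjacent b b′ = (b′ ≡ right b ⊎ b′ ≡ below b) ⊎ (b ≡ right b′ ⊎ b ≡ below b′)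

adjacent? : Decidable Adjacent
adjacent? b b′ = ((b′ ≟ᶜ right b) ⊎-dec (b′ ≟ᶜ below b))
           ⊎-dec ((b ≟ᶜ right b′) ⊎-dec (b ≟ᶜ below b′))

-- The connected components of a finite set of cells, each component being
-- listed without repetition if the set is.  Adding a cell b fuses b with
-- all components that contain a neighbour of b.
components : List Cell → List (List Cell)
components []       = []
components (b ∷ bs) =
  let touching , others = partition (any? (adjacent? b)) (components bs)
  in  (b ∷ concat touching) ∷ others

-- n +½ is the half-integer n + ½.
record ℤ′ : Set where
  constructor _+½
  field floor : ℤ

-- Unit segments, given by their midpoint (ε , δ).
data Side : Set where
  vertical   : (ε : ℤ′) (δ : ℤ)  → Side
  horizontal : (ε : ℤ)  (δ : ℤ′) → Side

δ-ε : Side → ℤ′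
δ-ε (vertical (m +½) δ)   = (δ ℤ.- m ℤ.- + 1) +½
δ-ε (horizontal ε (m +½)) = (m ℤ.- ε) +½

rightSide belowSide : Cell → Side
rightSide (r , c) = vertical ((+ r) +½) (+ suc c)
belowSide (r , c) = horizontal (+ suc r) ((+ c) +½)

interiorSides : List Cell → List Side
interiorSides ν = map rightSide (filter (λ b → right b ∈? ν) ν)
               ++ map belowSide (filter (λ b → below b ∈? ν) ν)
  where _∈?_ = mem? _≟ᶜ_

partOf : List ℕ → ℕ → ℕ
partOf []       _       = 0
partOf (m ∷ _)  zero    = m
partOf (_ ∷ ms) (suc i) = partOf ms i

module _ (μ : YoungDiagram) where
  open YoungDiagram μ

  -- part i is μᵢ₊₁, which is 0 beyond the last part.
  part : ℕ → ℕ
  part = partOf parts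

  rows : ℕ
  rows = length parts

  Box : Set
  Box = Σ[ r ∈ Fin rows ] Fin (part (toℕ r))

  row col : Box → ℕ
  row (r , _) = toℕ r
  col (_ , c) = toℕ c

  boxes : List Box
  boxes = concatMap (λ r → map (r ,_) (allFin (part (toℕ r)))) (allFin rows)

  cell : Box → Cell
  cell b = row b , col b

  -- The entry k ∈ {1, 2, …} is represented by k − 1 ∈ ℕ.
  record DiagonalStrictTableau : Set where
    field
      entry          : Box → ℕ
      rowWeak        : ∀ b b′ → row b ≡ row b′ → col b ≤ col b′ → entry b ≤ entry b′
      columnWeak     : ∀ b b′ → col b ≡ col b′ → row b ≤ row b′ → entry b ≤ entry b′
      -- row b + col b′ ≡ row b′ + col b says that b and b′ have the same j − i.
      diagonalStrict : ∀ b b′ → row b ℕ.+ col b′ ≡ row b′ ℕ.+ col b →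
                       row b < row b′ → entry b < entry b′

    preimage : ℕ → List Cell
    preimage k = map cell (filter (λ b → entry b ℕ.≟ k) boxes)

    maxEntry : ℕ
    maxEntry = foldr ℕ._⊔_ 0 (map entry boxes)

  open DiagonalStrictTableau

  tableaux : Setoid _ _
  tableaux = record
    { Carrier       = DiagonalStrictTableau
    ; _≈_           = λ T U → ∀ b → entry T b ≡ entry U b
    ; isEquivalence = record
      { refl  = λ _ → ≡.refl
      ; sym   = λ p b → ≡.sym (p b)
      ; trans = λ p q b → ≡.trans (p b) (q b)
      }
    }

------------------------------------------------------------------------
-- Symmetric functions

module SymmetricFunctions {c ℓ} (K : CommutativeRing c ℓ) (isℚAlgebra : IsℚAlgebra K) where
  open CommutativeRing K
  open IsℚAlgebra isℚAlgebra
  open RingOps K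
  private module · = Mult semiring renaming (_×_ to _·_)
  open · using (_·_)

  -- Λ is the free commutative K-algebra on the power sums; 𝐩[1+ m ] is 𝐩ₘ₊₁.
  data SymFun : Set c where
    const   : Carrier → SymFun
    𝐩[1+_] : ℕ → SymFun
    _⊕_ _⊗_ : SymFun → SymFun → SymFun
    ⊝_      : SymFun → SymFun

  infixl 6 _⊕_
  infixl 7 _⊗_
  infix  4 _≋_

  data _≋_ : SymFun → SymFun → Set (c ⊔ ℓ) where
    ≋-refl      : ∀ {f} → f ≋ f
    ≋-sym       : ∀ {f g} → f ≋ g → g ≋ f
    ≋-trans     : ∀ {f g h} → f ≋ g → g ≋ h → f ≋ h
    ⊕-cong      : ∀ {f f′ g g′} → f ≋ f′ → g ≋ g′ → f ⊕ g ≋ f′ ⊕ g′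
    ⊗-cong      : ∀ {f f′ g g′} → f ≋ f′ → g ≋ g′ → f ⊗ g ≋ f′ ⊗ g′
    ⊝-cong      : ∀ {f f′} → f ≋ f′ → ⊝ f ≋ ⊝ f′
    ⊕-assoc     : ∀ f g h → (f ⊕ g) ⊕ h ≋ f ⊕ (g ⊕ h)
    ⊕-comm      : ∀ f g → f ⊕ g ≋ g ⊕ f
    ⊕-identityˡ : ∀ f → const 0# ⊕ f ≋ f
    ⊝-inverseˡ  : ∀ f → ⊝ f ⊕ f ≋ const 0#
    ⊗-assoc     : ∀ f g h → (f ⊗ g) ⊗ h ≋ f ⊗ (g ⊗ h)
    ⊗-comm      : ∀ f g → f ⊗ g ≋ g ⊗ f
    ⊗-identityˡ : ∀ f → const 1# ⊗ f ≋ f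
    ⊗-distribʳ  : ∀ f g h → (g ⊕ h) ⊗ f ≋ g ⊗ f ⊕ h ⊗ f
    const-cong  : ∀ {s t} → s ≈ t → const s ≋ const t
    const-+     : ∀ s t → const (s + t) ≋ const s ⊕ const t
    const-*     : ∀ s t → const (s * t) ≋ const s ⊗ const t

  Λ : CommutativeRing c (c ⊔ ℓ)
  Λ = record
    { Carrier = SymFun ; _≈_ = _≋_ ; _+_ = _⊕_ ; _*_ = _⊗_ ; -_ = ⊝_
    ; 0# = const 0# ; 1# = const 1#
    ; isCommutativeRing = record
      { isRing = record
        { +-isAbelianGroup = record
          { isGroup = record
            { isMonoid = record
              { isSemigroup = record
                { isMagma = record
                  { isEquivalence = record { refl = ≋-refl ; sym = ≋-sym ; trans = ≋-trans }
                  ; ∙-cong = ⊕-cong }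
                ; assoc = ⊕-assoc }
              ; identity = ⊕-identityˡ , λ f → ≋-trans (⊕-comm _ _) (⊕-identityˡ f) }
            ; inverse = ⊝-inverseˡ , λ f → ≋-trans (⊕-comm _ _) (⊝-inverseˡ f)
            ; ⁻¹-cong = ⊝-cong }
          ; comm = ⊕-comm }
        ; *-cong = ⊗-cong
        ; *-assoc = ⊗-assoc
        ; *-identity = ⊗-identityˡ , λ f → ≋-trans (⊗-comm _ _) (⊗-identityˡ f)
        ; distrib = (λ f g h → ≋-trans (⊗-comm _ _)
                      (≋-trans (⊗-distribʳ f g h) (⊕-cong (⊗-comm _ _) (⊗-comm _ _))))
                  , ⊗-distribʳ }
      ; *-comm = ⊗-comm } }

  -- The algebra homomorphism Λ → K with 𝐩ₘ₊₁ ↦ π m.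
  specialise : (ℕ → Carrier) → SymFun → Carrier
  specialise π (const s) = s
  specialise π 𝐩[1+ m ] = π m
  specialise π (f ⊕ g)   = specialise π f + specialise π g
  specialise π (f ⊗ g)   = specialise π f * specialise π g
  specialise π (⊝ f)     = - specialise π f

  specialise-cong : ∀ π {f g} → f ≋ g → specialise π f ≈ specialise π g
  specialise-cong π ≋-refl            = refl
  specialise-cong π (≋-sym p)         = sym (specialise-cong π p)
  specialise-cong π (≋-trans p q)     = trans (specialise-cong π p) (specialise-cong π q)
  specialise-cong π (⊕-cong p q)      = +-cong (specialise-cong π p) (specialise-cong π q)
  specialise-cong π (⊗-cong p q)      = *-cong (specialise-cong π p) (specialise-cong π q)
  specialise-cong π (⊝-cong p)        = -‿cong (specialise-cong π p)
  specialise-cong π (⊕-assoc _ _ _)   = +-assoc _ _ _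
  specialise-cong π (⊕-comm _ _)      = +-comm _ _
  specialise-cong π (⊕-identityˡ _)   = +-identityˡ _
  specialise-cong π (⊝-inverseˡ _)    = -‿inverseˡ _
  specialise-cong π (⊗-assoc _ _ _)   = *-assoc _ _ _
  specialise-cong π (⊗-comm _ _)      = *-comm _ _
  specialise-cong π (⊗-identityˡ _)   = *-identityˡ _
  specialise-cong π (⊗-distribʳ _ _ _) = distribʳ _ _ _
  specialise-cong π (const-cong p)    = p
  specialise-cong π (const-+ _ _)     = refl
  specialise-cong π (const-* _ _)     = refl

  -- A sequence with finitely many nonzero coordinates; the k-th one is
  -- coord (k − 1).
  record FiniteSequence : Set (c ⊔ ℓ) where
    field
      coord  : ℕ → Carrier
      bound  : ℕ
      vanish : ∀ i → bound ≤ i → coord i ≈ 0#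

  powerSum : ℕ → FiniteSequence → Carrier
  powerSum k x = ∑[ i < bound ] (coord (toℕ i) ^ k)
    where open FiniteSequence x

  _⟨_∣_⟩ : SymFun → FiniteSequence → FiniteSequence → Carrier
  f ⟨ x ∣ y ⟩ = specialise
    (λ m → powerSum (suc m) x + (- 1#) ^ m * powerSum (suc m) y) f

  -- The complete homogeneous hₙ ∈ Λ, expressed through the power sums by
  -- n hₙ = 𝐩₁ hₙ₋₁ + 𝐩₂ hₙ₋₂ + ⋯ + 𝐩ₙ h₀; the vector is hₙ , hₙ₋₁ , … , h₀.
  -- By h-complete below, hₙ takes the
  -- value of the complete homogeneous polynomial at every finite list of
  -- variables.
  private module Λ-ops = RingOps Λ

  hs : ∀ n → Vec SymFun (suc n)
  hs zero    = const 1# Vec.∷ Vec.[]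
  hs (suc n) = (const (1/suc n) ⊗
                 Λ-ops.sum (λ i → 𝐩[1+ toℕ i ] ⊗ Vec.lookup (hs n) i)) Vec.∷ hs n

  h : ℕ → SymFun
  h n = Vec.head (hs n)

  powers : List Carrier → ℕ → Carrier
  powers xs m = sumList (map (_^ suc m) xs)

  private
    ringK = ACR.fromCommutativeRing K (λ _ → nothing)
    open RingSolver ringK using (solve; _⊜_) renaming (_⊕_ to _:+_; _⊗_ to _:*_)
    open SetoidReasoning setoid
    open SemiringSum semiring using (*-distribˡ-sum; sum-cong-≋; ∑-distrib-+)

    -- Σ f i * g (n − i) over 0 ≤ i ≤ n
    conv : (ℕ → Carrier) → (ℕ → Carrier) → ℕ → Carrier
    conv f g n = ∑[ i < suc n ] (f (toℕ i) * g (n ∸ toℕ i))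

    conv-+ : ∀ f f′ g n → conv (λ i → f i + f′ i) g n ≈ conv f g n + conv f′ g n
    conv-+ f f′ g n = trans
      (sum-cong-≋ {suc n} (λ i → distribʳ (g (n ∸ toℕ i)) (f (toℕ i)) (f′ (toℕ i))))
      (∑-distrib-+ {suc n} (λ i → f (toℕ i) * g (n ∸ toℕ i)) (λ i → f′ (toℕ i) * g (n ∸ toℕ i)))

    conv-scale : ∀ t f g n → conv (λ i → t * f i) g n ≈ t * conv f g n
    conv-scale t f g n = trans
      (sum-cong-≋ {suc n} (λ i → *-assoc t (f (toℕ i)) (g (n ∸ toℕ i))))
      (sym (*-distribˡ-sum t (λ (i : Fin (suc n)) → f (toℕ i) * g (n ∸ toℕ i))))

    conv-complete : ∀ x xs f m →
      conv f (λ n → complete n (x ∷ xs)) (suc m) ≈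
      x * conv f (λ n → complete n (x ∷ xs)) m + conv f (λ n → complete n xs) (suc m)
    conv-complete x xs f zero = begin
      f 0 * (x * 1# + complete 1 xs) + (f 1 * 1# + 0#)
        ≈⟨ solve 5 (λ x f₀ o H z → (f₀ :* (x :* o :+ H) :+ z)
                     ⊜ (x :* (f₀ :* o) :+ (f₀ :* H :+ z)))
             refl x (f 0) 1# (complete 1 xs) (f 1 * 1# + 0#) ⟩
      x * (f 0 * 1#) + (f 0 * complete 1 xs + (f 1 * 1# + 0#))
        ≈⟨ +-congʳ (*-congˡ (+-identityʳ _)) ⟨
      x * (f 0 * 1# + 0#) + (f 0 * complete 1 xs + (f 1 * 1# + 0#)) ∎
    conv-complete x xs f (suc m) = begin
      _ ≈⟨ +-congˡ (conv-complete x xs (λ i → f (suc i)) m) ⟩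
      f 0 * (x * a + b) + (x * p + q)
        ≈⟨ solve 6 (λ x f₀ a b p q → (f₀ :* (x :* a :+ b) :+ (x :* p :+ q))
                     ⊜ (x :* (f₀ :* a :+ p) :+ (f₀ :* b :+ q))) refl x (f 0) a b p q ⟩
      _ ∎
      where
      a = complete (suc m) (x ∷ xs)
      b = complete (suc (suc m)) xs
      p = conv (λ i → f (suc i)) (λ n → complete n (x ∷ xs)) m
      q = conv (λ i → f (suc i)) (λ n → complete n xs) (suc m)

    powers-conv : ∀ x f n → conv (λ m → x ^ suc m) f (suc n) ≈
                  x * (f (suc n) + conv (λ m → x ^ suc m) f n)
    powers-conv x f n = begin
      (x * 1#) * f (suc n) + conv (λ m → x * x ^ suc m) f n
        ≈⟨ +-cong (*-congʳ (*-identityʳ x)) (conv-scale x (λ m → x ^ suc m) f n) ⟩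
      x * f (suc n) + x * conv (λ m → x ^ suc m) f n
        ≈⟨ distribˡ x _ _ ⟨
      x * (f (suc n) + conv (λ m → x ^ suc m) f n) ∎

    newton : ∀ xs n → conv (powers xs) (λ m → complete m xs) n ≈ suc n · complete (suc n) xs
    newton [] n = begin
      conv (λ _ → 0#) (λ m → complete m []) n
        ≈⟨ sum-cong-≋ {suc n} (λ i → trans (zeroˡ (complete (n ∸ toℕ i) [])) (sym (zeroˡ 0#))) ⟩
      conv (λ _ → 0#) (λ _ → 0#) n
        ≈⟨ *-distribˡ-sum 0# (λ (i : Fin (suc n)) → 0#) ⟨
      0# * zeros
        ≈⟨ zeroˡ _ ⟩
      0#
        ≈⟨ zeroʳ _ ⟨
      (suc n · 1#) * 0#
        ≈⟨ ·.×-assoc-* (suc n) 1# 0# ⟩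
      suc n · (1# * 0#)
        ≈⟨ ·.×-congʳ (suc n) (*-identityˡ 0#) ⟩
      suc n · 0# ∎
      where
      zeros : Carrier
      zeros = ∑[ i < suc n ] 0#
    newton (x ∷ xs) n = begin
      conv (powers (x ∷ xs)) H′ n
        ≈⟨ conv-+ (λ m → x ^ suc m) (powers xs) H′ n ⟩
      A n + B n
        ≈⟨ step n ⟩
      suc n · (x * H′ n + H (suc n)) ∎
      where
      H′ H A B : ℕ → Carrier
      H′ m = complete m (x ∷ xs)
      H m = complete m xs
      A = conv (λ m → x ^ suc m) H′
      B = conv (powers xs) H′
      step : ∀ n → A n + B n ≈ suc n · H′ (suc n)
      step zero = begin
        ((x * 1#) * 1# + 0#) + B 0
          ≈⟨ +-cong (trans (+-identityʳ _) (*-identityʳ _)) (newton xs 0) ⟩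
        x * 1# + (H 1 + 0#)
          ≈⟨ +-assoc _ _ _ ⟨
        (x * 1# + H 1) + 0# ∎
      step (suc n) = begin
        A (suc n) + B (suc n)
          ≈⟨ +-cong (powers-conv x H′ n) (conv-complete x xs (powers xs) n) ⟩
        x * (H′ (suc n) + A n) + (x * B n + conv (powers xs) H (suc n))
          ≈⟨ +-congˡ (+-congˡ (newton xs (suc n))) ⟩
        x * (H′ (suc n) + A n) + (x * B n + (H (suc (suc n)) + t))
          ≈⟨ solve 6 (λ x a b c d t → (x :* (a :+ b) :+ (x :* c :+ (d :+ t)))
                       ⊜ (x :* a :+ d :+ (x :* (b :+ c) :+ t)))
               refl x (H′ (suc n)) (A n) (B n) (H (suc (suc n))) t ⟩
        H′ (suc (suc n)) + (x * (A n + B n) + t)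
          ≈⟨ +-congˡ (+-congʳ (trans (*-congˡ (step n)) (·.×-comm-* (suc n) x _))) ⟩
        H′ (suc (suc n)) + (suc n · (x * H′ (suc n)) + t)
          ≈⟨ +-congˡ (·-distrib (suc n) _ _) ⟨
        H′ (suc (suc n)) + suc n · H′ (suc (suc n)) ∎
        where
        t = suc n · H (suc (suc n))
        ·-distrib : ∀ k a b → k · (a + b) ≈ k · a + k · b
        ·-distrib zero    a b = sym (+-identityʳ 0#)
        ·-distrib (suc k) a b = trans (+-congˡ (·-distrib k a b))
          (solve 4 (λ a b u v → (a :+ b :+ (u :+ v)) ⊜ (a :+ u :+ (b :+ v)))
             refl a b (k · a) (k · b))

    specialise-sum : ∀ π {n} (f : Fin n → SymFun) →
      specialise π (Λ-ops.sum f) ≈ ∑[ i < n ] specialise π (f i)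
    specialise-sum π {zero}  f = refl
    specialise-sum π {suc n} f = +-congˡ (specialise-sum π (λ i → f (fsuc i)))

    lookup-hs : ∀ n i → Vec.lookup (hs n) i ≡ h (n ∸ toℕ i)
    lookup-hs zero    fzero    = ≡.refl
    lookup-hs (suc n) fzero    = ≡.refl
    lookup-hs (suc n) (fsuc i) = lookup-hs n i

  h-complete : ∀ n xs → specialise (powers xs) (h n) ≈ complete n xs
  h-complete n xs = bounded n n ℕ.≤-refl
    where
    bounded : ∀ b n → n ≤ b → specialise (powers xs) (h n) ≈ complete n xs
    bounded b       zero    n≤b = refl
    bounded (suc b) (suc n) n≤b = begin
      1/suc n * specialise (powers xs) (Λ-ops.sum (λ i → 𝐩[1+ toℕ i ] ⊗ Vec.lookup (hs n) i))
        ≈⟨ *-congˡ (specialise-sum (powers xs) (λ (i : Fin (suc n)) → 𝐩[1+ toℕ i ] ⊗ Vec.lookup (hs n) i)) ⟩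
      1/suc n * (∑[ i < suc n ] (powers xs (toℕ i) * specialise (powers xs) (Vec.lookup (hs n) i)))
        ≈⟨ *-congˡ (sum-cong-≋ {suc n} (λ i → *-congˡ {powers xs (toℕ i)} (earlier i))) ⟩
      1/suc n * conv (powers xs) (λ m → complete m xs) n
        ≈⟨ *-congˡ (newton xs n) ⟩
      1/suc n * (suc n · complete (suc n) xs)
        ≈⟨ *-congˡ (trans (·.×-assoc-* (suc n) 1# _) (·.×-congʳ (suc n) (*-identityˡ _))) ⟨
      1/suc n * ((suc n · 1#) * complete (suc n) xs)
        ≈⟨ *-assoc _ _ _ ⟨
      (1/suc n * (suc n · 1#)) * complete (suc n) xs
        ≈⟨ *-congʳ (trans (*-comm _ _) (inverse n)) ⟩
      1# * complete (suc n) xs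
        ≈⟨ *-identityˡ _ ⟩
      complete (suc n) xs ∎
      where
      earlier : ∀ i → specialise (powers xs) (Vec.lookup (hs n) i) ≈ complete (n ∸ toℕ i) xs
      earlier i = ≡.subst (λ f → specialise (powers xs) f ≈ complete (n ∸ toℕ i) xs)
        (≡.sym (lookup-hs n i))
        (bounded b (n ∸ toℕ i) (ℕ.≤-trans (ℕ.m∸n≤m n (toℕ i)) (ℕ.s≤s⁻¹ n≤b)))

  -- h⟨ a ⟩ k is h_{k;a}.  In the summand i = i′ + 1, and k − i = n − i′.
  h⟨_⟩ : (ℤ → Carrier) → ℤ → SymFun
  h⟨ a ⟩ (+ zero)   = const 1#
  h⟨ a ⟩ (+ suc n)  = Λ-ops.sum λ (i′ : Fin (suc n)) →
    const ((- 1#) ^ (n ∸ toℕ i′)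
             * elementary (n ∸ toℕ i′) (map (λ m → a (+ suc m)) (upTo n)))
      ⊗ h (suc (toℕ i′))
  h⟨ a ⟩ -[1+ _ ]   = const 0#

  τ : ℤ → (ℤ → Carrier) → (ℤ → Carrier)
  τ r a i = a (i ℤ.+ r)

  -- Rows and columns are counted from 0, which leaves μᵢ − i + j unchanged
  -- and turns 1 − j into − j.
  s⟨_⟩ : (ℤ → Carrier) → YoungDiagram → ℕ → SymFun
  s⟨ a ⟩ μ N = Λ-ops.det {N} λ i j →
    h⟨ τ (ℤ.- + toℕ j) a ⟩ (+ part μ (toℕ i) ℤ.- + toℕ i ℤ.+ + toℕ j)

  a′ : (ℤ → Carrier) → ℤ′ → Carrier
  a′ a (m +½) = a (m ℤ.+ + 1)

  module _ (a : ℤ → Carrier) (u v : Carrier) where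

    sideFactor : Side → Carrier
    sideFactor s@(vertical _ _)   = u - a′ a (δ-ε s)
    sideFactor s@(horizontal _ _) = v + a′ a (δ-ε s)

    hookPolynomial : List Cell → Carrier
    hookPolynomial ν = (u + v) * prodList (map sideFactor (interiorSides ν))

    -- f_{ν;a}(u,v)
    polynomial : List Cell → Carrier
    polynomial ν = prodList (map hookPolynomial (components ν))

  -- The product over all k ≥ 1; beyond the largest entry of T the preimages
  -- are empty and the factors are 1.
  weight : (ℤ → Carrier) → ∀ μ → FiniteSequence → FiniteSequence →
           DiagonalStrictTableau μ → Carrier
  weight a μ x y T = prodList
    (map (λ k → polynomial a (coord x k) (coord y k) (preimage k)) (upTo (suc maxEntry)))
    where
    open FiniteSequence using (coord)
    open DiagonalStrictTableau T

{-# OPTIONS --safe #-}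
-- Adding a pair (u , v) of variables multiplies the generating function of the
-- hₖ by (1 + v z) / (1 − u z).  Hence the rows ρ p of the determinant s⟨ a ⟩,
-- indexed by the position p = μᵢ − i + N, satisfy
--   ρ (p + 1) = α p ρ p + (σ (p + 1) + β p σ p),
-- where the σ p are the rows for the old variables, α p = u − a (p − N) and
-- β p = v + a (p − N), so that α p + β p = u + v.  Subtracting from each row
-- a multiple of the next one leaves a combination of the σ m, m running from
-- the position of the next row to that of the row itself.  The determinant is
-- expanded in these: the terms with two equal rows vanish, and the others
-- belong to the ν ⊂ μ for which μ / ν has no 2 × 2 block.  A nonempty row of
-- μ / ν contributes, besides an α for each of its interior vertical sides, a
-- factor β for the side shared with the next row or, if there is none, a
-- factor u + v, that is one for each component of μ / ν.
-- Thus removing the variables one pair at a time produces the chains of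
-- shapes which are the diagonal-strict tableaux.

module Submission where

open import Algebra.Bundles using (CommutativeRing)
import Algebra.Properties.Ring as RingProperties
import Algebra.Properties.Semiring.Mult as Mult
import Algebra.Properties.Semiring.Sum as SemiringSum
import Algebra.Solver.Ring.NaturalCoefficients.Default as SemiringSolver
open import Data.Empty using (⊥-elim)
open import Data.Fin.Base using (Fin; toℕ; fromℕ<; punchIn) renaming (zero to fzero; suc to fsuc)
import Data.Fin.Properties as Fin
open import Data.Integer.Base as ℤ using (ℤ; +_; -[1+_])
import Data.Integer.Properties as ℤ
open import Data.List.Base as List
  using (List; []; _∷_; [_]; _++_; map; concat; concatMap; filter; partition; foldr; length;
         tabulate; allFin; upTo)
open import Data.List.Membership.DecPropositional using () renaming (_∈?_ to mem?)
open import Data.List.Membership.Propositional using (_∈_; _∉_; find; lose)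
open import Data.List.Membership.Propositional.Properties
  using (∈-map⁺; ∈-map⁻; ∈-++⁺ˡ; ∈-++⁺ʳ; ∈-++⁻; ∈-concatMap⁺; ∈-concatMap⁻; ∈-allFin; ∈-filter⁺)
import Data.List.Membership.Setoid as Membership
import Data.List.Properties as List
open import Data.List.Relation.Unary.All as All using (All; []; _∷_)
import Data.List.Relation.Unary.All.Properties as All
open import Data.List.Relation.Unary.AllPairs using ([]; _∷_)
open import Data.List.Relation.Unary.Any using (Any; any?; here; there)
open import Data.List.Relation.Unary.Linked using (Linked; []; [-]; _∷_)
open import Data.List.Relation.Unary.Unique.Propositional using (Unique)
import Data.List.Relation.Unary.Unique.Propositional.Properties as Unique
import Data.List.Relation.Unary.Unique.Setoid as UniqueSetoid
open import Data.Nat.Base as ℕ using (ℕ; zero; suc; pred; z≤n; _∸_; _<_; _≤_; _≥_)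
import Data.Nat.Properties as ℕ
open import Data.Product.Base using (Σ-syntax; ∃; _×_; _,_; proj₁; proj₂)
open import Data.Sum.Base using (_⊎_; inj₁; inj₂)
open import Data.Unit.Polymorphic.Base using (⊤; tt)
open import Data.Vec.Base as Vec using (Vec; []; _∷_)
open import Function.Base using (_∘_)
open import Level using (_⊔_)
open import Relation.Binary.Bundles using (Setoid)
open import Relation.Binary.PropositionalEquality as ≡ using (_≡_; _≢_)
import Relation.Binary.Reasoning.Setoid as SetoidReasoning
open import Relation.Nullary.Decidable using (Dec; yes; no)
open import Relation.Nullary.Negation using (¬_; contradiction)
open import Relation.Unary using (Decidable)
open import Defs

-- Skew shapes without 2 × 2 blocks

-- Whole rows obey a single recurrence because of the shifts built into s: column `j` uses the
-- sequence `τ (- j) a` at an index raised by `j`, and the two shifts cancel, leaving `a (p - N)` in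
-- every column. The branching rule can therefore treat the determinant as an abstract multilinear
-- form that vanishes when two adjacent rows agree. Terms disappear at two different stages. The
-- multiple of the next new row drops out while the lower rows are still unexpanded. The multiple of
-- the old row at the position of the next row can be judged only after the lower rows of ν are
-- chosen: it drops out exactly if the next row of λ / ν is empty, and otherwise yields the factor β
-- of a shared side. The removal of variables ends with none left, where the determinant is 1 for
-- the empty shape and 0 for every other. Although there are infinitely many tableaux, each nonempty
-- level carries a factor u + v, which is 0 beyond the last nonzero pair, so finitely many entries
-- matter.

module Partitions where
  open import Data.Nat.Base
  open import Data.Nat.Properties
  open ≡ using (refl; sym; trans; cong; cong₂)

  -- Partitions are vectors padded with zeros.
  at : ∀ {k} → Vec ℕ k → ℕ → ℕ
  at []       _       = 0
  at (l ∷ _)  zero    = l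
  at (_ ∷ ls) (suc r) = at ls r

  Decreasing : ∀ {k} → Vec ℕ k → Set
  Decreasing ls = ∀ r → at ls (suc r) ≤ at ls r

  infix 4 _◁_

  -- ν ◁ λ: both are partitions, ν ⊂ λ and λ / ν has no 2 × 2 block.
  record _◁_ {k} (ns ls : Vec ℕ k) : Set where
    field
      contained  : ∀ r → at ns r ≤ at ls r
      thin       : ∀ r → at ls (suc r) ≤ suc (at ns r)
      decreasing : Decreasing ns
  open _◁_ public

  ◁-tail : ∀ {k n l} {ns ls : Vec ℕ k} → n ∷ ns ◁ l ∷ ls → ns ◁ ls
  ◁-tail p = record
    { contained  = λ r → contained p (suc r)
    ; thin       = λ r → thin p (suc r)
    ; decreasing = λ r → decreasing p (suc r) }

  ◁-cons : ∀ {k n l} {ns ls : Vec ℕ k} → n ≤ l → at ls 0 ≤ suc n → at ns 0 ≤ n → ns ◁ ls → n ∷ ns ◁ l ∷ ls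
  ◁-cons p q s t = record
    { contained  = λ { zero → p ; (suc r) → contained t r }
    ; thin       = λ { zero → q ; (suc r) → thin t r }
    ; decreasing = λ { zero → s ; (suc r) → decreasing t r } }

  at-injective : ∀ {k} (ns ls : Vec ℕ k) → (∀ r → at ns r ≡ at ls r) → ns ≡ ls
  at-injective []       []       p = refl
  at-injective (n ∷ ns) (l ∷ ls) p = cong₂ _∷_ (p 0) (at-injective ns ls (λ r → p (suc r)))

  run : ℕ → ℕ → List ℕ
  run s zero    = []
  run s (suc n) = s ∷ run (suc s) n

  ∈-run⁻ : ∀ {x} s n → x ∈ run s n → s ≤ x × x < s + n
  ∈-run⁻ s (suc n) (here refl) = ≤-refl , m<m+n s z<s
  ∈-run⁻ s (suc n) (there p) with ∈-run⁻ (suc s) n p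
  ... | s<x , x< = <⇒≤ s<x , ≤-trans x< (≤-reflexive (sym (+-suc s n)))

  ∈-run⁺ : ∀ {x} s n → s ≤ x → x < s + n → x ∈ run s n
  ∈-run⁺ {x} s zero    s≤x x<s+n = ⊥-elim (<⇒≱ x<s+n (≤-trans (≤-reflexive (+-identityʳ s)) s≤x))
  ∈-run⁺ {x} s (suc n) s≤x x<s+n with m≤n⇒m<n∨m≡n s≤x
  ... | inj₁ s<x  = there (∈-run⁺ (suc s) n s<x (≤-trans x<s+n (≤-reflexive (+-suc s n))))
  ... | inj₂ refl = here refl

  run-unique : ∀ s n → Unique (run s n)
  run-unique s zero    = []
  run-unique s (suc n) =
    All.tabulate (λ x∈ s≡x → <-irrefl s≡x (proj₁ (∈-run⁻ (suc s) n x∈))) ∷ run-unique (suc s) n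

  -- The possible first rows n of ν, given the first row l of λ, and the second
  -- rows l₂ and n₂; n = l₂ − 1 means that row 1 of λ / ν touches row 2.
  heads : (l l₂ n₂ : ℕ) → List ℕ
  heads l l₂ n₂ with n₂ <? l₂
  ... | yes _ = pred l₂ ∷ run l₂ (suc (l ∸ l₂))
  ... | no  _ = run l₂ (suc (l ∸ l₂))

  private
    ∈-run-∸⁻ : ∀ {n} l l₂ → l₂ ≤ l → n ∈ run l₂ (suc (l ∸ l₂)) → l₂ ≤ n × n ≤ l
    ∈-run-∸⁻ l l₂ l₂≤l n∈ with ∈-run⁻ l₂ (suc (l ∸ l₂)) n∈
    ... | l₂≤n , n< = l₂≤n , ≤-trans (s≤s⁻¹ (≤-trans n< (≤-reflexive (+-suc l₂ (l ∸ l₂)))))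
        (≤-reflexive (m+[n∸m]≡n l₂≤l))

    ∈-run-∸⁺ : ∀ {n} l l₂ → l₂ ≤ n → n ≤ l → n ∈ run l₂ (suc (l ∸ l₂))
    ∈-run-∸⁺ l l₂ l₂≤n n≤l = ∈-run⁺ l₂ (suc (l ∸ l₂)) l₂≤n
      (≤-trans (s≤s n≤l) (≤-reflexive (trans (cong suc (sym (m+[n∸m]≡n (≤-trans l₂≤n n≤l))))
          (sym (+-suc l₂ (l ∸ l₂))))))

  ∈-heads⁻ : ∀ {n} l l₂ n₂ → n₂ ≤ l₂ → l₂ ≤ l → n ∈ heads l l₂ n₂ → n ≤ l × l₂ ≤ suc n × n₂ ≤ n
  ∈-heads⁻ l l₂ n₂ n₂≤l₂ l₂≤l n∈ with n₂ <? l₂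
  ∈-heads⁻ l (suc l₂) n₂ n₂≤l₂ l₂≤l (here refl) | yes p = ≤-trans (n≤1+n l₂) l₂≤l , ≤-refl , s≤s⁻¹ p
  ∈-heads⁻ l l₂ n₂ n₂≤l₂ l₂≤l (there n∈) | yes p with ∈-run-∸⁻ l l₂ l₂≤l n∈
  ... | l₂≤n , n≤l = n≤l , m≤n⇒m≤1+n l₂≤n , ≤-trans n₂≤l₂ l₂≤n
  ∈-heads⁻ l l₂ n₂ n₂≤l₂ l₂≤l n∈ | no p with ∈-run-∸⁻ l l₂ l₂≤l n∈
  ... | l₂≤n , n≤l = n≤l , m≤n⇒m≤1+n l₂≤n , ≤-trans n₂≤l₂ l₂≤n

  ∈-heads⁺ : ∀ {n} l l₂ n₂ → n ≤ l → l₂ ≤ suc n → n₂ ≤ n → n ∈ heads l l₂ n₂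
  ∈-heads⁺ l l₂ n₂ n≤l l₂≤1+n n₂≤n with n₂ <? l₂ | m≤n⇒m<n∨m≡n l₂≤1+n
  ... | yes p | inj₁ q    = there (∈-run-∸⁺ l l₂ (s≤s⁻¹ q) n≤l)
  ... | yes p | inj₂ refl = here refl
  ... | no ¬p | inj₁ q    = ∈-run-∸⁺ l l₂ (s≤s⁻¹ q) n≤l
  -- Here `l₂` is `suc n`, so `n₂ ≤ n` would make the next row of λ / ν nonempty.
  ... | no ¬p | inj₂ refl = ⊥-elim (¬p (s≤s n₂≤n))

  heads-unique : ∀ l l₂ n₂ → Unique (heads l l₂ n₂)
  heads-unique l l₂ n₂ with n₂ <? l₂
  ... | no  _ = run-unique l₂ (suc (l ∸ l₂))
  heads-unique l (suc l₂) n₂ | yes _ =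
    All.tabulate (λ x∈ l₂≡x → <-irrefl l₂≡x (proj₁ (∈-run⁻ (suc l₂) (suc (l ∸ suc l₂)) x∈)))
    ∷ run-unique (suc l₂) (suc (l ∸ suc l₂))

  -- The lower rows come first, since the possible first rows depend on the second row already
  -- chosen.
  choices : ∀ {k} → Vec ℕ k → List (Vec ℕ k)
  choices []       = [] ∷ []
  choices (l ∷ ls) = concatMap (λ ns → map (_∷ ns) (heads l (at ls 0) (at ns 0))) (choices ls)

  module _ {a b c} {A : Set a} {B : Set b} {C : Set c} (f : A → List B) (g : A → B → C) where

    -- An enumeration of dependent pairs. Both `choices` and `chains` have this form, so membership
    -- and absence of repetitions are settled once for the two.
    pairsWith : List A → List C
    pairsWith = concatMap (λ x → map (g x) (f x))

    ∈-pairsWith⁺ : ∀ {x y xs} → x ∈ xs → y ∈ f x → g x y ∈ pairsWith xs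
    ∈-pairsWith⁺ {x} {y} {xs} x∈ y∈ = ∈-concatMap⁺ (λ x → map (g x) (f x)) (lose x∈ (∈-map⁺ (g x) y∈))

    ∈-pairsWith⁻ : ∀ {z} xs → z ∈ pairsWith xs → ∃ λ x → ∃ λ y → x ∈ xs × y ∈ f x × z ≡ g x y
    ∈-pairsWith⁻ {z} xs z∈ with find (∈-concatMap⁻ (λ x → map (g x) (f x)) z∈)
    ... | x , x∈ , p with ∈-map⁻ (g x) p
    ... | y , y∈ , q = x , y , x∈ , y∈ , q

    pairsWith-unique : (∀ {x x′ y y′} → g x y ≡ g x′ y′ → x ≡ x′ × y ≡ y′) → (∀ x → Unique (f x)) →
                       ∀ {xs} → Unique xs → Unique (pairsWith xs)
    pairsWith-unique inj f-unique []       = []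
    pairsWith-unique inj f-unique {x ∷ xs} (x∉ ∷ xs-unique) = Unique.++⁺
      (Unique.map⁺ (λ eq → proj₂ (inj eq)) (f-unique x))
      (pairsWith-unique inj f-unique xs-unique)
      (λ { (p , q) → disjoint p q })
      where
      disjoint : ∀ {z} → z ∈ map (g x) (f x) → ¬ z ∈ pairsWith xs
      disjoint p q with ∈-map⁻ (g x) p | ∈-pairsWith⁻ xs q
      ... | y , _ , eq | x′ , y′ , x′∈ , _ , eq′ =
        All.lookup x∉ x′∈ (proj₁ (inj (trans (sym eq) eq′)))

  choices-sound : ∀ {k} {ls : Vec ℕ k} → Decreasing ls → ∀ {ns} → ns ∈ choices ls → ns ◁ ls
  choices-sound {ls = []} dec {[]} _ =
    record { contained = λ _ → z≤n ; thin = λ _ → z≤n ; decreasing = λ _ → z≤n }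
  choices-sound {ls = l ∷ ls} dec ns∈
    with ∈-pairsWith⁻ (λ ns → heads l (at ls 0) (at ns 0)) (λ ns n → n ∷ ns) (choices ls) ns∈
  ... | ns , n , ns∈′ , n∈ , refl with choices-sound (λ r → dec (suc r)) ns∈′
  ... | ns◁ls with ∈-heads⁻ l (at ls 0) (at ns 0) (contained ns◁ls 0) (dec 0) n∈
  ... | p , q , s = ◁-cons p q s ns◁ls

  choices-complete : ∀ {k} {ns ls : Vec ℕ k} → ns ◁ ls → ns ∈ choices ls
  choices-complete {ns = []}     {[]}     _ = here refl
  choices-complete {ns = n ∷ ns} {l ∷ ls} p = ∈-pairsWith⁺ _ (λ ns n → n ∷ ns)
    (choices-complete (◁-tail p)) (∈-heads⁺ l (at ls 0) (at ns 0) (contained p 0) (thin p 0) (decreasing p 0))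

  choices-unique : ∀ {k} (ls : Vec ℕ k) → Unique (choices ls)
  choices-unique []       = [] ∷ []
  choices-unique (l ∷ ls) = pairsWith-unique _ (λ ns n → n ∷ ns) (λ { refl → refl , refl })
    (λ ns → heads-unique l (at ls 0) (at ns 0)) (choices-unique ls)

open Partitions

-- Finite sums and determinants

-- Both sides skip exactly the columns `j` and `j′`: `k` is the place of `j′` after the removal of
-- `j`, and `k′` that of `j` after the removal of `j′`.
punchIn-swap : ∀ {n} (j : Fin (suc (suc n))) k j′ k′ → punchIn j k ≡ j′ → punchIn j′ k′ ≡ j →
               ∀ x → punchIn j (punchIn k x) ≡ punchIn j′ (punchIn k′ x)
punchIn-swap fzero k _ fzero ≡.refl q x = ≡.refl
punchIn-swap (fsuc j) fzero _ k′ ≡.refl q x with Fin.suc-injective q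
... | ≡.refl = ≡.refl
punchIn-swap (fsuc j) (fsuc k) _ (fsuc k′) ≡.refl q fzero = ≡.refl
punchIn-swap {suc n} (fsuc j) (fsuc k) _ (fsuc k′) ≡.refl q (fsuc x) =
  ≡.cong fsuc (punchIn-swap j k _ k′ ≡.refl (Fin.suc-injective q) x)

module RingSums {c ℓ} (K : CommutativeRing c ℓ) where
  open CommutativeRing K
  open RingOps K
  open SemiringSum semiring using (*-distribˡ-sum; sum-cong-≋; ∑-distrib-+)
  open SetoidReasoning setoid
  open SemiringSolver commutativeSemiring using (solve; _:=_; _:+_; _:*_) public

  sum-zero : ∀ n (f : Fin n → Carrier) → (∀ i → f i ≈ 0#) → sum f ≈ 0#
  sum-zero zero    f f≈0 = refl
  sum-zero (suc n) f f≈0 =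
    trans (+-cong (f≈0 fzero) (sum-zero n (λ i → f (fsuc i)) (λ i → f≈0 (fsuc i)))) (+-identityˡ 0#)

  ∑ˡ : ∀ {a} {A : Set a} → List A → (A → Carrier) → Carrier
  ∑ˡ xs f = sumList (map f xs)

  ∑ˡ-cong : ∀ {a} {A : Set a} xs {f g : A → Carrier} → All (λ x → f x ≈ g x) xs → ∑ˡ xs f ≈ ∑ˡ xs g
  ∑ˡ-cong []       []       = refl
  ∑ˡ-cong (x ∷ xs) (p ∷ ps) = +-cong p (∑ˡ-cong xs ps)

  ∑ˡ-++ : ∀ {a} {A : Set a} xs ys (f : A → Carrier) → ∑ˡ (xs ++ ys) f ≈ ∑ˡ xs f + ∑ˡ ys f
  ∑ˡ-++ []       ys f = sym (+-identityˡ _)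
  ∑ˡ-++ (x ∷ xs) ys f = trans (+-congˡ (∑ˡ-++ xs ys f)) (sym (+-assoc _ _ _))

  ∑ˡ-map : ∀ {a b} {A : Set a} {B : Set b} (g : A → B) xs (f : B → Carrier) →
           ∑ˡ (map g xs) f ≡ ∑ˡ xs (λ x → f (g x))
  ∑ˡ-map g []       f = ≡.refl
  ∑ˡ-map g (x ∷ xs) f = ≡.cong (λ s → f (g x) + s) (∑ˡ-map g xs f)

  ∑ˡ-concatMap : ∀ {a b} {A : Set a} {B : Set b} (g : A → List B) xs (f : B → Carrier) →
                 ∑ˡ (concatMap g xs) f ≈ ∑ˡ xs (λ x → ∑ˡ (g x) f)
  ∑ˡ-concatMap g []       f = refl
  ∑ˡ-concatMap g (x ∷ xs) f =
    trans (∑ˡ-++ (g x) (concatMap g xs) f) (+-congˡ (∑ˡ-concatMap g xs f))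

  ∑ˡ-distribˡ : ∀ {a} {A : Set a} s xs (f : A → Carrier) → s * ∑ˡ xs f ≈ ∑ˡ xs (λ x → s * f x)
  ∑ˡ-distribˡ s []       f = zeroʳ s
  ∑ˡ-distribˡ s (x ∷ xs) f = trans (distribˡ s _ _) (+-congˡ (∑ˡ-distribˡ s xs f))

  ∑ˡ-+ : ∀ {a} {A : Set a} xs (f g : A → Carrier) → ∑ˡ xs f + ∑ˡ xs g ≈ ∑ˡ xs (λ x → f x + g x)
  ∑ˡ-+ []       f g = +-identityˡ _
  ∑ˡ-+ (x ∷ xs) f g = trans
    (solve 4 (λ p q r s → (p :+ q :+ (r :+ s)) := (p :+ r :+ (q :+ s))) refl (f x) (∑ˡ xs f) (g x) (∑ˡ xs g))
    (+-congˡ (∑ˡ-+ xs f g))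

  ∑ˡ-zero : ∀ {a} {A : Set a} (xs : List A) → ∑ˡ xs (λ _ → 0#) ≈ 0#
  ∑ˡ-zero []       = refl
  ∑ˡ-zero (x ∷ xs) = trans (+-identityˡ _) (∑ˡ-zero xs)

  ∑ˡ-swap : ∀ {a b} {A : Set a} {B : Set b} xs ys (f : A → B → Carrier) →
            ∑ˡ xs (λ x → ∑ˡ ys (f x)) ≈ ∑ˡ ys (λ y → ∑ˡ xs (λ x → f x y))
  ∑ˡ-swap []       ys f = sym (∑ˡ-zero ys)
  ∑ˡ-swap (x ∷ xs) ys f = trans (+-congˡ (∑ˡ-swap xs ys f)) (∑ˡ-+ ys (f x) _)

  module _ {n : ℕ} where

    ∑-cong : (f g : Fin n → Carrier) → (∀ i → f i ≈ g i) → sum f ≈ sum g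
    ∑-cong f g p = sum-cong-≋ {n} p

    -- The Laplace expansion in `det` is definitionally of this form, with signs `s`, first row `ρ`
    -- and minors `d`.
    weightedSum : (s ρ d : Fin n → Carrier) → Carrier
    weightedSum s ρ d = ∑[ j < n ] ((s j * ρ j) * d j)

    weightedSum-cong : ∀ s {ρ σ d e} → (∀ j → ρ j ≈ σ j) → (∀ j → d j ≈ e j) →
                       weightedSum s ρ d ≈ weightedSum s σ e
    weightedSum-cong s p q = sum-cong-≋ {n} (λ j → *-cong (*-congˡ (p j)) (q j))

    weightedSum-+ : ∀ s ρ σ d → weightedSum s (λ j → ρ j + σ j) d ≈ weightedSum s ρ d + weightedSum s σ d
    weightedSum-+ s ρ σ d = trans
      (sum-cong-≋ {n} (λ j → trans (*-congʳ (distribˡ (s j) (ρ j) (σ j))) (distribʳ (d j) _ _)))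
      (∑-distrib-+ {n} (λ j → s j * ρ j * d j) (λ j → s j * σ j * d j))

    weightedSum-* : ∀ s x ρ d → weightedSum s (λ j → x * ρ j) d ≈ x * weightedSum s ρ d
    weightedSum-* s x ρ d = trans
      (sum-cong-≋ {n} (λ j →
        solve 4 (λ s x r d → ((s :* (x :* r)) :* d) := (x :* ((s :* r) :* d))) refl (s j) x (ρ j) (d j)))
      (sym (*-distribˡ-sum {n} x (λ j → s j * ρ j * d j)))

  det-cong : ∀ {n} {A B : Fin n → Fin n → Carrier} → (∀ i j → A i j ≈ B i j) → det A ≈ det B
  det-cong {zero}  p = refl
  det-cong {suc n} p = weightedSum-cong (λ j → (- 1#) ^ toℕ j) (p fzero)
    (λ j → det-cong (λ i k → p (fsuc i) (punchIn j k)))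

-- Alternating multilinear forms, and the determinant as one of them

module Forms {c ℓ} (K : CommutativeRing c ℓ) where
  open CommutativeRing K
  open RingOps K
  open RingSums K
  open RingProperties ring using (-‿distribʳ-*; -1*x≈-x; -0#≈0#)
  open SemiringSum semiring using (*-distribˡ-sum; sum-cong-≋; ∑-distrib-+)
  open SetoidReasoning setoid

  Row : Set → Set c
  Row X = X → Carrier

  module _ {X : Set} where

    infix 4 _≐_
    _≐_ : Row X → Row X → Set ℓ
    ρ ≐ σ = ∀ x → ρ x ≈ σ x

    infixl 6 _⊞_
    infixr 7 _⊡_
    _⊞_ : Row X → Row X → Row X
    (ρ ⊞ σ) x = ρ x + σ x

    _⊡_ : Carrier → Row X → Row X
    (s ⊡ ρ) x = s * ρ x

    0ʳ : Row X
    0ʳ _ = 0#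

    -- `ρ` stands for the argument just before those of `Φ`; with no argument left there is nothing
    -- to compare it with.
    AdjacentEqual : ∀ {k} → (Vec (Row X) k → Carrier) → Row X → Set (c ⊔ ℓ)
    AdjacentEqual {zero}  Φ ρ = ⊤
    AdjacentEqual {suc k} Φ ρ = ∀ ρs → Φ (ρ ∷ ρs) ≈ 0#

    -- The conditions speak of the first argument, and the last of them passes to the form that
    -- remains once it is fixed, in step with expansion from the top row. Alternation is asked for
    -- adjacent arguments only, the case that the branching rule meets.
    IsForm : ∀ k → (Vec (Row X) k → Carrier) → Set (c ⊔ ℓ)
    IsForm zero    Φ = ⊤
    IsForm (suc k) Φ =
        (∀ {ρ σ} → ρ ≐ σ → ∀ ρs → Φ (ρ ∷ ρs) ≈ Φ (σ ∷ ρs))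
      × (∀ ρ σ ρs → Φ (ρ ⊞ σ ∷ ρs) ≈ Φ (ρ ∷ ρs) + Φ (σ ∷ ρs))
      × (∀ s ρ ρs → Φ (s ⊡ ρ ∷ ρs) ≈ s * Φ (ρ ∷ ρs))
      × (∀ ρ → AdjacentEqual (λ ρs → Φ (ρ ∷ ρs)) ρ)
      × (∀ ρ → IsForm k (λ ρs → Φ (ρ ∷ ρs)))

  linear-0 : ∀ {X k} {Φ : Vec (Row X) (suc k) → Carrier} → IsForm (suc k) Φ →
             ∀ {ρ} → ρ ≐ 0ʳ → ∀ ρs → Φ (ρ ∷ ρs) ≈ 0#
  linear-0 {Φ = Φ} (cong , _ , scale , _) {ρ} ρ≐0 ρs = begin
    Φ (ρ ∷ ρs)         ≈⟨ cong (λ x → trans (ρ≐0 x) (sym (zeroˡ (ρ x)))) ρs ⟩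
    Φ (0# ⊡ ρ ∷ ρs)    ≈⟨ scale 0# ρ ρs ⟩
    0# * Φ (ρ ∷ ρs)    ≈⟨ zeroˡ _ ⟩
    0#                 ∎

  adjacentEqual-cong : ∀ {X} k {Φ Ψ : Vec (Row X) k → Carrier} {ρ} → (∀ ρs → Φ ρs ≈ Ψ ρs) →
                       AdjacentEqual Φ ρ → AdjacentEqual Ψ ρ
  adjacentEqual-cong zero    p _ = tt
  adjacentEqual-cong (suc k) p q = λ ρs → trans (sym (p _)) (q ρs)

  adjacentEqual-combination : ∀ {X} k {n} {ρ} (t : Fin n → Carrier) (Φ : Fin n → Vec (Row X) k → Carrier) →
    (∀ j → AdjacentEqual (Φ j) ρ) → AdjacentEqual (λ ρs → ∑[ j < n ] (t j * Φ j ρs)) ρ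
  adjacentEqual-combination zero    t Φ p = tt
  adjacentEqual-combination (suc k) {n} t Φ p = λ ρs →
    sum-zero n _ (λ j → trans (*-congˡ (p j ρs)) (zeroʳ (t j)))

  isForm-combination : ∀ {X} k {n} (t : Fin n → Carrier) (Φ : Fin n → Vec (Row X) k → Carrier) →
    (∀ j → IsForm k (Φ j)) → IsForm k (λ ρs → ∑[ j < n ] (t j * Φ j ρs))
  isForm-combination zero    t Φ p = tt
  isForm-combination (suc k) {n} t Φ p =
      (λ ρ≐σ ρs → sum-cong-≋ {n} (λ j → *-congˡ (proj₁ (p j) ρ≐σ ρs)))
    , (λ ρ σ ρs → trans
         (sum-cong-≋ {n} (λ j → trans (*-congˡ (proj₁ (proj₂ (p j)) ρ σ ρs)) (distribˡ (t j) _ _)))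
         (∑-distrib-+ {n} (λ j → t j * Φ j (ρ ∷ ρs)) (λ j → t j * Φ j (σ ∷ ρs))))
    , (λ s ρ ρs → trans
         (sum-cong-≋ {n} (λ j → trans (*-congˡ (proj₁ (proj₂ (proj₂ (p j))) s ρ ρs))
           (solve 3 (λ a b d → (a :* (b :* d)) := (b :* (a :* d))) refl (t j) s (Φ j (ρ ∷ ρs)))))
         (sym (*-distribˡ-sum {n} s (λ j → t j * Φ j (ρ ∷ ρs)))))
    , (λ ρ → adjacentEqual-combination k t (λ j ρs → Φ j (ρ ∷ ρs))
         (λ j → proj₁ (proj₂ (proj₂ (proj₂ (p j)))) ρ))
    , (λ ρ → isForm-combination k t (λ j ρs → Φ j (ρ ∷ ρs))
         (λ j → proj₂ (proj₂ (proj₂ (proj₂ (p j)))) ρ))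

  restrict : ∀ {X Y : Set} → (Y → X) → Row X → Row Y
  restrict φ ρ y = ρ (φ y)

  isForm-restrict : ∀ {X Y} (φ : Y → X) k {Φ : Vec (Row Y) k → Carrier} → IsForm k Φ →
                    IsForm k (λ ρs → Φ (Vec.map (restrict φ) ρs))
  isForm-restrict φ zero    p = tt
  isForm-restrict φ (suc k) {Φ} (cong , add , scale , alt , rest) =
      (λ ρ≐σ ρs → cong (λ y → ρ≐σ (φ y)) _)
    , (λ ρ σ ρs → add _ _ _)
    , (λ s ρ ρs → scale s _ _)
    , (λ ρ → adj k (λ ρs → Φ (restrict φ ρ ∷ ρs)) ρ (alt (restrict φ ρ)))
    , (λ ρ → isForm-restrict φ k (rest (restrict φ ρ)))
    where
    adj : ∀ k Ψ ρ → AdjacentEqual {k = k} Ψ (restrict φ ρ) →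
          AdjacentEqual (λ ρs → Ψ (Vec.map (restrict φ) ρs)) ρ
    adj zero    Ψ ρ p = tt
    adj (suc k) Ψ ρ p = λ ρs → p _

  sign : ℕ → Carrier
  sign j = (- 1#) ^ j

  signedSum : ∀ {n} → (Fin n → Carrier) → Carrier
  signedSum {n} f = ∑[ j < n ] (sign (toℕ j) * f j)

  signedSum-cong : ∀ {n} {f g : Fin n → Carrier} → (∀ j → f j ≈ g j) → signedSum f ≈ signedSum g
  signedSum-cong {n} p = sum-cong-≋ {n} (λ j → *-congˡ (p j))

  signedSum-fsuc : ∀ {n} (f : Fin n → Carrier) →
    ∑[ j < n ] (sign (toℕ (fsuc j)) * f j) ≈ - signedSum f
  signedSum-fsuc {n} f = begin
    ∑[ j < n ] (- 1# * sign (toℕ j) * f j)     ≈⟨ sum-cong-≋ {n} (λ j → *-assoc _ _ _) ⟩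
    ∑[ j < n ] (- 1# * (sign (toℕ j) * f j))   ≈⟨ *-distribˡ-sum {n} (- 1#) (λ j → sign (toℕ j) * f j) ⟨
    - 1# * signedSum f                         ≈⟨ -1*x≈-x _ ⟩
    - signedSum f                              ∎

  -- The pairs (j, k) and (punchIn j k, its position after j is removed)
  -- cancel.
  alternating-sum : ∀ n (g : Fin (suc n) → Fin n → Carrier) →
    (∀ j k j′ k′ → punchIn j k ≡ j′ → punchIn j′ k′ ≡ j → g j k ≈ g j′ k′) →
    signedSum (λ j → signedSum (g j)) ≈ 0#
  alternating-sum zero    g symm = trans (+-identityʳ _) (zeroʳ _)
  alternating-sum (suc n) g symm = begin
    sign 0 * first + ∑[ j < suc n ] (sign (toℕ (fsuc j)) * signedSum (g (fsuc j)))
      ≈⟨ +-cong (*-identityˡ _) (trans (signedSum-fsuc (λ j → signedSum (g (fsuc j))))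
           (-‿cong (trans (signedSum-cong step) (signedSum-+- (g fzero) rest)))) ⟩
    first + - (first + - signedSum rest)
      ≈⟨ +-congˡ (-‿cong (trans (+-congˡ (trans (-‿cong vanishing) -0#≈0#)) (+-identityʳ _))) ⟩
    first + - first
      ≈⟨ -‿inverseʳ _ ⟩
    0# ∎
    where
    first : Carrier
    first = signedSum (g fzero)
    rest : Fin (suc n) → Carrier
    rest j = signedSum (λ k → g (fsuc j) (fsuc k))
    -- The pairs with `j = 0` and those with `k = 0` contribute `first` with opposite signs; the
    -- remaining pairs form the same double sum with one column fewer.
    vanishing : signedSum rest ≈ 0#
    vanishing = alternating-sum n (λ j k → g (fsuc j) (fsuc k))
      (λ j k j′ k′ p q → symm (fsuc j) (fsuc k) (fsuc j′) (fsuc k′) (≡.cong fsuc p) (≡.cong fsuc q))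
    step : ∀ j → signedSum (g (fsuc j)) ≈ g fzero j + - rest j
    step j = +-cong (trans (*-identityˡ _) (symm (fsuc j) fzero fzero j ≡.refl ≡.refl))
                    (signedSum-fsuc (λ k → g (fsuc j) (fsuc k)))
    signedSum-+- : ∀ {n} (f h : Fin n → Carrier) →
      signedSum (λ j → f j + - h j) ≈ signedSum f + - signedSum h
    signedSum-+- {n} f h = begin
      ∑[ j < n ] (sign (toℕ j) * (f j + - h j))
        ≈⟨ sum-cong-≋ {n} (λ j → trans (distribˡ _ _ _) (+-congˡ (sym (trans (*-assoc _ _ _)
             (trans (-1*x≈-x _) (-‿distribʳ-* _ _)))))) ⟩
      ∑[ j < n ] (sign (toℕ j) * f j + sign (toℕ (fsuc j)) * h j)
        ≈⟨ ∑-distrib-+ {n} (λ j → sign (toℕ j) * f j) (λ j → sign (toℕ (fsuc j)) * h j) ⟩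
      signedSum f + ∑[ j < n ] (sign (toℕ (fsuc j)) * h j)
        ≈⟨ +-congˡ (signedSum-fsuc h) ⟩
      signedSum f + - signedSum h ∎

  detᵛ : ∀ {n} → Vec (Row (Fin n)) n → Carrier
  detᵛ ρs = det (λ i j → Vec.lookup ρs i j)

  private
    lookup-restrict : ∀ {X Y : Set} (φ : Y → X) {k} (ρs : Vec (Row X) k) i y →
      Vec.lookup ρs i (φ y) ≡ Vec.lookup (Vec.map (restrict φ) ρs) i y
    lookup-restrict φ (ρ ∷ ρs) fzero    y = ≡.refl
    lookup-restrict φ (ρ ∷ ρs) (fsuc i) y = lookup-restrict φ ρs i y

    signs : ∀ {n} → Fin n → Carrier
    signs j = sign (toℕ j)

    minor : ∀ {n} → Vec (Row (Fin (suc n))) n → Fin (suc n) → Carrier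
    minor ρs j = det (λ i k → Vec.lookup ρs i (punchIn j k))

  detᵛ-expand : ∀ {n} ρ (ρs : Vec (Row (Fin (suc n))) n) →
    weightedSum signs ρ (λ j → detᵛ (Vec.map (restrict (punchIn j)) ρs)) ≈ detᵛ (ρ ∷ ρs)
  detᵛ-expand {n} ρ ρs = weightedSum-cong signs {ρ = ρ} (λ _ → refl) (λ j →
    det-cong (λ i k → reflexive (≡.sym (lookup-restrict (punchIn j) ρs i k))))

  isForm-cong : ∀ {X} k {Φ Ψ : Vec (Row X) k → Carrier} → (∀ ρs → Φ ρs ≈ Ψ ρs) → IsForm k Φ → IsForm k Ψ
  isForm-cong zero    p q = tt
  isForm-cong (suc k) p (cong , add , scale , alt , rest) =
      (λ ρ≐σ ρs → trans (sym (p _)) (trans (cong ρ≐σ ρs) (p _)))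
    , (λ ρ σ ρs → trans (sym (p _)) (trans (add ρ σ ρs) (+-cong (p _) (p _))))
    , (λ s ρ ρs → trans (sym (p _)) (trans (scale s ρ ρs) (*-congˡ (p _))))
    , (λ ρ → adjacentEqual-cong k (λ ρs → p (ρ ∷ ρs)) (alt ρ))
    , (λ ρ → isForm-cong k (λ ρs → p (ρ ∷ ρs)) (rest ρ))

  weightedSum-signed : ∀ {m n} (ρ : Fin m → Carrier) (τ d : Fin m → Fin n → Carrier) →
    weightedSum signs ρ (λ j → weightedSum signs (τ j) (d j)) ≈
    signedSum (λ j → signedSum (λ k → ρ j * τ j k * d j k))
  weightedSum-signed {m} {n} ρ τ d = sum-cong-≋ {m} (λ j → trans (*-assoc _ _ _) (*-congˡ
    (trans (*-distribˡ-sum {n} (ρ j) (λ k → signs k * τ j k * d j k))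
      (sum-cong-≋ {n} (λ k →
        solve 4 (λ a b d e → (a :* ((b :* d) :* e)) := (b :* (a :* d :* e)))
          refl (ρ j) (signs k) (τ j k) (d j k))))))

  -- Expansion along both rows gives a signed sum over ordered pairs of columns. Its summand, two
  -- entries of `ρ` times the minor without both columns, does not change when the columns are
  -- exchanged, so `alternating-sum` applies.
  det-equal-rows : ∀ {n} ρ (ρs : Vec (Row (Fin (suc (suc n)))) n) → detᵛ (ρ ∷ ρ ∷ ρs) ≈ 0#
  det-equal-rows {n} ρ ρs = trans
    (weightedSum-signed ρ (λ j k → ρ (punchIn j k)) minor₂)
    (alternating-sum (suc n) (λ j k → ρ j * ρ (punchIn j k) * minor₂ j k)
      (λ { j k _ k′ ≡.refl q → *-cong
           (trans (*-comm _ _) (*-congˡ (reflexive (≡.cong ρ (≡.sym q)))))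
           (det-cong (λ i x → reflexive (≡.cong (Vec.lookup ρs i)
             (punchIn-swap j k _ k′ ≡.refl q x)))) }))
    where
    minor₂ : Fin (suc (suc n)) → Fin (suc n) → Carrier
    minor₂ j k = det (λ i x → Vec.lookup ρs i (punchIn j (punchIn k x)))

  -- With the first row fixed, the determinant is a linear combination of smaller determinants, each
  -- of which sees the other rows through the columns kept by `punchIn j`. Restriction of columns
  -- and linear combination both preserve forms.
  detᵛ-isForm : ∀ n → IsForm n (detᵛ {n})
  detᵛ-isForm zero    = tt
  detᵛ-isForm (suc n) =
      (λ ρ≐σ ρs → weightedSum-cong signs {d = minor ρs} ρ≐σ (λ _ → refl))
    , (λ ρ σ ρs → weightedSum-+ signs ρ σ (minor ρs))
    , (λ s ρ ρs → weightedSum-* signs s ρ (minor ρs))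
    , adj n
    , (λ ρ → isForm-cong n (detᵛ-expand ρ)
         (isForm-combination n (λ j → signs j * ρ j) (λ j ρs → detᵛ (Vec.map (restrict (punchIn j)) ρs))
           (λ j → isForm-restrict (punchIn j) n (detᵛ-isForm n))))
    where
    adj : ∀ n ρ → AdjacentEqual {k = n} (λ ρs → detᵛ (ρ ∷ ρs)) ρ
    adj zero    ρ = tt
    adj (suc n) ρ = det-equal-rows ρ

-- The branching rule for an alternating form

module Rows {c ℓ} (K : CommutativeRing c ℓ) where
  open CommutativeRing K
  open Forms K

  -- A row of length l followed by k more rows lies at position 1 + l + k; below
  -- the last row there is the zero row, at position 0.
  rowsAt : ∀ {X k} → (ℕ → Row X) → Vec ℕ k → Vec (Row X) k
  rowsAt ρ []                 = []
  rowsAt ρ (_∷_ {n = k} l ls) = ρ (suc (l ℕ.+ k)) ∷ rowsAt ρ ls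

  -- The position `at ls 0 + k` is that of the first row of `ls`, so two adjacent arguments
  -- coincide. If `ls` is empty it is position 0, where the row is zero.
  repeated-row : ∀ {X k} {Φ : Vec (Row X) (suc k) → Carrier} → IsForm (suc k) Φ →
    ∀ ρ → ρ 0 ≐ 0ʳ → (ls : Vec ℕ k) → Φ (ρ (at ls 0 ℕ.+ k) ∷ rowsAt ρ ls) ≈ 0#
  repeated-row {Φ = Φ} form ρ ρ-0 [] = linear-0 {Φ = Φ} form ρ-0 []
  repeated-row {Φ = Φ} (_ , _ , _ , alt , _) ρ ρ-0 (_∷_ {n = k} l ls) =
    ≡.subst (λ p → Φ (ρ p ∷ ρ (suc (l ℕ.+ k)) ∷ rowsAt ρ ls) ≈ 0#) (≡.sym (ℕ.+-suc l k))
      (alt (ρ (suc (l ℕ.+ k))) (rowsAt ρ ls))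

module Branching {c ℓ} (K : CommutativeRing c ℓ)
  (α β : ℕ → CommutativeRing.Carrier K) (t : CommutativeRing.Carrier K) where
  open CommutativeRing K
  open RingOps K
  open RingSums K
  open Forms K
  open Rows K
  open SetoidReasoning setoid

  ∏α : ℕ → ℕ → Carrier
  ∏α s zero    = 1#
  ∏α s (suc n) = α s * ∏α (suc s) n

  -- The contribution of a row of n boxes of λ / ν which does not touch the
  -- next row; s is the position of the row of ν.
  freeRow : ℕ → ℕ → Carrier
  freeRow s zero    = 1#
  freeRow s (suc n) = t * ∏α (suc s) n

  -- The row occupies the columns from `n` on, and the last box of the next row has column `l₂ - 1`.
  -- The test thus asks whether the leftmost box of the row lies above that last box.
  rowWeight : (k l l₂ n : ℕ) → Carrier
  rowWeight k l l₂ n with suc n ℕ.≟ l₂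
  ... | yes _ = β (suc (n ℕ.+ k)) * ∏α (suc (suc (n ℕ.+ k))) (l ∸ l₂)
  ... | no  _ = freeRow (suc (n ℕ.+ k)) (l ∸ n)

  skewWeight : ∀ {k} (ls ns : Vec ℕ k) → Carrier
  skewWeight []       []                 = 1#
  skewWeight (l ∷ ls) (_∷_ {n = k} n ns) = rowWeight k l (at ls 0) n * skewWeight ls ns

  rowWeight-unlinked : ∀ k l l₂ n → l₂ ≤ n → rowWeight k l l₂ n ≡ freeRow (suc (n ℕ.+ k)) (l ∸ n)
  rowWeight-unlinked k l l₂ n l₂≤n with suc n ℕ.≟ l₂
  ... | yes p = ⊥-elim (ℕ.<-irrefl (≡.sym p) (ℕ.s≤s l₂≤n))
  ... | no  _ = ≡.refl

  rowWeight-linked : ∀ k l n → rowWeight k l (suc n) n ≡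
                     β (suc (n ℕ.+ k)) * ∏α (suc (suc (n ℕ.+ k))) (l ∸ suc n)
  rowWeight-linked k l n with suc n ℕ.≟ suc n
  ... | yes _ = ≡.refl
  ... | no ¬p = ⊥-elim (¬p ≡.refl)

  module _ (α+β : ∀ i → α i + β i ≈ t) where

    -- The recurrence is applied downwards from position `suc (l + k)` to `s + k`. At an
    -- intermediate position the value of `y` is met twice, with β left over from the step above and
    -- with α from the expansion of `x`; their sum is `t`, whence the factor `t` in `freeRow`.
    telescope : (x y : ℕ → Carrier) → (∀ p → x (suc p) ≈ α p * x p + (y (suc p) + β p * y p)) →
      ∀ k l n s → l ≡ s ℕ.+ n → x (suc (l ℕ.+ k)) ≈
        ∏α (s ℕ.+ k) (suc n) * x (s ℕ.+ k) +
        ((β (s ℕ.+ k) * ∏α (suc (s ℕ.+ k)) n) * y (s ℕ.+ k) +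
         ∑ˡ (run s (suc n)) (λ m → freeRow (suc (m ℕ.+ k)) (l ∸ m) * y (suc (m ℕ.+ k))))
    telescope x y step k l zero s eq with ≡.trans eq (ℕ.+-identityʳ s)
    ... | ≡.refl = begin
      x (suc q)                                  ≈⟨ step q ⟩
      α q * x q + (y (suc q) + β q * y q)
        ≈⟨ solve 6 (λ a x y′ b y u → a :* x :+ (y′ :+ b :* y) := a :* x :+ (b :* y :+ y′)) refl
             (α q) (x q) (y (suc q)) (β q) (y q) 1# ⟩
      α q * x q + (β q * y q + y (suc q))
        ≈⟨ +-cong (*-congʳ (*-identityʳ _)) (+-cong (*-congʳ (*-identityʳ _))
             (trans (+-identityʳ _) (trans (*-congʳ (reflexive
               (≡.cong (freeRow (suc q)) (ℕ.n∸n≡0 s)))) (*-identityˡ _)))) ⟨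
      (α q * 1#) * x q + ((β q * 1#) * y q + (freeRow (suc q) (s ∸ s) * y (suc q) + 0#)) ∎
      where q = s ℕ.+ k
    telescope x y step k l (suc n) s eq = begin
      x (suc (l ℕ.+ k))
        ≈⟨ telescope x y step k l n (suc s) eq′ ⟩
      (α (suc q) * P) * x (suc q) + ((β (suc q) * P) * y (suc q) + S)
        ≈⟨ +-congʳ (*-congˡ (step q)) ⟩
      (α (suc q) * P) * (α q * x q + (y (suc q) + β q * y q)) + ((β (suc q) * P) * y (suc q) + S)
        ≈⟨ solve 9 (λ a′ P a x y′ b y b′ S →
             (a′ :* P) :* (a :* x :+ (y′ :+ b :* y)) :+ ((b′ :* P) :* y′ :+ S)
             := (a :* (a′ :* P)) :* x :+ ((b :* (a′ :* P)) :* y :+ (((a′ :+ b′) :* P) :* y′ :+ S)))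
             refl (α (suc q)) P (α q) (x q) (y (suc q)) (β q) (y q) (β (suc q)) S ⟩
      ∏α q (suc (suc n)) * x q + ((β q * ∏α (suc q) (suc n)) * y q
        + (((α (suc q) + β (suc q)) * P) * y (suc q) + S))
        ≈⟨ +-congˡ (+-congˡ (+-congʳ (*-congʳ (trans (*-congʳ (α+β (suc q)))
             (reflexive (≡.cong (freeRow (suc q)) (≡.sym l∸s))))))) ⟩
      ∏α q (suc (suc n)) * x q + ((β q * ∏α (suc q) (suc n)) * y q
        + (freeRow (suc q) (l ∸ s) * y (suc q) + S)) ∎
      where
      q = s ℕ.+ k
      P = ∏α (suc (suc q)) n
      S = ∑ˡ (run (suc s) (suc n)) (λ m → freeRow (suc (m ℕ.+ k)) (l ∸ m) * y (suc (m ℕ.+ k)))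
      eq′ : l ≡ suc s ℕ.+ n
      eq′ = ≡.trans eq (ℕ.+-suc s n)
      l∸s : l ∸ s ≡ suc n
      l∸s = ≡.trans (≡.cong (_∸ s) eq) (ℕ.m+n∸m≡n s (suc n))

    module _ {X : Set} (ρ σ : ℕ → Row X) (ρ-0 : ρ 0 ≐ 0ʳ) (σ-0 : σ 0 ≐ 0ʳ)
      (step : ∀ p → ρ (suc p) ≐ α p ⊡ ρ p ⊞ (σ (suc p) ⊞ β p ⊡ σ p)) where

      -- The first row is telescoped while the lower rows are still rows of `ρ`, so the leftover
      -- multiple of the next row vanishes by `repeated-row`. The first argument is then a row of
      -- `σ`, and induction applies to the form in the other arguments. The term with coefficient
      -- `L` is judged last, separately for each choice of the lower rows.
      branching : ∀ {k} {Φ : Vec (Row X) k → Carrier} → IsForm k Φ → ∀ ls → Decreasing ls →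
        Φ (rowsAt ρ ls) ≈ ∑ˡ (choices ls) (λ ns → skewWeight ls ns * Φ (rowsAt σ ns))
      branching {Φ = Φ} form [] dec = sym (trans (+-identityʳ _) (*-identityˡ _))
      branching {Φ = Φ} form@(cong , add , scale , alt , rest) (_∷_ {n = k} l ls) dec = begin
        x (suc (l ℕ.+ k))
          ≈⟨ telescope x y x-step k l (l ∸ l₂) l₂ (≡.sym (ℕ.m+[n∸m]≡n (dec 0))) ⟩
        ∏α (l₂ ℕ.+ k) (suc (l ∸ l₂)) * x (l₂ ℕ.+ k) + (L * y (l₂ ℕ.+ k) + ∑ˡ R (λ m → F m * y (suc (m ℕ.+ k))))
          ≈⟨ trans (+-congʳ (trans (*-congˡ (repeated-row {Φ = Φ} form ρ ρ-0 ls)) (zeroʳ _))) (+-identityˡ _) ⟩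
        L * y (l₂ ℕ.+ k) + ∑ˡ R (λ m → F m * y (suc (m ℕ.+ k)))
          ≈⟨ +-cong (*-congˡ (expand (l₂ ℕ.+ k))) (∑ˡ-cong R
              (All.universal (λ m → *-congˡ (expand (suc (m ℕ.+ k)))) R)) ⟩
        L * ∑ˡ C (λ ns → W ns * z ns (l₂ ℕ.+ k)) + ∑ˡ R (λ m → F m * ∑ˡ C (λ ns → W ns * z ns (suc (m ℕ.+ k))))
          ≈⟨ +-cong (∑ˡ-distribˡ L C _) (trans (∑ˡ-cong R (All.universal (λ m → ∑ˡ-distribˡ (F m) C _) R))
               (∑ˡ-swap R C _)) ⟩
        ∑ˡ C (λ ns → L * (W ns * z ns (l₂ ℕ.+ k))) + ∑ˡ C
            (λ ns → ∑ˡ R (λ m → F m * (W ns * z ns (suc (m ℕ.+ k)))))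
          ≈⟨ ∑ˡ-+ C _ _ ⟩
        ∑ˡ C (λ ns → L * (W ns * z ns (l₂ ℕ.+ k)) + ∑ˡ R (λ m → F m * (W ns * z ns (suc (m ℕ.+ k)))))
          ≈⟨ ∑ˡ-cong C (All.tabulate (λ {ns} ns∈ → first-row ns (choices-sound (λ r → dec (suc r)) ns∈))) ⟩
        ∑ˡ C (λ ns → ∑ˡ (heads l l₂ (at ns 0)) (λ n → skewWeight (l ∷ ls) (n ∷ ns) * Φ (rowsAt σ (n ∷ ns))))
          ≈⟨ ∑ˡ-cong C (All.universal (λ ns → reflexive (∑ˡ-map (_∷ ns) (heads l l₂ (at ns 0)) _)) C) ⟨
        ∑ˡ C (λ ns → ∑ˡ (map (_∷ ns) (heads l l₂ (at ns 0)))
            (λ ns′ → skewWeight (l ∷ ls) ns′ * Φ (rowsAt σ ns′)))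
          ≈⟨ ∑ˡ-concatMap (λ ns → map (_∷ ns) (heads l l₂ (at ns 0))) C _ ⟨
        ∑ˡ (choices (l ∷ ls)) (λ ns → skewWeight (l ∷ ls) ns * Φ (rowsAt σ ns)) ∎
        where
        l₂ = at ls 0
        C  = choices ls
        R  = run l₂ (suc (l ∸ l₂))
        W  = skewWeight ls
        L  = β (l₂ ℕ.+ k) * ∏α (suc (l₂ ℕ.+ k)) (l ∸ l₂)
        F : ℕ → Carrier
        F m = freeRow (suc (m ℕ.+ k)) (l ∸ m)
        x y : ℕ → Carrier
        x p = Φ (ρ p ∷ rowsAt ρ ls)
        y p = Φ (σ p ∷ rowsAt ρ ls)
        z : Vec ℕ k → ℕ → Carrier
        z ns p = Φ (σ p ∷ rowsAt σ ns)
        x-step : ∀ p → x (suc p) ≈ α p * x p + (y (suc p) + β p * y p)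
        x-step p = trans (cong (step p) _) (trans (add _ _ _) (+-cong (scale _ _ _)
          (trans (add _ _ _) (+-congˡ (scale _ _ _)))))
        expand : ∀ p → y p ≈ ∑ˡ C (λ ns → W ns * z ns p)
        expand p = branching (rest (σ p)) ls (λ r → dec (suc r))
        first-row : ∀ ns → ns ◁ ls →
          L * (W ns * z ns (l₂ ℕ.+ k)) + ∑ˡ R (λ m → F m * (W ns * z ns (suc (m ℕ.+ k)))) ≈
          ∑ˡ (heads l l₂ (at ns 0)) (λ n → skewWeight (l ∷ ls) (n ∷ ns) * z ns (suc (n ℕ.+ k)))
        first-row ns ns◁ls = by-cases (at ns 0) ≡.refl
          where
          run-terms : ∑ˡ R (λ m → F m * (W ns * z ns (suc (m ℕ.+ k)))) ≈
                      ∑ˡ R (λ n → skewWeight (l ∷ ls) (n ∷ ns) * z ns (suc (n ℕ.+ k)))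
          run-terms = ∑ˡ-cong R (All.tabulate (λ {m} m∈ → trans (sym (*-assoc _ _ _))
            (*-congʳ (*-congʳ (reflexive (≡.sym (rowWeight-unlinked k l l₂ m (proj₁ (∈-run⁻ l₂ _ m∈)))))))))
          by-cases : ∀ n₂ → n₂ ≡ at ns 0 →
            L * (W ns * z ns (l₂ ℕ.+ k)) + ∑ˡ R (λ m → F m * (W ns * z ns (suc (m ℕ.+ k)))) ≈
            ∑ˡ (heads l l₂ n₂) (λ n → skewWeight (l ∷ ls) (n ∷ ns) * z ns (suc (n ℕ.+ k)))
          by-cases n₂ eq with n₂ ℕ.<? l₂
          ... | yes n₂<l₂ = +-cong (trans (sym (*-assoc _ _ _)) (linked l₂ n₂<l₂)) run-terms
            where
            linked : ∀ l₂ → n₂ < l₂ →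
              (β (l₂ ℕ.+ k) * ∏α (suc (l₂ ℕ.+ k)) (l ∸ l₂) * W ns) * z ns (l₂ ℕ.+ k) ≈
              (rowWeight k l l₂ (pred l₂) * W ns) * z ns (suc (pred l₂ ℕ.+ k))
            linked (suc n) _ = *-congʳ (*-congʳ (reflexive (≡.sym (rowWeight-linked k l n))))
          -- If the next row of λ / ν is empty, position `l₂ + k` is already taken by the first row
          -- of `ns`, and the term with `L` vanishes. Otherwise it is the position of a row of
          -- length `pred l₂`, which is why `heads` offers that length above.
          ... | no n₂≮l₂ = trans (+-cong (trans (*-congˡ (trans (*-congˡ z≈0) (zeroʳ _))) (zeroʳ _)) run-terms)
                                 (+-identityˡ _)
            where
            n₂≡l₂ : at ns 0 ≡ l₂
            n₂≡l₂ = ℕ.≤-antisym (contained ns◁ls 0) (ℕ.≤-trans (ℕ.≮⇒≥ n₂≮l₂) (ℕ.≤-reflexive eq))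
            z≈0 : z ns (l₂ ℕ.+ k) ≈ 0#
            z≈0 = ≡.subst (λ p → z ns (p ℕ.+ k) ≈ 0#) n₂≡l₂ (repeated-row {Φ = Φ} form σ σ-0 ns)

-- Complete homogeneous functions

module Convolution {c ℓ} (K : CommutativeRing c ℓ) where
  open CommutativeRing K
  open RingOps K
  open RingSums K
  open SemiringSum semiring using (*-distribˡ-sum; sum-cong-≋; ∑-distrib-+)
  open SetoidReasoning setoid

  conv : (ℕ → Carrier) → (ℕ → Carrier) → ℕ → Carrier
  conv f g n = ∑[ i < suc n ] (f (toℕ i) * g (n ∸ toℕ i))

  conv-congˡ : ∀ {f f′} g n → (∀ i → f i ≈ f′ i) → conv f g n ≈ conv f′ g n
  conv-congˡ {f} {f′} g n p = ∑-cong (λ (i : Fin (suc n)) → f (toℕ i) * g (n ∸ toℕ i))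
      (λ i → f′ (toℕ i) * g (n ∸ toℕ i))
    (λ i → *-congʳ (p (toℕ i)))

  conv-congʳ : ∀ f {g g′} n → (∀ i → i ≤ n → g i ≈ g′ i) → conv f g n ≈ conv f g′ n
  conv-congʳ f {g} {g′} n p = ∑-cong (λ (i : Fin (suc n)) → f (toℕ i) * g (n ∸ toℕ i))
      (λ i → f (toℕ i) * g′ (n ∸ toℕ i))
    (λ i → *-congˡ (p (n ∸ toℕ i) (ℕ.m∸n≤m n (toℕ i))))

  conv-+ˡ : ∀ f f′ g n → conv (λ i → f i + f′ i) g n ≈ conv f g n + conv f′ g n
  conv-+ˡ f f′ g n = trans
    (sum-cong-≋ {suc n} (λ i → distribʳ (g (n ∸ toℕ i)) (f (toℕ i)) (f′ (toℕ i))))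
    (∑-distrib-+ {suc n} (λ i → f (toℕ i) * g (n ∸ toℕ i)) (λ i → f′ (toℕ i) * g (n ∸ toℕ i)))

  conv-*ˡ : ∀ s f g n → conv (λ i → s * f i) g n ≈ s * conv f g n
  conv-*ˡ s f g n = trans
    (sum-cong-≋ {suc n} (λ i → *-assoc s (f (toℕ i)) (g (n ∸ toℕ i))))
    (sym (*-distribˡ-sum {suc n} s (λ i → f (toℕ i) * g (n ∸ toℕ i))))

  -- In generating functions: P = s z Q + R implies F P = s z F Q + F R.
  conv-recurrence : ∀ {p q r} s → p 0 ≈ r 0 → (∀ k → p (suc k) ≈ s * q k + r (suc k)) →
    ∀ f n → conv f p (suc n) ≈ s * conv f q n + conv f r (suc n)
  conv-recurrence {p} {q} {r} s p₀ p₊ f zero = begin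
    f 0 * p 1 + (f 1 * p 0 + 0#)
      ≈⟨ +-cong (*-congˡ (p₊ 0)) (+-congʳ (*-congˡ p₀)) ⟩
    f 0 * (s * q 0 + r 1) + (f 1 * r 0 + 0#)
      ≈⟨ solve 5 (λ f₀ s q₀ r₁ z → f₀ :* (s :* q₀ :+ r₁) :+ z := s :* (f₀ :* q₀) :+ (f₀ :* r₁ :+ z))
           refl (f 0) s (q 0) (r 1) (f 1 * r 0 + 0#) ⟩
    s * (f 0 * q 0) + (f 0 * r 1 + (f 1 * r 0 + 0#))
      ≈⟨ +-congʳ (*-congˡ (+-identityʳ _)) ⟨
    s * (f 0 * q 0 + 0#) + (f 0 * r 1 + (f 1 * r 0 + 0#)) ∎
  conv-recurrence {p} {q} {r} s p₀ p₊ f (suc n) = begin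
    f 0 * p (suc (suc n)) + conv f₊ p (suc n)
      ≈⟨ +-cong (*-congˡ (p₊ (suc n))) (conv-recurrence {p} {q} {r} s p₀ p₊ f₊ n) ⟩
    f 0 * (s * q (suc n) + r (suc (suc n))) + (s * conv f₊ q n + conv f₊ r (suc n))
      ≈⟨ solve 6 (λ f₀ s q r x y → f₀ :* (s :* q :+ r) :+ (s :* x :+ y) := s :* (f₀ :* q :+ x) :+
          (f₀ :* r :+ y))
           refl (f 0) s (q (suc n)) (r (suc (suc n))) (conv f₊ q n) (conv f₊ r (suc n)) ⟩
    s * conv f q (suc n) + conv f r (suc (suc n)) ∎
    where
    f₊ : ℕ → Carrier
    f₊ i = f (suc i)

  -- `elementary` peels off the first variable, whereas the lists of variables in the hₖ;ₐ grow at
  -- the end.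
  elementary-snoc : ∀ k xs y → elementary (suc k) (xs ++ [ y ]) ≈ y * elementary k xs + elementary (suc k) xs
  elementary-snoc zero    []       y = refl
  elementary-snoc (suc k) []       y = refl
  elementary-snoc zero    (x ∷ xs) y = begin
    x * 1# + elementary 1 (xs ++ [ y ])     ≈⟨ +-congˡ (elementary-snoc 0 xs y) ⟩
    x * 1# + (y * 1# + elementary 1 xs)     ≈⟨ solve 3 (λ x y e → x :+ (y :+ e) := y :+ (x :+ e)) refl _ _ _ ⟩
    y * 1# + (x * 1# + elementary 1 xs)     ∎
  elementary-snoc (suc k) (x ∷ xs) y = begin
    x * elementary (suc k) (xs ++ [ y ]) + elementary (suc (suc k)) (xs ++ [ y ])
      ≈⟨ +-cong (*-congˡ (elementary-snoc k xs y)) (elementary-snoc (suc k) xs y) ⟩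
    x * (y * elementary k xs + elementary (suc k) xs) +
        (y * elementary (suc k) xs + elementary (suc (suc k)) xs)
      ≈⟨ solve 5 (λ x y a b d → x :* (y :* a :+ b) :+ (y :* b :+ d) := y :* (x :* a :+ b) :+ (x :* b :+ d))
           refl x y _ _ _ ⟩
    y * (x * elementary k xs + elementary (suc k) xs) +
        (x * elementary (suc k) xs + elementary (suc (suc k)) xs) ∎

  elementary-vanish : ∀ k xs → length xs < k → elementary k xs ≈ 0#
  elementary-vanish (suc k) []       _ = refl
  elementary-vanish (suc k) (x ∷ xs) p = trans
    (+-cong (trans (*-congˡ (elementary-vanish k xs (ℕ.s≤s⁻¹ p))) (zeroʳ x))
            (elementary-vanish (suc k) xs (ℕ.m<n⇒m<1+n (ℕ.s≤s⁻¹ p))))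
    (+-identityˡ 0#)

-- Newton's identities and the effect of new variables

module Specialisations {c ℓ} (K : CommutativeRing c ℓ) (isℚAlgebra : IsℚAlgebra K) where
  open CommutativeRing K
  open IsℚAlgebra isℚAlgebra
  open RingOps K
  open RingSums K
  open Forms K
  open Convolution K
  open SymmetricFunctions K isℚAlgebra
  open Mult semiring using (×-assoc-*; ×-congʳ; ×-comm-*) renaming (_×_ to _·_)
  open RingProperties ring using (-1*x≈-x)
  open SemiringSum semiring using (sum-cong-≋)
  open SetoidReasoning setoid

  module Λ = RingOps Λ

  specialise-sum : ∀ π {n} (f : Fin n → SymFun) → specialise π (Λ.sum f) ≈ ∑[ i < n ] specialise π (f i)
  specialise-sum π {zero}  f = refl
  specialise-sum π {suc n} f = +-congˡ (specialise-sum π (λ i → f (fsuc i)))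

  specialise-^ : ∀ π f n → specialise π (f Λ.^ n) ≈ specialise π f ^ n
  specialise-^ π f zero    = refl
  specialise-^ π f (suc n) = *-congˡ (specialise-^ π f n)

  specialise-det : ∀ π {n} (A : Fin n → Fin n → SymFun) →
                   specialise π (Λ.det A) ≈ det (λ i j → specialise π (A i j))
  specialise-det π {zero}  A = refl
  specialise-det π {suc n} A = trans
    (specialise-sum π {suc n} (λ j → (((⊝ const 1#) Λ.^ toℕ j) ⊗ A fzero j) ⊗ Λ.det
        (λ i k → A (fsuc i) (punchIn j k))))
    (∑-cong (λ j → (specialise π ((⊝ const 1#) Λ.^ toℕ j) * specialise π (A fzero j)) *
                     specialise π (Λ.det (λ i k → A (fsuc i) (punchIn j k))))
            (λ j → (sign (toℕ j) * specialise π (A fzero j)) *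
                     det (λ i k → specialise π (A (fsuc i) (punchIn j k))))
            (λ j → *-cong (*-congʳ (specialise-^ π (⊝ const 1#) (toℕ j)))
                          (specialise-det π (λ i k → A (fsuc i) (punchIn j k)))))

  specialise-congˡ : ∀ {π π′} → (∀ m → π m ≈ π′ m) → ∀ f → specialise π f ≈ specialise π′ f
  specialise-congˡ p (const s) = refl
  specialise-congˡ p 𝐩[1+ m ]  = p m
  specialise-congˡ p (f ⊕ g)   = +-cong (specialise-congˡ p f) (specialise-congˡ p g)
  specialise-congˡ p (f ⊗ g)   = *-cong (specialise-congˡ p f) (specialise-congˡ p g)
  specialise-congˡ p (⊝ f)     = -‿cong (specialise-congˡ p f)

  H : (ℕ → Carrier) → ℕ → Carrier
  H π n = specialise π (h n)

  lookup-hs : ∀ n i → Vec.lookup (hs n) i ≡ h (n ∸ toℕ i)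
  lookup-hs zero    fzero    = ≡.refl
  lookup-hs (suc n) fzero    = ≡.refl
  lookup-hs (suc n) (fsuc i) = lookup-hs n i

  H-suc : ∀ π n → H π (suc n) ≈ 1/suc n * conv π (H π) n
  H-suc π n = *-congˡ (trans
    (specialise-sum π (λ (i : Fin (suc n)) → 𝐩[1+ toℕ i ] ⊗ Vec.lookup (hs n) i))
    (sum-cong-≋ {suc n} (λ i → *-congˡ {π (toℕ i)} (reflexive (≡.cong (specialise π) (lookup-hs n i))))))

  1/suc-cancel : ∀ n x → 1/suc n * (suc n · x) ≈ x
  1/suc-cancel n x = begin
    1/suc n * (suc n · x)          ≈⟨ *-congˡ (trans (×-assoc-* (suc n) 1# x)
        (×-congʳ (suc n) (*-identityˡ x))) ⟨
    1/suc n * ((suc n · 1#) * x)   ≈⟨ *-assoc _ _ _ ⟨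
    (1/suc n * (suc n · 1#)) * x   ≈⟨ *-congʳ (trans (*-comm _ _) (inverse n)) ⟩
    1# * x                         ≈⟨ *-identityˡ x ⟩
    x                              ∎

  suc-cancel : ∀ n x → suc n · (1/suc n * x) ≈ x
  suc-cancel n x = begin
    suc n · (1/suc n * x)           ≈⟨ ×-congʳ (suc n) (*-identityˡ _) ⟨
    suc n · (1# * (1/suc n * x))    ≈⟨ ×-assoc-* (suc n) 1# _ ⟨
    (suc n · 1#) * (1/suc n * x)    ≈⟨ *-assoc _ _ _ ⟨
    ((suc n · 1#) * 1/suc n) * x    ≈⟨ *-congʳ (inverse n) ⟩
    1# * x                          ≈⟨ *-identityˡ x ⟩
    x                               ∎

  H-newton : ∀ π n → suc n · H π (suc n) ≈ conv π (H π) n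
  H-newton π n = trans (×-congʳ (suc n) (H-suc π n)) (suc-cancel n _)

  -- Since `suc n` is invertible, Newton's identities determine each value from the earlier ones.
  -- This is how `H` is recognised after a variable has been adjoined.
  H-unique : ∀ π g → g 0 ≈ 1# → (∀ n → suc n · g (suc n) ≈ conv π g n) → ∀ n → H π n ≈ g n
  H-unique π g g₀ newton n = bounded n n ℕ.≤-refl
    where
    bounded : ∀ b n → n ≤ b → H π n ≈ g n
    bounded b       zero    n≤b = sym g₀
    bounded (suc b) (suc n) n≤b = begin
      H π (suc n)                    ≈⟨ H-suc π n ⟩
      1/suc n * conv π (H π) n       ≈⟨ *-congˡ (conv-congʳ π {H π} {g} n
                                          (λ i i≤n → bounded b i (ℕ.≤-trans i≤n (ℕ.s≤s⁻¹ n≤b)))) ⟩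
      1/suc n * conv π g n           ≈⟨ *-congˡ (newton n) ⟨
      1/suc n * (suc n · g (suc n))  ≈⟨ 1/suc-cancel n _ ⟩
      g (suc n)                      ∎

  ·-distrib : ∀ k a b → k · (a + b) ≈ k · a + k · b
  ·-distrib zero    a b = sym (+-identityʳ 0#)
  ·-distrib (suc k) a b = trans (+-congˡ (·-distrib k a b))
    (solve 4 (λ a b u v → a :+ b :+ (u :+ v) := a :+ u :+ (b :+ v)) refl a b (k · a) (k · b))

  -- The factor 1 / (1 - u z) of the generating function.
  adjoin : Carrier → (ℕ → Carrier) → ℕ → Carrier
  adjoin u f zero    = 1#
  adjoin u f (suc n) = u * adjoin u f n + f (suc n)

  -- Newton's identities say G′ = P G for the generating functions G of the values and P of the
  -- power sums. A factor 1 / (1 - u z) adds its logarithmic derivative u / (1 - u z) to P; the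
  -- proof checks this on coefficients.
  adjoin-newton : ∀ π u n → suc n · adjoin u (H π) (suc n) ≈ conv (λ m → u ^ suc m + π m) (adjoin u (H π)) n
  adjoin-newton π u n = sym (trans (conv-+ˡ (λ m → u ^ suc m) π g n) (step n))
    where
    g A B : ℕ → Carrier
    g = adjoin u (H π)
    A = conv (λ m → u ^ suc m) g
    B = conv π g
    A-suc : ∀ n → A (suc n) ≈ u * (g (suc n) + A n)
    A-suc n = begin
      (u * 1#) * g (suc n) + conv (λ m → u * u ^ suc m) g n
        ≈⟨ +-cong (*-congʳ (*-identityʳ u)) (conv-*ˡ u (λ m → u ^ suc m) g n) ⟩
      u * g (suc n) + u * A n
        ≈⟨ distribˡ u _ _ ⟨
      u * (g (suc n) + A n) ∎
    step : ∀ n → A n + B n ≈ suc n · g (suc n)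
    step zero = begin
      ((u * 1#) * 1# + 0#) + (π 0 * 1# + 0#)
        ≈⟨ +-cong (trans (+-identityʳ _) (*-identityʳ _)) (sym (H-newton π 0)) ⟩
      u * 1# + (H π 1 + 0#)
        ≈⟨ +-assoc _ _ _ ⟨
      (u * 1# + H π 1) + 0# ∎
    step (suc n) = begin
      A (suc n) + B (suc n)
        ≈⟨ +-cong (A-suc n) (conv-recurrence {g} {g} {H π} u refl (λ _ → refl) π n) ⟩
      u * (g (suc n) + A n) + (u * B n + conv π (H π) (suc n))
        ≈⟨ +-congˡ (+-congˡ (H-newton π (suc n))) ⟨
      u * (g (suc n) + A n) + (u * B n + (H π (suc (suc n)) + t))
        ≈⟨ solve 6 (λ u a b c d t → u :* (a :+ b) :+ (u :* c :+ (d :+ t)) := u :* a :+ d :+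
            (u :* (b :+ c) :+ t))
             refl u (g (suc n)) (A n) (B n) (H π (suc (suc n))) t ⟩
      g (suc (suc n)) + (u * (A n + B n) + t)
        ≈⟨ +-congˡ (+-congʳ (trans (*-congˡ (step n)) (×-comm-* (suc n) u _))) ⟩
      g (suc (suc n)) + (suc n · (u * g (suc n)) + t)
        ≈⟨ +-congˡ (·-distrib (suc n) _ _) ⟨
      g (suc (suc n)) + suc n · g (suc (suc n)) ∎
      where
      t = suc n · H π (suc (suc n))

  H-adjoin : ∀ {π π′} u → (∀ m → π′ m ≈ u ^ suc m + π m) → ∀ n → H π′ (suc n) ≈ u * H π′ n + H π (suc n)
  H-adjoin {π} {π′} u p n = trans (eq (suc n)) (+-congʳ (*-congˡ (sym (eq n))))
    where
    eq : ∀ n → H π′ n ≈ adjoin u (H π) n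
    eq = H-unique π′ (adjoin u (H π)) refl
      (λ n → trans (adjoin-newton π u n) (conv-congˡ (adjoin u (H π)) n (λ m → sym (p m))))

  -^ : ∀ v k → (- v) ^ k ≈ sign k * v ^ k
  -^ v zero    = sym (*-identityˡ 1#)
  -^ v (suc k) = begin
    - v * (- v) ^ k                  ≈⟨ *-cong (sym (-1*x≈-x v)) (-^ v k) ⟩
    (- 1# * v) * (sign k * v ^ k)    ≈⟨ solve 4 (λ m v s p → (m :* v) :* (s :* p) := (m :* s) :*
        (v :* p)) refl (- 1#) v (sign k) (v ^ k) ⟩
    (- 1# * sign k) * (v * v ^ k)    ∎

  -- `π m` is the power sum of degree m + 1, so `sign m` is the sign (-1)^(k-1) with which the `y`
  -- enter in degree k.
  extend : (ℕ → Carrier) → Carrier → Carrier → ℕ → Carrier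
  extend π u v m = π m + (u ^ suc m + sign m * v ^ suc m)

  -- With q = π + (the power sums of v alone), π and extend π u v arise from q by
  -- adjoining − v and u, respectively.
  H-extend : ∀ π u v n → H (extend π u v) (suc n) ≈
             u * H (extend π u v) n + (H π (suc n) + v * H π n)
  H-extend π u v n = trans
    (H-adjoin {q} {extend π u v} u (λ m → solve 3 (λ p x y → p :+ (x :+ y) := x :+ (p :+ y)) refl (π m)
        (u ^ suc m) (sign m * v ^ suc m)) n)
    (+-congˡ (begin
      H q (suc n)                                       ≈⟨ +-identityˡ _ ⟨
      0# + H q (suc n)                                  ≈⟨ +-congʳ cancelled ⟨
      (- v * H π n + v * H π n) + H q (suc n)           ≈⟨ solve 3
          (λ a b d → (a :+ b) :+ d := (a :+ d) :+ b) refl (- v * H π n) (v * H π n) (H q (suc n)) ⟩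
      (- v * H π n + H q (suc n)) + v * H π n           ≈⟨ +-congʳ (H-adjoin {q} {π} (- v) π-q n) ⟨
      H π (suc n) + v * H π n                           ∎))
    where
    q : ℕ → Carrier
    q m = π m + sign m * v ^ suc m
    cancelled : - v * H π n + v * H π n ≈ 0#
    cancelled = trans (sym (distribʳ _ _ _)) (trans (*-congʳ (-‿inverseˡ v)) (zeroˡ _))
    π-q : ∀ m → π m ≈ (- v) ^ suc m + q m
    π-q m = begin
      π m                                            ≈⟨ +-identityʳ _ ⟨
      π m + 0#                                       ≈⟨ +-congˡ (-‿inverseˡ s) ⟨
      π m + (- s + s)                                ≈⟨ solve 3
          (λ p a b → p :+ (a :+ b) := a :+ (p :+ b)) refl (π m) (- s) s ⟩
      - s + (π m + s)                                ≈⟨ +-congʳ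
          (trans (-^ v (suc m)) (trans (*-assoc _ _ _) (-1*x≈-x s))) ⟨
      (- v) ^ suc m + q m                            ∎
      where s = sign m * v ^ suc m

  private
    variables : (ℤ → Carrier) → ℕ → List Carrier
    variables b n = map (λ m → b (+ suc m)) (upTo n)

    variables-suc : ∀ b n → variables b (suc n) ≡ variables b n ++ [ b (+ suc n) ]
    variables-suc b n = ≡.trans (≡.cong (map (λ m → b (+ suc m))) (≡.sym (List.upTo-∷ʳ n)))
                                (List.map-++ (λ m → b (+ suc m)) (upTo n) [ n ])

    -- The coefficients of the polynomial (1 - b₁ z) ⋯ (1 - bₙ z). Accordingly `coeff-suc`
    -- multiplies by one more linear factor, and `coeff-vanish` bounds the degree.
    coeff : (ℤ → Carrier) → ℕ → ℕ → Carrier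
    coeff b n k = sign k * elementary k (variables b n)

    coeff-suc : ∀ b n k → coeff b (suc n) (suc k) ≈ - b (+ suc n) * coeff b n k + coeff b n (suc k)
    coeff-suc b n k = begin
      sign (suc k) * elementary (suc k) (variables b (suc n))
        ≈⟨ *-congˡ (trans (reflexive (≡.cong (elementary (suc k)) (variables-suc b n)))
                          (elementary-snoc k (variables b n) y)) ⟩
      (- 1# * sign k) * (y * e + e₊)
        ≈⟨ solve 5 (λ m s y e f → (m :* s) :* (y :* e :+ f) := (m :* y) :* (s :* e) :+ (m :* s) :* f)
             refl (- 1#) (sign k) y e e₊ ⟩
      (- 1# * y) * (sign k * e) + sign (suc k) * e₊
        ≈⟨ +-congʳ (*-congʳ (-1*x≈-x y)) ⟩
      - y * coeff b n k + coeff b n (suc k) ∎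
      where
      y  = b (+ suc n)
      e  = elementary k (variables b n)
      e₊ = elementary (suc k) (variables b n)

    coeff-vanish : ∀ b n → coeff b n (suc n) ≈ 0#
    coeff-vanish b n = trans (*-congˡ (elementary-vanish (suc n) (variables b n)
      (ℕ.s≤s (ℕ.≤-reflexive (≡.trans (List.length-map _ (upTo n)) (List.length-upTo n)))))) (zeroʳ _)

  -- The functions hₖ;ᵦ under a new pair of variables

  hᵇ : (ℕ → Carrier) → (ℤ → Carrier) → ℤ → Carrier
  hᵇ π b z = specialise π (h⟨ b ⟩ z)

  hᵇ-conv : ∀ π b n → hᵇ π b (+ suc n) ≈ conv (λ i → H π (suc i)) (coeff b n) n
  hᵇ-conv π b n = trans
    (specialise-sum π (λ (i : Fin (suc n)) → const (coeff b n (n ∸ toℕ i)) ⊗ h (suc (toℕ i))))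
    (∑-cong (λ (i : Fin (suc n)) → coeff b n (n ∸ toℕ i) * H π (suc (toℕ i)))
            (λ i → H π (suc (toℕ i)) * coeff b n (n ∸ toℕ i)) (λ i → *-comm _ _))

  -- The last factor 1 - bₙ₊₁ z is split off. What remains has degree `n`, so in the second
  -- convolution the term with `H π 1`, whose coefficient has index `suc n`, drops out and only
  -- shifted values of `H` are left.
  hᵇ-suc : ∀ π b n → hᵇ π b (+ suc (suc n)) ≈
           - b (+ suc n) * hᵇ π b (+ suc n) + conv (λ i → H π (suc (suc i))) (coeff b n) n
  hᵇ-suc π b n = begin
    hᵇ π b (+ suc (suc n))
      ≈⟨ hᵇ-conv π b (suc n) ⟩
    conv (λ i → H π (suc i)) (coeff b (suc n)) (suc n)
      ≈⟨ conv-recurrence {coeff b (suc n)} {coeff b n} {coeff b n} (- b (+ suc n)) refl (coeff-suc b n)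
           (λ i → H π (suc i)) n ⟩
    - b (+ suc n) * conv (λ i → H π (suc i)) (coeff b n) n + conv (λ i → H π (suc i)) (coeff b n) (suc n)
      ≈⟨ +-cong (*-congˡ (sym (hᵇ-conv π b n))) (+-congʳ (trans (*-congˡ (coeff-vanish b n)) (zeroʳ _))) ⟩
    - b (+ suc n) * hᵇ π b (+ suc n) + (0# + conv (λ i → H π (suc (suc i))) (coeff b n) n)
      ≈⟨ +-congˡ (+-identityˡ _) ⟩
    - b (+ suc n) * hᵇ π b (+ suc n) + conv (λ i → H π (suc (suc i))) (coeff b n) n ∎

  -- For `z > 0`, `hᵇ-suc` shows that the value at `suc z` plus `b z` times the value at `z` is a
  -- convolution of shifted values of `H`, with the same coefficients for the old and the new
  -- variables, so `H-extend` carries over termwise. Moving the terms with `b z` back puts `- b z`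
  -- next to `u` and `b z` next to `v`. The case `z = 0` is separate because the value at 0 is 1 by
  -- definition and not a convolution.
  hᵇ-extend : ∀ π u v b z → hᵇ (extend π u v) b (ℤ.suc z) ≈
    (u + - b z) * hᵇ (extend π u v) b z + (hᵇ π b (ℤ.suc z) + (v + b z) * hᵇ π b z)
  hᵇ-extend π u v b -[1+ suc n ] = sym (trans (+-cong (zeroʳ _)
      (trans (+-cong refl (zeroʳ _)) (+-identityˡ _))) (+-identityˡ _))
  hᵇ-extend π u v b -[1+ zero ]  = sym (trans (+-cong (zeroʳ _)
      (trans (+-congˡ (zeroʳ _)) (+-identityʳ _))) (+-identityˡ _))
  hᵇ-extend π u v b (+ zero) = begin
    hᵇ π′ b (+ 1)
      ≈⟨ single π′ ⟩
    H π′ 1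
      ≈⟨ H-extend π u v 0 ⟩
    u * 1# + (H π 1 + v * 1#)
      ≈⟨ +-cong (*-identityʳ _) (+-congˡ (*-identityʳ _)) ⟩
    u + (H π 1 + v)
      ≈⟨ +-identityʳ _ ⟨
    u + (H π 1 + v) + 0#
      ≈⟨ +-congˡ (-‿inverseˡ y) ⟨
    u + (H π 1 + v) + (- y + y)
      ≈⟨ solve 5 (λ u h v n y → u :+ (h :+ v) :+ (n :+ y) := (u :+ n) :+ (h :+ (v :+ y))) refl u
          (H π 1) v (- y) y ⟩
    (u + - y) + (H π 1 + (v + y))
      ≈⟨ +-cong (*-identityʳ _) (+-cong (single π) (*-identityʳ _)) ⟨
    (u + - y) * 1# + (hᵇ π b (+ 1) + (v + y) * 1#) ∎
    where
    y  = b (+ 0)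
    π′ = extend π u v
    single : ∀ π → hᵇ π b (+ 1) ≈ H π 1
    single π = trans (+-identityʳ _) (trans (*-congʳ (*-identityˡ 1#)) (*-identityˡ _))
  hᵇ-extend π u v b (+ suc n) = begin
    hᵇ π′ b (+ suc (suc n))
      ≈⟨ hᵇ-suc π′ b n ⟩
    - y * X + conv (λ i → H π′ (suc (suc i))) C n
      ≈⟨ +-congˡ expand ⟩
    - y * X + (u * X + (Q + v * Y))
      ≈⟨ +-identityʳ _ ⟨
    - y * X + (u * X + (Q + v * Y)) + 0#
      ≈⟨ +-congˡ (trans (sym (distribʳ _ _ _)) (trans (*-congʳ (-‿inverseˡ y)) (zeroˡ _))) ⟨
    - y * X + (u * X + (Q + v * Y)) + (- y * Y + y * Y)
      ≈⟨ solve 7 (λ m X u Q v Y y → m :* X :+ (u :* X :+ (Q :+ v :* Y)) :+ (m :* Y :+ y :* Y)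
           := (u :+ m) :* X :+ ((m :* Y :+ Q) :+ (v :+ y) :* Y)) refl (- y) X u Q v Y y ⟩
    (u + - y) * X + ((- y * Y + Q) + (v + y) * Y)
      ≈⟨ +-congˡ (+-congʳ (hᵇ-suc π b n)) ⟨
    (u + - y) * X + (hᵇ π b (+ suc (suc n)) + (v + y) * Y) ∎
    where
    π′ = extend π u v
    y  = b (+ suc n)
    C  = coeff b n
    X  = hᵇ π′ b (+ suc n)
    Y  = hᵇ π b (+ suc n)
    Q  = conv (λ i → H π (suc (suc i))) C n
    expand : conv (λ i → H π′ (suc (suc i))) C n ≈ u * X + (Q + v * Y)
    expand = begin
      conv (λ i → H π′ (suc (suc i))) C n
        ≈⟨ conv-congˡ C n (λ i → H-extend π u v (suc i)) ⟩
      conv (λ i → u * H π′ (suc i) + (H π (suc (suc i)) + v * H π (suc i))) C n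
        ≈⟨ trans (conv-+ˡ (λ i → u * H π′ (suc i)) (λ i → H π (suc (suc i)) + v * H π (suc i)) C n)
             (+-cong (conv-*ˡ u (λ i → H π′ (suc i)) C n)
               (trans (conv-+ˡ (λ i → H π (suc (suc i))) (λ i → v * H π (suc i)) C n)
                 (+-congˡ (conv-*ˡ v (λ i → H π (suc i)) C n)))) ⟩
      u * conv (λ i → H π′ (suc i)) C n + (Q + v * conv (λ i → H π (suc i)) C n)
        ≈⟨ +-cong (*-congˡ (hᵇ-conv π′ b n)) (+-congˡ (*-congˡ (hᵇ-conv π b n))) ⟨
      u * X + (Q + v * Y) ∎

  H-0 : ∀ {π} → (∀ m → π m ≈ 0#) → ∀ n → H π (suc n) ≈ 0#
  H-0 {π} π≈0 n = trans (H-suc π n) (trans (*-congˡ (sum-zero (suc n)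
    (λ i → π (toℕ i) * H π (n ∸ toℕ i)) (λ i → trans (*-congʳ (π≈0 (toℕ i))) (zeroˡ _)))) (zeroʳ _))

  hᵇ-0 : ∀ {π} → (∀ m → π m ≈ 0#) → ∀ b z → z ≢ + 0 → hᵇ π b z ≈ 0#
  hᵇ-0 π≈0 b -[1+ n ]  _   = refl
  hᵇ-0 π≈0 b (+ zero)  z≢0 = contradiction ≡.refl z≢0
  hᵇ-0 {π} π≈0 b (+ suc n) _ = trans (hᵇ-conv π b n) (sum-zero (suc n)
    (λ i → H π (suc (toℕ i)) * coeff b n (n ∸ toℕ i))
    (λ i → trans (*-congʳ (H-0 π≈0 (toℕ i))) (zeroˡ _)))

  det-identity : ∀ {n} (A : Fin n → Fin n → Carrier) → (∀ i → A i i ≈ 1#) → (∀ i j → i ≢ j → A i j ≈ 0#) →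
                 det A ≈ 1#
  det-identity {zero}  A diag off = refl
  det-identity {suc n} A diag off = trans (+-cong
    (trans (*-cong (trans (*-identityˡ _) (diag fzero))
             (det-identity (λ i k → A (fsuc i) (fsuc k)) (λ i → diag (fsuc i))
               (λ i j i≢j → off (fsuc i) (fsuc j) (λ eq → i≢j (Fin.suc-injective eq)))))
           (*-identityˡ 1#))
    (sum-zero n _ (λ j → trans (*-congʳ (trans (*-congˡ (off fzero (fsuc j) (λ ()))) (zeroʳ _))) (zeroˡ _))))
    (+-identityʳ 1#)

  det-zero-row : ∀ {n} → 0 < n → (A : Fin n → Fin n → Carrier) → (∀ i j → toℕ i ≡ 0 → A i j ≈ 0#) → det A ≈ 0#
  det-zero-row {suc n} _ A p = sum-zero (suc n)
    (λ j → (sign (toℕ j) * A fzero j) * det (λ i k → A (fsuc i) (punchIn j k)))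
    (λ j → trans (*-congʳ (trans (*-congˡ (p fzero j ≡.refl)) (zeroʳ _))) (zeroˡ _))

-- The determinant of s⟨ a ⟩

pad : ∀ N → List ℕ → Vec ℕ N
pad zero    ms       = []
pad (suc N) []       = 0 ∷ pad N []
pad (suc N) (m ∷ ms) = m ∷ pad N ms

at-pad-[] : ∀ N r → at (pad N []) r ≡ 0
at-pad-[] zero    r       = ≡.refl
at-pad-[] (suc N) zero    = ≡.refl
at-pad-[] (suc N) (suc r) = at-pad-[] N r

at-pad : ∀ N ms → length ms ≤ N → ∀ r → at (pad N ms) r ≡ partOf ms r
at-pad N       []       _ r       = at-pad-[] N r
at-pad (suc N) (m ∷ ms) p zero    = ≡.refl
at-pad (suc N) (m ∷ ms) p (suc r) = at-pad N ms (ℕ.s≤s⁻¹ p) r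

m+n-n : ∀ m n → m ℤ.+ n ℤ.- n ≡ m
m+n-n m n = ≡.trans (ℤ.+-assoc m n (ℤ.- n)) (≡.trans (≡.cong (λ z → m ℤ.+ z) (ℤ.+-inverseʳ n))
    (ℤ.+-identityʳ m))

m-n+n : ∀ m n → m ℤ.- n ℤ.+ n ≡ m
m-n+n m n = ≡.trans (ℤ.+-assoc m (ℤ.- n) n) (≡.trans (≡.cong (λ z → m ℤ.+ z) (ℤ.+-inverseˡ n))
    (ℤ.+-identityʳ m))

m+d-[i+d] : ∀ m d i → + (m ℕ.+ d) ℤ.- + (i ℕ.+ d) ≡ + m ℤ.- + i
m+d-[i+d] m d i = ≡.trans (ℤ.m-n≡m⊖n (m ℕ.+ d) (i ℕ.+ d))
  (≡.trans (≡.cong₂ ℤ._⊖_ (ℕ.+-comm m d) (ℕ.+-comm i d))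
    (≡.trans (ℤ.+-cancelˡ-⊖ d m i) (≡.sym (ℤ.m-n≡m⊖n m i))))

module Determinants {c ℓ} (K : CommutativeRing c ℓ) (isℚAlgebra : IsℚAlgebra K)
  (a : ℤ → CommutativeRing.Carrier K) (N : ℕ) where
  open CommutativeRing K
  open RingOps K
  open RingSums K
  open Forms K
  open Rows K
  open Specialisations K isℚAlgebra
  open SymmetricFunctions K isℚAlgebra
  open SetoidReasoning setoid

  -- For p = μᵢ − i + N, with i counted from 0, these are the entries of row i of
  -- the determinant s⟨ a ⟩ μ N.
  rowAt : (ℕ → Carrier) → ℕ → Row (Fin N)
  rowAt π p j = hᵇ π (τ (ℤ.- + toℕ j) a) (+ p ℤ.- + N ℤ.+ + toℕ j)

  s-det : (ℕ → Carrier) → Vec ℕ N → Carrier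
  s-det π ls = detᵛ (rowsAt (rowAt π) ls)

  lookup-rowsAt : ∀ {X : Set} (ρ : ℕ → Row X) {k} (ls : Vec ℕ k) i →
    Vec.lookup (rowsAt ρ ls) i ≡ ρ (at ls (toℕ i) ℕ.+ (k ∸ toℕ i))
  lookup-rowsAt ρ (_∷_ {n = k} l ls) fzero    = ≡.cong ρ (≡.sym (ℕ.+-suc l k))
  lookup-rowsAt ρ (l ∷ ls)           (fsuc i) = lookup-rowsAt ρ ls i

  index : ∀ l (i : Fin N) → + (l ℕ.+ (N ∸ toℕ i)) ℤ.- + N ≡ + l ℤ.- + toℕ i
  index l i = ≡.trans
    (≡.cong (λ n → + (l ℕ.+ (N ∸ toℕ i)) ℤ.- + n) (≡.sym (ℕ.m+[n∸m]≡n (ℕ.<⇒≤ (Fin.toℕ<n i)))))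
    (m+d-[i+d] l (N ∸ toℕ i) (toℕ i))

  lookup-rowAt : ∀ π ls i j → Vec.lookup (rowsAt (rowAt π) ls) i j ≡
    hᵇ π (τ (ℤ.- + toℕ j) a) (+ at ls (toℕ i) ℤ.- + toℕ i ℤ.+ + toℕ j)
  lookup-rowAt π ls i j = ≡.trans
    (≡.cong (λ ρ → ρ j) (lookup-rowsAt (rowAt π) ls i))
    (≡.cong (λ z → hᵇ π (τ (ℤ.- + toℕ j) a) (z ℤ.+ + toℕ j)) (index (at ls (toℕ i)) i))

  s-specialised : ∀ π μ → rows μ ≤ N → specialise π (s⟨ a ⟩ μ N) ≈ s-det π (pad N (YoungDiagram.parts μ))
  s-specialised π μ rows≤N = trans
    (specialise-det π {N} (λ i j → h⟨ τ (ℤ.- + toℕ j) a ⟩ (+ part μ (toℕ i) ℤ.- + toℕ i ℤ.+ + toℕ j)))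
    (det-cong (λ i j → reflexive (≡.sym (≡.trans (lookup-rowAt π (pad N (YoungDiagram.parts μ)) i j)
      (≡.cong (λ m → hᵇ π (τ (ℤ.- + toℕ j) a) (+ m ℤ.- + toℕ i ℤ.+ + toℕ j))
        (at-pad N (YoungDiagram.parts μ) rows≤N (toℕ i)))))))

  module _ {π : ℕ → Carrier} (π≈0 : ∀ m → π m ≈ 0#) where

    -- Without variables only the function of index 0 survives, and the entry of row `i` and column
    -- `j` has index j - i: the matrix is the identity.
    s-det-empty : ∀ ls → (∀ r → at ls r ≡ 0) → s-det π ls ≈ 1#
    s-det-empty ls ls≡0 = det-identity _
      (λ i → reflexive (≡.trans (entry i i) (≡.cong (λ z → hᵇ π (τ (ℤ.- + toℕ i) a) z)
        (m-n+n (+ 0) (+ toℕ i)))))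
      (λ i j i≢j → trans (reflexive (entry i j)) (hᵇ-0 π≈0 _ _
        (λ eq → i≢j (Fin.toℕ-injective (ℤ.+-injective (ℤ-lemma (toℕ i) (toℕ j) eq))))))
      where
      entry : ∀ i j → Vec.lookup (rowsAt (rowAt π) ls) i j ≡
              hᵇ π (τ (ℤ.- + toℕ j) a) (+ 0 ℤ.- + toℕ i ℤ.+ + toℕ j)
      entry i j = ≡.trans (lookup-rowAt π ls i j)
        (≡.cong (λ l → hᵇ π (τ (ℤ.- + toℕ j) a) (+ l ℤ.- + toℕ i ℤ.+ + toℕ j)) (ls≡0 (toℕ i)))
      ℤ-lemma : ∀ i j → + 0 ℤ.- + i ℤ.+ + j ≡ + 0 → + i ≡ + j
      ℤ-lemma i j eq = ≡.sym (ℤ.i-j≡0⇒i≡j (+ j) (+ i)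
        (≡.trans (ℤ.+-comm (+ j) (ℤ.- + i)) (≡.trans (≡.cong (λ z → z ℤ.+ + j)
            (≡.sym (ℤ.+-identityˡ (ℤ.- + i)))) eq)))

    -- All indices in the first row are at least `at ls 0`, hence positive, and the row is zero.
    s-det-nonempty : ∀ ls → 0 < at ls 0 → s-det π ls ≈ 0#
    s-det-nonempty ls 0<l = det-zero-row (length-positive ls 0<l) _ (λ i j i≡0 → trans
      (reflexive (≡.trans (lookup-rowAt π ls i j)
        (≡.cong (λ r → hᵇ π (τ (ℤ.- + toℕ j) a) (+ at ls r ℤ.- + r ℤ.+ + toℕ j)) i≡0)))
      (hᵇ-0 π≈0 _ _ (λ eq → ℕ.<⇒≢ (ℕ.≤-trans 0<l (ℕ.m≤m+n (at ls 0) (toℕ j)))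
        (≡.sym (ℤ.+-injective (≡.trans (≡.sym (≡.cong (λ z → z ℤ.+ + toℕ j)
            (ℤ.+-identityʳ (+ at ls 0)))) eq))))))
      where
      length-positive : ∀ {k} (ls : Vec ℕ k) → 0 < at ls 0 → 0 < k
      length-positive (_ ∷ _) _ = ℕ.z<s

  module _ (u v : Carrier) where

    α β : ℕ → Carrier
    α p = u + - a (+ p ℤ.- + N)
    β p = v + a (+ p ℤ.- + N)

    open Branching K α β (u + v) using (skewWeight; branching)

    s-branching : ∀ π ls → Decreasing ls → s-det (extend π u v) ls ≈
      ∑ˡ (choices ls) (λ ns → skewWeight ls ns * s-det π ns)
    s-branching π ls dec = branching α+β (rowAt (extend π u v)) (rowAt π)
      (rowAt-0 (extend π u v)) (rowAt-0 π) step (detᵛ-isForm N) ls dec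
      where
      α+β : ∀ p → α p + β p ≈ u + v
      α+β p = begin
        (u + - y) + (v + y)   ≈⟨ solve 4 (λ u m v y → (u :+ m) :+ (v :+ y) := (u :+ v) :+ (m :+ y)) refl
            u (- y) v y ⟩
        (u + v) + (- y + y)   ≈⟨ trans (+-congˡ (-‿inverseˡ y)) (+-identityʳ _) ⟩
        u + v                 ∎
        where y = a (+ p ℤ.- + N)
      -- At position 0 the indices are `j - N` with `j < N`, all negative. This supplies the zero
      -- row below the last one.
      rowAt-0 : ∀ π → rowAt π 0 ≐ 0ʳ
      rowAt-0 π j = reflexive (≡.cong (hᵇ π (τ (ℤ.- + toℕ j) a)) {y = -[1+ N ∸ suc (toℕ j) ]}
          (negative (Fin.toℕ<n j)))
        where
        negative : ∀ {j} → j < N → + 0 ℤ.- + N ℤ.+ + j ≡ -[1+ N ∸ suc j ]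
        negative {j} j<N = ≡.trans (≡.cong (λ z → z ℤ.+ + j) (ℤ.+-identityˡ (ℤ.- + N)))
          (≡.trans (ℤ.-m+n≡n⊖m N j) (≡.trans (ℤ.⊖-< j<N) (≡.cong (λ n → ℤ.- + n) (ℕ.+-∸-assoc 1 j<N))))
      step : ∀ p → rowAt (extend π u v) (suc p) ≐
             α p ⊡ rowAt (extend π u v) p ⊞ (rowAt π (suc p) ⊞ β p ⊡ rowAt π p)
      step p j = begin
        hᵇ (extend π u v) b (+ suc p ℤ.- + N ℤ.+ + toℕ j)
          ≈⟨ reflexive (≡.cong (hᵇ (extend π u v) b) suc-z) ⟩
        hᵇ (extend π u v) b (ℤ.suc z)
          ≈⟨ hᵇ-extend π u v b z ⟩
        (u + - b z) * hᵇ (extend π u v) b z + (hᵇ π b (ℤ.suc z) + (v + b z) * hᵇ π b z)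
          ≈⟨ reflexive (≡.cong₂ (λ y x → (u + - y) * hᵇ (extend π u v) b z + (x + (v + y) * hᵇ π b z))
               (≡.cong a (m+n-n (+ p ℤ.- + N) (+ toℕ j))) (≡.cong (hᵇ π b) (≡.sym suc-z))) ⟩
        α p * rowAt (extend π u v) p j + (rowAt π (suc p) j + β p * rowAt π p j) ∎
        where
        b : ℤ → Carrier
        b = τ (ℤ.- + toℕ j) a
        z = + p ℤ.- + N ℤ.+ + toℕ j
        suc-z : + suc p ℤ.- + N ℤ.+ + toℕ j ≡ ℤ.suc z
        suc-z = ≡.trans (≡.cong (λ z → z ℤ.+ + toℕ j) (ℤ.+-assoc (+ 1) (+ p) (ℤ.- + N)))
                        (ℤ.+-assoc (+ 1) (+ p ℤ.- + N) (+ toℕ j))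

-- Components of skew shapes without 2 × 2 blocks

segment : (r c n : ℕ) → List Cell
segment r c n = map (r ,_) (run c n)

-- `components` works from the end of the list. In this order cells are added row by row from the
-- bottom, each row from right to left, so a new cell can touch earlier ones only on its right and
-- below.
skew : ∀ {k} → ℕ → Vec ℕ k → Vec ℕ k → List Cell
skew r []       []       = []
skew r (l ∷ ls) (n ∷ ns) = segment r n (l ∸ n) ++ skew (suc r) ls ns

∈-segment⁻ : ∀ {x} r c n → x ∈ segment r c n → proj₁ x ≡ r × c ≤ proj₂ x × proj₂ x < c ℕ.+ n
∈-segment⁻ r c n x∈ with ∈-map⁻ (r ,_) x∈
... | y , y∈ , ≡.refl = ≡.refl , ∈-run⁻ c n y∈

Touches : Cell → List Cell → Set
Touches b = Any (Adjacent b)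

module _ {a p} {A : Set a} {P : A → Set p} (P? : Decidable P) where

  partition-none : ∀ {xs} → All (λ x → ¬ P x) xs → partition P? xs ≡ ([] , xs)
  partition-none []                  = ≡.refl
  partition-none {x ∷ xs} (¬p ∷ ¬ps) with P? x
  ... | yes p = ⊥-elim (¬p p)
  ... | no  _ rewrite partition-none ¬ps = ≡.refl

  partition-first : ∀ {x xs} → P x → All (λ x → ¬ P x) xs → partition P? (x ∷ xs) ≡ (x ∷ [] , xs)
  partition-first {x} p ¬ps with P? x
  ... | yes _ rewrite partition-none ¬ps = ≡.refl
  ... | no ¬p = ⊥-elim (¬p p)

  partition-first₂ : ∀ {x y xs} → P x → P y → All (λ x → ¬ P x) xs →
                     partition P? (x ∷ y ∷ xs) ≡ (x ∷ y ∷ [] , xs)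
  partition-first₂ {x} {y} p q ¬ps with P? x
  ... | yes _ rewrite partition-first q ¬ps = ≡.refl
  ... | no ¬p = ⊥-elim (¬p p)

private
  fuse : Cell → List (List Cell) × List (List Cell) → List (List Cell)
  fuse b (touching , others) = (b ∷ concat touching) ∷ others

components-isolated : ∀ b bs {Cs} → components bs ≡ Cs → All (λ C → ¬ Touches b C) Cs →
                      components (b ∷ bs) ≡ (b ∷ []) ∷ Cs
components-isolated b bs ≡.refl ¬t = ≡.cong (fuse b) (partition-none (any? (adjacent? b)) ¬t)

components-join : ∀ b bs {C Cs} → components bs ≡ C ∷ Cs → Touches b C → All (λ C → ¬ Touches b C) Cs →
                  components (b ∷ bs) ≡ (b ∷ C) ∷ Cs
components-join b bs {C} {Cs} eq t ¬t = ≡.trans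
  (≡.cong (λ Cs → fuse b (partition (any? (adjacent? b)) Cs)) eq)
  (≡.trans (≡.cong (fuse b) (partition-first (any? (adjacent? b)) t ¬t))
    (≡.cong (λ C → (b ∷ C) ∷ Cs) (List.++-identityʳ C)))

components-join₂ : ∀ b bs {C D Cs} → components bs ≡ C ∷ D ∷ Cs → Touches b C → Touches b D →
                   All (λ C → ¬ Touches b C) Cs → components (b ∷ bs) ≡ (b ∷ C ++ D) ∷ Cs
components-join₂ b bs {C} {D} {Cs} eq t t′ ¬t = ≡.trans
  (≡.cong (λ Cs → fuse b (partition (any? (adjacent? b)) Cs)) eq)
  (≡.trans (≡.cong (fuse b) (partition-first₂ (any? (adjacent? b)) t t′ ¬t))
    (≡.cong (λ D → (b ∷ C ++ D) ∷ Cs) (List.++-identityʳ D)))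

-- The cell x lies below row r and does not touch a cell of row r in a column
-- ≥ c.
Clear : ℕ → ℕ → Cell → Set
Clear r c x = r < proj₁ x × (proj₁ x ≡ suc r → proj₂ x < c)

clear-suc : ∀ {r c x} → Clear r c x → Clear r (suc c) x
clear-suc (p , q) = p , λ eq → ℕ.m<n⇒m<1+n (q eq)

clear⇒¬adjacent : ∀ {r c x} → Clear r c x → ¬ Adjacent (r , c) x
clear⇒¬adjacent (p , q) (inj₁ (inj₁ ≡.refl)) = ℕ.<-irrefl ≡.refl p
clear⇒¬adjacent (p , q) (inj₁ (inj₂ ≡.refl)) = ℕ.<-irrefl ≡.refl (q ≡.refl)
clear⇒¬adjacent (p , q) (inj₂ (inj₁ ≡.refl)) = ℕ.<-irrefl ≡.refl p
clear⇒¬adjacent (p , q) (inj₂ (inj₂ ≡.refl)) = ℕ.<-asym p ℕ.≤-refl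

clear⇒¬touches : ∀ {r c C} → All (Clear r c) C → ¬ Touches (r , c) C
clear⇒¬touches clear t with find t
... | x , x∈ , adj = clear⇒¬adjacent (All.lookup clear x∈) adj

-- The rightmost cell of the row opens a new component. Every later cell joins it through its right
-- neighbour, and `Clear` excludes any contact with the components below.
components-free : ∀ r c n rest {Cs} → components rest ≡ Cs → All (All (Clear r c)) Cs →
                  components (segment r c (suc n) ++ rest) ≡ segment r c (suc n) ∷ Cs
components-free r c zero    rest eq clear = components-isolated (r , c) rest eq (All.map clear⇒¬touches clear)
components-free r c (suc n) rest eq clear = components-join (r , c) (segment r (suc c) (suc n) ++ rest)
  (components-free r (suc c) n rest eq (All.map (All.map clear-suc) clear))
  (here (inj₁ (inj₁ ≡.refl))) (All.map clear⇒¬touches clear)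

-- Only the leftmost cell of the row, which is added last, has a cell of `C` below it; it fuses the
-- finished row with `C`. Hence `C` has to be clear from column `suc c` on, the other components
-- from column `c` on.
components-linked : ∀ r c n rest {C Cs} → components rest ≡ C ∷ Cs → (suc r , c) ∈ C →
  All (Clear r (suc c)) C → All (All (Clear r c)) Cs →
  components (segment r c (suc n) ++ rest) ≡ (segment r c (suc n) ++ C) ∷ Cs
components-linked r c zero    rest eq below∈ clear clears = components-join (r , c) rest
  eq (lose below∈ (inj₁ (inj₂ ≡.refl))) (All.map clear⇒¬touches clears)
components-linked r c (suc n) rest eq below∈ clear clears = components-join₂ (r , c)
    (segment r (suc c) (suc n) ++ rest)
  (components-free r (suc c) n rest eq (clear ∷ All.map (All.map clear-suc) clears))
  (here (inj₁ (inj₁ ≡.refl))) (lose below∈ (inj₁ (inj₂ ≡.refl))) (All.map clear⇒¬touches clears)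

_∈ᶜ?_ : (x : Cell) (X : List Cell) → Dec (x ∈ X)
_∈ᶜ?_ = mem? _≟ᶜ_

filter-cong : ∀ {a p q} {A : Set a} {P : A → Set p} {Q : A → Set q} (P? : Decidable P) (Q? : Decidable Q) {xs} →
              All (λ x → (P x → Q x) × (Q x → P x)) xs → filter P? xs ≡ filter Q? xs
filter-cong P? Q? []                         = ≡.refl
filter-cong P? Q? (_∷_ {x = x} (to , from) ps) with P? x | Q? x
... | yes _ | yes _ = ≡.cong (x ∷_) (filter-cong P? Q? ps)
... | no _  | no _  = filter-cong P? Q? ps
... | yes p | no ¬q = ⊥-elim (¬q (to p))
... | no ¬p | yes q = ⊥-elim (¬p (from q))

filter-extend : ∀ (f : Cell → Cell) b X Y → All (λ x → f x ≢ b) X →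
                filter (λ x → f x ∈ᶜ? (b ∷ Y)) X ≡ filter (λ x → f x ∈ᶜ? Y) X
filter-extend f b X Y fx≢b = filter-cong (λ x → f x ∈ᶜ? (b ∷ Y)) (λ x → f x ∈ᶜ? Y)
  (All.map (λ fx≢b → (λ { (here q) → ⊥-elim (fx≢b q) ; (there q) → q }) , there) fx≢b)

-- Hook polynomials as products of row weights

module HookPolynomials {c ℓ} (K : CommutativeRing c ℓ) (isℚAlgebra : IsℚAlgebra K)
  (a : ℤ → CommutativeRing.Carrier K) (N : ℕ) (u v : CommutativeRing.Carrier K) where
  open CommutativeRing K
  open RingOps K
  open RingSums K
  open SymmetricFunctions K isℚAlgebra
  open Determinants K isℚAlgebra a N using (α; β)
  open Branching K (α u v) (β u v) (u + v)
  open SetoidReasoning setoid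

  factor : ∀ {p} {P : Set p} → Dec P → Carrier → Carrier
  factor (yes _) x = x
  factor (no  _) x = 1#

  factor-yes : ∀ {p} {P : Set p} (d : Dec P) x → P → factor d x ≡ x
  factor-yes (yes _) x p = ≡.refl
  factor-yes (no ¬p) x p = ⊥-elim (¬p p)

  factor-no : ∀ {p} {P : Set p} (d : Dec P) x → ¬ P → factor d x ≡ 1#
  factor-no (yes p) x ¬p = ⊥-elim (¬p p)
  factor-no (no _)  x ¬p = ≡.refl

  prodList-++ : ∀ xs ys → prodList (xs ++ ys) ≈ prodList xs * prodList ys
  prodList-++ []       ys = sym (*-identityˡ _)
  prodList-++ (x ∷ xs) ys = trans (*-congˡ (prodList-++ xs ys)) (sym (*-assoc _ _ _))

  private
    sf : Side → Carrier
    sf = sideFactor a u v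

  module _ (f : Cell → Cell) (s : Cell → Side) where

    sides : List Cell → Carrier
    sides X = prodList (map sf (map s (filter (λ x → f x ∈ᶜ? X) X)))

    sides-cons : ∀ b X → f b ≢ b → All (λ x → f x ≢ b) X →
                 sides (b ∷ X) ≈ factor (f b ∈ᶜ? X) (sf (s b)) * sides X
    sides-cons b X fb≢b fx≢b = by-cases (f b ∈ᶜ? X)
      where
      product-over : List Cell → Carrier
      product-over F = prodList (map sf (map s F))
      tail-sides : product-over (filter (λ x → f x ∈ᶜ? (b ∷ X)) X) ≡ sides X
      tail-sides = ≡.cong product-over (filter-extend f b X X fx≢b)
      by-cases : (d : Dec (f b ∈ X)) → sides (b ∷ X) ≈ factor d (sf (s b)) * sides X
      by-cases (yes p) = reflexive (≡.trans
        (≡.cong product-over (List.filter-accept (λ x → f x ∈ᶜ? (b ∷ X)) {b} {X} (there p)))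
        (≡.cong (sf (s b) *_) tail-sides))
      by-cases (no ¬p) = trans
        (reflexive (≡.trans (≡.cong product-over (List.filter-reject (λ x → f x ∈ᶜ? (b ∷ X)) {b} {X}
          (λ { (here q) → fb≢b q ; (there q) → ¬p q }))) tail-sides))
        (sym (*-identityˡ _))

  hookSides : List Cell → Carrier
  hookSides X = prodList (map sf (interiorSides X))

  hookSides-split : ∀ X → hookSides X ≈ sides right rightSide X * sides below belowSide X
  hookSides-split X = trans
    (reflexive (≡.cong prodList (List.map-++ sf
      (map rightSide (filter (λ x → right x ∈ᶜ? X) X)) (map belowSide (filter (λ x → below x ∈ᶜ? X) X)))))
    (prodList-++ (map sf (map rightSide (filter (λ x → right x ∈ᶜ? X) X)))
                 (map sf (map belowSide (filter (λ x → below x ∈ᶜ? X) X))))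

  right≢ : ∀ b → right b ≢ b
  right≢ b eq = ℕ.1+n≢n (≡.cong proj₂ eq)

  below≢ : ∀ b → below b ≢ b
  below≢ b eq = ℕ.1+n≢n (≡.cong proj₁ eq)

  -- No cell of `X` has `b` on its right or below it, so the sides interior to `X` are unaffected
  -- and the new ones are the right and lower sides of `b`.
  hookSides-cons : ∀ b X → All (λ x → right x ≢ b × below x ≢ b) X →
    hookSides (b ∷ X) ≈
    (factor (right b ∈ᶜ? X) (sf (rightSide b)) * factor (below b ∈ᶜ? X) (sf (belowSide b))) * hookSides X
  hookSides-cons b X X≢b = begin
    hookSides (b ∷ X)
      ≈⟨ hookSides-split (b ∷ X) ⟩
    sides right rightSide (b ∷ X) * sides below belowSide (b ∷ X)
      ≈⟨ *-cong (sides-cons right rightSide b X (right≢ b) (All.map proj₁ X≢b))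
                (sides-cons below belowSide b X (below≢ b) (All.map proj₂ X≢b)) ⟩
    (R * sides right rightSide X) * (B * sides below belowSide X)
      ≈⟨ solve 4 (λ R x B y → (R :* x) :* (B :* y) := (R :* B) :* (x :* y)) refl R _ B _ ⟩
    (R * B) * (sides right rightSide X * sides below belowSide X)
      ≈⟨ *-congˡ (hookSides-split X) ⟨
    (R * B) * hookSides X ∎
    where
    R = factor (right b ∈ᶜ? X) (sf (rightSide b))
    B = factor (below b ∈ᶜ? X) (sf (belowSide b))

  rightSides : (r c n : ℕ) → Carrier
  rightSides r c zero    = 1#
  rightSides r c (suc n) = sf (rightSide (r , c)) * rightSides r (suc c) n

  after : ∀ {r c n C} → All (λ x → r < proj₁ x) C →
          All (λ x → right x ≢ (r , c) × below x ≢ (r , c)) (segment r (suc c) n ++ C)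
  after {r} {c} {n} C> = All.++⁺
    (All.tabulate (λ x∈ → let (r≡ , c< , _) = ∈-segment⁻ r (suc c) n x∈ in
      (λ eq → ℕ.<⇒≢ (ℕ.m<n⇒m<1+n c<) (≡.sym (≡.cong proj₂ eq)))
      , (λ eq → ℕ.1+n≢n (≡.trans (≡.cong proj₁ eq) (≡.sym r≡)))))
    (All.map (λ r< → (λ eq → ℕ.<⇒≢ r< (≡.sym (≡.cong proj₁ eq)))
      , (λ eq → ℕ.<⇒≢ (ℕ.m<n⇒m<1+n r<) (≡.sym (≡.cong proj₁ eq)))) C>)

  right∉ : ∀ {r c C} → All (λ x → r < proj₁ x) C → right (r , c) ∉ C
  right∉ C> x∈ = ℕ.<-irrefl ≡.refl (All.lookup C> x∈)

  below∉ : ∀ {r c C} n → All (Clear r c) C → below (r , c) ∉ segment r (suc c) n ++ C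
  below∉ {r} {c} n clear x∈ with ∈-++⁻ (segment r (suc c) n) x∈
  ... | inj₁ y∈ = ℕ.1+n≢n (proj₁ (∈-segment⁻ r (suc c) n y∈))
  ... | inj₂ y∈ = ℕ.<-irrefl ≡.refl (proj₂ (All.lookup clear y∈) ≡.refl)

  hookSides-free : ∀ r c n {C} → All (Clear r c) C →
                   hookSides (segment r c (suc n) ++ C) ≈ rightSides r c n * hookSides C
  hookSides-free r c zero {C} clear = trans (hookSides-cons (r , c) C (after {n = 0} (All.map proj₁ clear)))
    (*-congʳ (trans (*-cong
      (reflexive (factor-no (right (r , c) ∈ᶜ? C) _ (right∉ (All.map proj₁ clear))))
      (reflexive (factor-no (below (r , c) ∈ᶜ? C) _ (below∉ 0 clear)))) (*-identityˡ 1#)))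
  hookSides-free r c (suc n) {C} clear = trans
    (hookSides-cons (r , c) X (after (All.map proj₁ clear)))
    (trans (*-cong (trans (*-cong
        (reflexive (factor-yes (right (r , c) ∈ᶜ? X) _ (here ≡.refl)))
        (reflexive (factor-no (below (r , c) ∈ᶜ? X) _ (below∉ (suc n) clear)))) (*-identityʳ _))
      (hookSides-free r (suc c) n (All.map clear-suc clear))) (sym (*-assoc _ _ _)))
    where X = segment r (suc c) (suc n) ++ C

  hookSides-linked : ∀ r c n {C} → (suc r , c) ∈ C → All (Clear r (suc c)) C →
    hookSides (segment r c (suc n) ++ C) ≈ (sf (belowSide (r , c)) * rightSides r c n) * hookSides C
  hookSides-linked r c zero {C} below∈ clear = trans
    (hookSides-cons (r , c) C (after {n = 0} (All.map proj₁ clear)))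
    (*-congʳ (trans (*-comm _ _) (*-cong
      (reflexive (factor-yes (below (r , c) ∈ᶜ? C) _ below∈))
      (reflexive (factor-no (right (r , c) ∈ᶜ? C) _ (right∉ (All.map proj₁ clear)))))))
  hookSides-linked r c (suc n) {C} below∈ clear = trans
    (hookSides-cons (r , c) X (after (All.map proj₁ clear)))
    (trans (*-cong (*-cong
        (reflexive (factor-yes (right (r , c) ∈ᶜ? X) _ (here ≡.refl)))
        (reflexive (factor-yes (below (r , c) ∈ᶜ? X) _ (∈-++⁺ʳ (segment r (suc c) (suc n)) below∈))))
      (hookSides-free r (suc c) n clear))
      (solve 4 (λ R B P S → (R :* B) :* (P :* S) := (B :* (R :* P)) :* S) refl _ _ _ _))
    where X = segment r (suc c) (suc n) ++ C

  module _ (k r : ℕ) (N≡ : N ≡ r ℕ.+ suc k) where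

    private
      shift : ∀ c → + (suc (c ℕ.+ k)) ℤ.- + N ≡ + c ℤ.- + r
      shift c = ≡.trans (≡.cong₂ (λ p n → + p ℤ.- + n) (≡.sym (ℕ.+-suc c k)) N≡) (m+d-[i+d] c (suc k) r)

    -- The midpoint (r + 1, c + ½) has δ - ε = c - r - ½, where `a′` reads `a` at c - r, which is
    -- the position `suc (c + k)` less `N`. For a right side δ - ε is larger by 1, and so is the
    -- position in `rightSide-α`.
    belowSide-β : ∀ c → sf (belowSide (r , c)) ≡ β u v (suc (c ℕ.+ k))
    belowSide-β c = ≡.cong (λ z → v + a z) (≡.trans
      (≡.trans (ℤ.+-assoc (+ c) (ℤ.- + suc r) (+ 1)) (≡.cong (λ z → + c ℤ.+ z) (≡.trans (ℤ.-m+n≡n⊖m (suc r) 1)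
        (≡.trans (≡.sym (ℤ.m-n≡m⊖n 1 (suc r))) (one-minus r)))))
      (≡.sym (shift c)))
      where
      one-minus : ∀ r → + 1 ℤ.- + suc r ≡ ℤ.- + r
      one-minus r = ≡.trans (ℤ.m-n≡m⊖n 1 (suc r)) (≡.trans (ℤ.[1+m]⊖[1+n]≡m⊖n 0 r)
        (≡.trans (≡.sym (ℤ.m-n≡m⊖n 0 r)) (ℤ.+-identityˡ (ℤ.- + r))))

    rightSide-α : ∀ c → sf (rightSide (r , c)) ≡ α u v (suc (suc c ℕ.+ k))
    rightSide-α c = ≡.cong (λ z → u + - a z) (≡.trans (m-n+n (+ suc c ℤ.- + r) (+ 1)) (≡.sym (shift (suc c))))

    rightSides-∏α : ∀ c n → rightSides r c n ≈ ∏α (suc (suc (c ℕ.+ k))) n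
    rightSides-∏α c zero    = refl
    rightSides-∏α c (suc n) = *-cong (reflexive (rightSide-α c)) (rightSides-∏α (suc c) n)

  -- The invariant passed to the row above. A row can touch the next one only at the last cell of
  -- that next row; `first` says that this cell lies in the hook listed first and that no other hook
  -- reaches row `r`, while `bounded` supplies the `Clear` conditions.
  record Analysis {k} (r : ℕ) (ls ns : Vec ℕ k) : Set (c ⊔ ℓ) where
    field
      hooks      : List (List Cell)
      components≡ : components (skew r ls ns) ≡ hooks
      bounded    : All (All (λ x → r ≤ proj₁ x × (proj₁ x ≡ r → proj₂ x < at ls 0))) hooks
      first      : at ns 0 < at ls 0 → ∃ λ C → ∃ λ Cs → hooks ≡ C ∷ Cs × (r , pred (at ls 0)) ∈ C
                   × All (All (λ x → r < proj₁ x)) Cs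
      product     : prodList (map (hookPolynomial a u v) hooks) ≈ skewWeight ls ns
  open Analysis

  segment-last : ∀ r c n → (r , c ℕ.+ n) ∈ segment r c (suc n)
  segment-last r c n = ∈-map⁺ (r ,_) (∈-run⁺ c (suc n) (ℕ.m≤m+n c n) (ℕ.≤-reflexive (≡.sym (ℕ.+-suc c n))))

  -- A row of λ / ν is empty, separate from the next row, or linked to it. By `thin` the length of
  -- the next row of λ is at most `suc n`, so two consecutive rows of λ / ν have at most the column
  -- `n` in common, and they have it only if that length is `suc n`.
  analyse : ∀ {k} r → N ≡ r ℕ.+ k → (ls ns : Vec ℕ k) → Decreasing ls → ns ◁ ls → Analysis r ls ns
  analyse r N≡ [] [] _ _ = record
    { hooks = [] ; components≡ = ≡.refl ; bounded = [] ; first = λ () ; product = refl }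
  analyse r N≡ (l ∷ ls) (_∷_ {n = k} n ns) dec n◁l = by-length (l ∸ n) ≡.refl
    where
    A : Analysis (suc r) ls ns
    A = analyse (suc r) (≡.trans N≡ (ℕ.+-suc r k)) ls ns (λ r → dec (suc r)) (◁-tail n◁l)
    lower : All (All (λ x → r < proj₁ x)) (hooks A)
    lower = All.map (All.map proj₁) (bounded A)
    by-length : ∀ m → l ∸ n ≡ m → Analysis r (l ∷ ls) (n ∷ ns)
    by-length zero eq = record
      { hooks = hooks A
      ; components≡ = ≡.trans (≡.cong (λ m → components (segment r n m ++ skew (suc r) ls ns)) eq)
          (components≡ A)
      ; bounded = All.map (All.map (λ p → ℕ.<⇒≤ p , λ eq → ⊥-elim (ℕ.<⇒≢ p (≡.sym eq)))) lower
      ; first = λ n<l → ⊥-elim (ℕ.<⇒≱ n<l l≤n)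
      ; product = begin
          prodList (map (hookPolynomial a u v) (hooks A))    ≈⟨ product A ⟩
          skewWeight ls ns                                   ≈⟨ *-identityˡ _ ⟨
          1# * skewWeight ls ns                              ≈⟨ *-congʳ
              (reflexive (≡.cong (freeRow (suc (n ℕ.+ k))) eq)) ⟨
          freeRow (suc (n ℕ.+ k)) (l ∸ n) * skewWeight ls ns
            ≈⟨ *-congʳ (reflexive (rowWeight-unlinked k l (at ls 0) n l₂≤n)) ⟨
          skewWeight (l ∷ ls) (n ∷ ns)                       ∎
      }
      where
      l≤n : l ≤ n
      l≤n = ℕ.m∸n≡0⇒m≤n eq
      l₂≤n : at ls 0 ≤ n
      l₂≤n = ℕ.≤-trans (dec 0) l≤n
    by-length (suc m) eq = by-link (ℕ.m≤n⇒m<n∨m≡n (thin n◁l 0))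
      where
      S : List Cell
      S = segment r n (suc m)
      n<l : n < l
      n<l = ℕ.m∸n≢0⇒n<m (λ p → ℕ.1+n≢0 (≡.trans (≡.sym eq) p))
      l≡ : l ≡ suc (n ℕ.+ m)
      l≡ = ≡.trans (≡.sym (ℕ.m+[n∸m]≡n (ℕ.<⇒≤ n<l))) (≡.trans (≡.cong (n ℕ.+_) eq) (ℕ.+-suc n m))
      S-bounded : All (λ x → r ≤ proj₁ x × (proj₁ x ≡ r → proj₂ x < l)) S
      S-bounded = All.tabulate (λ x∈ → let (r≡ , _ , <l) = ∈-segment⁻ r n (suc m) x∈ in
        ℕ.≤-reflexive (≡.sym r≡) , λ _ → ℕ.≤-trans <l (ℕ.≤-reflexive (≡.trans (ℕ.+-suc n m) (≡.sym l≡))))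
      lower-bounded : ∀ {X} → All (λ x → r < proj₁ x) X →
                      All (λ x → r ≤ proj₁ x × (proj₁ x ≡ r → proj₂ x < l)) X
      lower-bounded = All.map (λ p → ℕ.<⇒≤ p , λ eq → ⊥-elim (ℕ.<⇒≢ p (≡.sym eq)))
      last∈ : (r , pred l) ∈ S
      last∈ = ≡.subst (λ c → (r , c) ∈ S) (≡.sym (≡.cong pred l≡)) (segment-last r n m)
      components-skew : ∀ {Cs} → components (S ++ skew (suc r) ls ns) ≡ Cs →
                        components (skew r (l ∷ ls) (n ∷ ns)) ≡ Cs
      components-skew p = ≡.trans (≡.cong (λ m → components (segment r n m ++ skew (suc r) ls ns)) eq) p
      by-link : suc (at ls 0) ≤ suc n ⊎ at ls 0 ≡ suc n → Analysis r (l ∷ ls) (n ∷ ns)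
      by-link (inj₁ l₂<1+n) = record
        { hooks = S ∷ hooks A
        ; components≡ = components-skew (components-free r n m (skew (suc r) ls ns) (components≡ A)
            (All.map (All.map (λ (p , q) → p , λ eq → ℕ.≤-trans (q eq) l₂≤n)) (bounded A)))
        ; bounded = S-bounded ∷ All.map lower-bounded lower
        ; first = λ _ → S , hooks A , ≡.refl , last∈ , lower
        ; product = *-cong hook-product (product A)
        }
        where
        l₂≤n : at ls 0 ≤ n
        l₂≤n = ℕ.s≤s⁻¹ l₂<1+n
        hook-product : hookPolynomial a u v S ≈ rowWeight k l (at ls 0) n
        hook-product = begin
          (u + v) * hookSides S
            ≈⟨ *-congˡ (reflexive (≡.cong hookSides (List.++-identityʳ S))) ⟨
          (u + v) * hookSides (S ++ [])
            ≈⟨ *-congˡ (trans (hookSides-free r n m []) (trans (*-identityʳ _) (rightSides-∏α k r N≡ n m))) ⟩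
          freeRow (suc (n ℕ.+ k)) (suc m)
            ≈⟨ reflexive (≡.cong (freeRow (suc (n ℕ.+ k))) eq) ⟨
          freeRow (suc (n ℕ.+ k)) (l ∸ n)
            ≈⟨ reflexive (rowWeight-unlinked k l (at ls 0) n l₂≤n) ⟨
          rowWeight k l (at ls 0) n ∎
      -- The next row of λ / ν is nonempty here: the row of ν has length at most `n`, that of λ has
      -- length `suc n`.
      by-link (inj₂ l₂≡1+n) with first A (≡.subst (at ns 0 <_) (≡.sym l₂≡1+n) (ℕ.s≤s (decreasing n◁l 0)))
      ... | C , Cs , hooks≡ , below∈ , clears = record
        { hooks = (S ++ C) ∷ Cs
        ; components≡ = components-skew (components-linked r n m (skew (suc r) ls ns)
            (≡.trans (components≡ A) hooks≡) below∈′ clear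
            (All.map (All.map (λ p → ℕ.<-trans ℕ.≤-refl p , λ eq → ⊥-elim (ℕ.<⇒≢ p (≡.sym eq)))) clears))
        ; bounded = All.++⁺ S-bounded (lower-bounded (All.map proj₁ clear))
                    ∷ All.map (λ C> → lower-bounded (All.map (ℕ.<-trans ℕ.≤-refl) C>)) clears
        ; first = λ _ → S ++ C , Cs , ≡.refl , ∈-++⁺ˡ last∈ , All.map (All.map (ℕ.<-trans ℕ.≤-refl)) clears
        ; product = begin
            ((u + v) * hookSides (S ++ C)) * rest
              ≈⟨ *-congʳ (*-congˡ (hookSides-linked r n m below∈′ clear)) ⟩
            ((u + v) * ((sf (belowSide (r , n)) * rightSides r n m) * hookSides C)) * rest
              ≈⟨ solve 4 (λ t p h q → (t :* (p :* h)) :* q := p :* ((t :* h) :* q)) refl (u + v) _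
                  (hookSides C) rest ⟩
            (sf (belowSide (r , n)) * rightSides r n m) * (hookPolynomial a u v C * rest)
              ≈⟨ *-cong row-product (trans (reflexive (≡.cong
                  (λ Cs → prodList (map (hookPolynomial a u v) Cs)) (≡.sym hooks≡))) (product A)) ⟩
            skewWeight (l ∷ ls) (n ∷ ns) ∎
        }
        where
        rest = prodList (map (hookPolynomial a u v) Cs)
        below∈′ : (suc r , n) ∈ C
        below∈′ = ≡.subst (λ l₂ → (suc r , pred l₂) ∈ C) l₂≡1+n below∈
        clear : All (Clear r (suc n)) C
        clear = All.map (λ (p , q) → p , λ eq → ℕ.≤-trans (q eq) (ℕ.≤-reflexive l₂≡1+n))
          (All.head (≡.subst (All _) hooks≡ (bounded A)))
        l∸1+n : l ∸ suc n ≡ m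
        l∸1+n = ≡.trans (≡.cong (_∸ suc n) l≡) (ℕ.m+n∸m≡n n m)
        row-product : sf (belowSide (r , n)) * rightSides r n m ≈ rowWeight k l (at ls 0) n
        row-product = begin
          sf (belowSide (r , n)) * rightSides r n m
            ≈⟨ *-cong (reflexive (belowSide-β k r N≡ n)) (rightSides-∏α k r N≡ n m) ⟩
          β u v (suc (n ℕ.+ k)) * ∏α (suc (suc (n ℕ.+ k))) m
            ≈⟨ *-congˡ (reflexive (≡.cong (∏α (suc (suc (n ℕ.+ k)))) l∸1+n)) ⟨
          β u v (suc (n ℕ.+ k)) * ∏α (suc (suc (n ℕ.+ k))) (l ∸ suc n)
            ≈⟨ reflexive (rowWeight-linked k l n) ⟨
          rowWeight k l (suc n) n
            ≈⟨ reflexive (≡.cong (λ l₂ → rowWeight k l l₂ n) l₂≡1+n) ⟨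
          rowWeight k l (at ls 0) n ∎

  polynomial-skew : (ls ns : Vec ℕ N) → Decreasing ls → ns ◁ ls →
                    polynomial a u v (skew 0 ls ns) ≈ skewWeight ls ns
  polynomial-skew ls ns dec n◁l = trans
    (reflexive (≡.cong (λ Cs → prodList (map (hookPolynomial a u v) Cs)) (components≡ A))) (product A)
    where A = analyse 0 ≡.refl ls ns dec n◁l

-- Tableaux as chains of shapes

module Chains where
  open import Data.Nat.Base
  open import Data.Nat.Properties
  open ≡ using (refl; sym; trans; cong; cong₂; subst; module ≡-Reasoning)

  antitone : ∀ {k} (ls : Vec ℕ k) → Decreasing ls → ∀ {r r′} → r ≤ r′ → at ls r′ ≤ at ls r
  antitone ls dec {r} r≤r′ = go (≤⇒≤′ r≤r′)
    where
    go : ∀ {r′} → r ≤′ r′ → at ls r′ ≤ at ls r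
    go (≤′-reflexive refl) = ≤-refl
    go (≤′-step {n = r′} p) = ≤-trans (dec r′) (go p)

  <-ext : ∀ {m n} → (∀ c → c < m → c < n) → m ≤ n
  <-ext {zero}  p = z≤n
  <-ext {suc m} p = p m ≤-refl

  diagonal-< : ∀ {r r′ c c′} → r + c′ ≡ r′ + c → r < r′ → c < c′
  diagonal-< {r} {r′} {c} {c′} eq r<r′ = +-cancelˡ-< r c c′ (≤-trans (+-monoˡ-< c r<r′) (≤-reflexive (sym eq)))

  at-beyond : ∀ {k} (ls : Vec ℕ k) r → k ≤ r → at ls r ≡ 0
  at-beyond []       r       _ = refl
  at-beyond (l ∷ ls) (suc r) p = at-beyond ls r (s≤s⁻¹ p)

  tab : ∀ k → (ℕ → ℕ) → Vec ℕ k
  tab zero    f = []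
  tab (suc k) f = f 0 ∷ tab k (λ r → f (suc r))

  at-tab : ∀ k f → (∀ r → k ≤ r → f r ≡ 0) → ∀ r → at (tab k f) r ≡ f r
  at-tab zero    f p r       = sym (p r z≤n)
  at-tab (suc k) f p zero    = refl
  at-tab (suc k) f p (suc r) = at-tab k (λ r → f (suc r)) (λ r q → p (suc r) (s≤s q)) r

  module _ {p} {P : ℕ → Set p} (P? : Decidable P) where

    -- For a predicate closed downwards, this is the length of the initial interval on which it
    -- holds below the given bound.
    threshold : ℕ → ℕ
    threshold zero = 0
    threshold (suc m) with P? m
    ... | yes _ = suc m
    ... | no  _ = threshold m

    threshold≤ : ∀ m → threshold m ≤ m
    threshold≤ zero = z≤n
    threshold≤ (suc m) with P? m
    ... | yes _ = ≤-refl
    ... | no  _ = m≤n⇒m≤1+n (threshold≤ m)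

    <threshold⁺ : ∀ m {c} → c < m → P c → c < threshold m
    <threshold⁺ (suc m) {c} c<m Pc with P? m | m≤n⇒m<n∨m≡n (s≤s⁻¹ c<m)
    ... | yes _ | _         = c<m
    ... | no  _ | inj₁ c<m′ = <threshold⁺ m c<m′ Pc
    ... | no ¬p | inj₂ refl = ⊥-elim (¬p Pc)

    <threshold⁻ : ∀ m → (∀ {c c′} → c ≤ c′ → c′ < m → P c′ → P c) → ∀ {c} → c < threshold m → P c
    <threshold⁻ (suc m) closed {c} c< with P? m
    ... | yes p = closed (s≤s⁻¹ c<) ≤-refl p
    ... | no  _ = <threshold⁻ m (λ p q → closed p (m<n⇒m<1+n q)) c<

  module _ {N : ℕ} where

    -- A tableau with entries < n, given by the shapes of its subtableaux with
    -- entries < n - 1, …, < 1, < 0.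
    data IsChain : ∀ {n} → Vec ℕ N → Vec (Vec ℕ N) n → Set where
      empty : ∀ {ls} → (∀ r → at ls r ≡ 0) → IsChain ls []
      step  : ∀ {n ls ns} {ch : Vec (Vec ℕ N) n} → ns ◁ ls → IsChain ns ch → IsChain ls (ns ∷ ch)

    -- A chain of length 0 exists only over the empty shape. The argument is the first row, which
    -- decides emptiness because shapes are decreasing.
    chains₀ : ℕ → List (Vec (Vec ℕ N) 0)
    chains₀ zero    = [] ∷ []
    chains₀ (suc _) = []

    chains : ∀ n → Vec ℕ N → List (Vec (Vec ℕ N) n)
    chains zero    ls = chains₀ (at ls 0)
    chains (suc n) ls = pairsWith (chains n) _∷_ (choices ls)

    chains-sound : ∀ n {ls} → Decreasing ls → ∀ {ch} → ch ∈ chains n ls → IsChain ls ch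
    chains-sound zero {ls} dec {[]} ch∈ with at ls 0 in eq
    ... | zero = empty (λ r → n≤0⇒n≡0 (≤-trans (antitone ls dec z≤n) (≤-reflexive eq)))
    chains-sound (suc n) {ls} dec ch∈ with ∈-pairsWith⁻ (chains n) _∷_ (choices ls) ch∈
    ... | ns , ch , ns∈ , ch∈′ , refl =
      let ns◁ls = choices-sound dec ns∈ in step ns◁ls (chains-sound n (decreasing ns◁ls) ch∈′)

    chains-complete : ∀ {n ls} {ch : Vec (Vec ℕ N) n} → IsChain ls ch → ch ∈ chains n ls
    chains-complete (empty p) rewrite p 0 = here refl
    chains-complete (step p q) = ∈-pairsWith⁺ _ _∷_ (choices-complete p) (chains-complete q)

    chains-unique : ∀ n ls → Unique (chains n ls)
    chains-unique zero ls with at ls 0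
    ... | zero  = [] ∷ []
    ... | suc _ = []
    chains-unique (suc n) ls = pairsWith-unique (chains n) _∷_ (λ { refl → refl , refl })
      (chains-unique n) (choices-unique ls)

    -- The entry of a box of the shape is the number of the step that adds it to the growing shape;
    -- the search starts from the last step.
    fill : ∀ {n} → Vec (Vec ℕ N) n → ℕ → ℕ → ℕ
    fill []                   r c = 0
    fill (_∷_ {n = n} ns ch) r c with c <? at ns r
    ... | yes _ = fill ch r c
    ... | no  _ = n

    fill-inner : ∀ {n} ns (ch : Vec (Vec ℕ N) n) {r c} → c < at ns r → fill (ns ∷ ch) r c ≡ fill ch r c
    fill-inner ns ch {r} {c} p with c <? at ns r
    ... | yes _ = refl
    ... | no ¬p = ⊥-elim (¬p p)

    fill-outer : ∀ {n} ns (ch : Vec (Vec ℕ N) n) {r c} → at ns r ≤ c → fill (ns ∷ ch) r c ≡ n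
    fill-outer ns ch {r} {c} p with c <? at ns r
    ... | yes q = ⊥-elim (<⇒≱ q p)
    ... | no  _ = refl

    fill-bound : ∀ {n ls} {ch : Vec (Vec ℕ N) n} → IsChain ls ch → ∀ {r c} → c < at ls r → fill ch r c < n
    fill-bound (empty p) {r} c< = ⊥-elim (n≮0 (≤-trans c< (≤-reflexive (p r))))
    fill-bound (step {ns = ns} {ch} p q) {r} {c} c< with c <? at ns r
    ... | yes c<n = m<n⇒m<1+n (fill-bound q c<n)
    ... | no  _   = ≤-refl

    record IsTableau (ls : Vec ℕ N) (e : ℕ → ℕ → ℕ) : Set where
      field
        rowWeak        : ∀ {r c c′} → c ≤ c′ → c′ < at ls r → e r c ≤ e r c′
        columnWeak     : ∀ {r r′ c} → r ≤ r′ → c < at ls r′ → e r c ≤ e r′ c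
        diagonalStrict : ∀ {r r′ c c′} → r + c′ ≡ r′ + c → r < r′ → c′ < at ls r′ → e r c < e r′ c′
    open IsTableau

    fill-isTableau : ∀ {n ls} {ch : Vec (Vec ℕ N) n} → Decreasing ls → IsChain ls ch → IsTableau ls (fill ch)
    fill-isTableau dec (empty p) = record
      { rowWeak        = λ _ _ → z≤n
      ; columnWeak     = λ _ _ → z≤n
      ; diagonalStrict = λ {_} {r′} _ _ c′< → ⊥-elim (n≮0 (≤-trans c′< (≤-reflexive (p r′)))) }
    fill-isTableau {ls = ls} dec ch@(step {n} {ns = ns} {ch′} p q) = record
      { rowWeak = row-weak ; columnWeak = column-weak ; diagonalStrict = diagonal-strict }
      where
      T : IsTableau ns (fill ch′)
      T = fill-isTableau (decreasing p) q
      at-most : ∀ {r c} → c < at ls r → fill (ns ∷ ch′) r c ≤ n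
      at-most c< = s≤s⁻¹ (fill-bound ch c<)
      row-weak : ∀ {r c c′} → c ≤ c′ → c′ < at ls r → fill (ns ∷ ch′) r c ≤ fill (ns ∷ ch′) r c′
      row-weak {r} {c} {c′} c≤c′ c′< with at ns r ≤? c′
      ... | yes ≤c′ rewrite fill-outer ns ch′ {r} {c′} ≤c′ = at-most (≤-<-trans c≤c′ c′<)
      ... | no ≰c′ rewrite fill-inner ns ch′ {r} {c′} (≰⇒> ≰c′)
                         | fill-inner ns ch′ {r} {c} (≤-<-trans c≤c′ (≰⇒> ≰c′)) = rowWeak T c≤c′ (≰⇒> ≰c′)
      column-weak : ∀ {r r′ c} → r ≤ r′ → c < at ls r′ → fill (ns ∷ ch′) r c ≤ fill (ns ∷ ch′) r′ c
      column-weak {r} {r′} {c} r≤r′ c< with at ns r′ ≤? c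
      ... | yes ≤c rewrite fill-outer ns ch′ {r′} {c} ≤c = at-most (<-≤-trans c< (antitone ls dec r≤r′))
      ... | no ≰c rewrite fill-inner ns ch′ {r′} {c} (≰⇒> ≰c)
                        | fill-inner ns ch′ {r} {c} (<-≤-trans (≰⇒> ≰c) (antitone ns (decreasing p) r≤r′)) =
        columnWeak T r≤r′ (≰⇒> ≰c)
      -- This is where `thin` gives strictness along diagonals: a box of `ls` further down the same
      -- diagonal forces the earlier box into `ns`, where entries are below `n`.
      inside : ∀ {r r′ c c′} → r + c′ ≡ r′ + c → r < r′ → c′ < at ls r′ → c < at ns r
      inside {r} eq r<r′ c′< = s≤s⁻¹ (≤-trans (s≤s (diagonal-< eq r<r′))
        (≤-trans c′< (≤-trans (antitone ls dec r<r′) (thin p r))))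
      diagonal-strict : ∀ {r r′ c c′} → r + c′ ≡ r′ + c → r < r′ → c′ < at ls r′ →
                 fill (ns ∷ ch′) r c < fill (ns ∷ ch′) r′ c′
      diagonal-strict {r} {r′} {c} {c′} eq r<r′ c′<
        rewrite fill-inner ns ch′ {r} {c} (inside eq r<r′ c′<) with at ns r′ ≤? c′
      ... | yes ≤c′ rewrite fill-outer ns ch′ {r′} {c′} ≤c′ = fill-bound q (inside eq r<r′ c′<)
      ... | no ≰c′ rewrite fill-inner ns ch′ {r′} {c′} (≰⇒> ≰c′) = diagonalStrict T eq r<r′ (≰⇒> ≰c′)

    -- The next shape `ns` consists of the boxes with entry less than `n`. Row weakness makes each
    -- of its rows an initial interval, column weakness makes it decreasing. Diagonal strictness
    -- makes it thin: above and to the left of a box of `ls` the entry is smaller than one that is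
    -- at most `n`.
    chain-of : ∀ n ls (e : ℕ → ℕ → ℕ) → Decreasing ls → IsTableau ls e → (∀ {r c} → c < at ls r → e r c < n) →
               ∃ λ (ch : Vec (Vec ℕ N) n) → IsChain ls ch × (∀ {r c} → c < at ls r → fill ch r c ≡ e r c)
    chain-of zero ls e dec T e<n = [] , empty all-empty , λ {r} c< → ⊥-elim
        (n≮0 (≤-trans c< (≤-reflexive (all-empty r))))
      where
      all-empty : ∀ r → at ls r ≡ 0
      all-empty r with at ls r in eq
      ... | zero  = refl
      ... | suc _ = ⊥-elim (n≮0 (e<n {r} {0} (≤-trans z<s (≤-reflexive (sym eq)))))
    chain-of (suc n) ls e dec T e<n = let (ch , isChain , agrees) = rest in
      ns ∷ ch , step ns◁ls isChain , λ {r} {c} → agree ch agrees {r} {c}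
      where
      small? : ∀ r → Decidable (λ c → e r c < n)
      small? r c = e r c <? n
      len : ℕ → ℕ
      len r = threshold (small? r) (at ls r)
      ns : Vec ℕ N
      ns = tab N len
      at-ns : ∀ r → at ns r ≡ len r
      at-ns = at-tab N len (λ r N≤r → n≤0⇒n≡0 (≤-trans (threshold≤ (small? r) (at ls r))
          (≤-reflexive (at-beyond ls r N≤r))))
      small : ∀ {r c} → c < at ns r → e r c < n
      small {r} c< = <threshold⁻ (small? r) (at ls r) (λ p q s → ≤-<-trans (rowWeak T p q) s)
          (≤-trans c< (≤-reflexive (at-ns r)))
      inside : ∀ {r c} → c < at ls r → e r c < n → c < at ns r
      inside {r} c< p = ≤-trans (<threshold⁺ (small? r) (at ls r) c< p) (≤-reflexive (sym (at-ns r)))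
      ns⊆ls : ∀ r → at ns r ≤ at ls r
      ns⊆ls r = ≤-trans (≤-reflexive (at-ns r)) (threshold≤ (small? r) (at ls r))
      ns◁ls : ns ◁ ls
      ns◁ls = record
        { contained  = ns⊆ls
        ; thin       = λ r → ≤-pred-suc (<-ext λ c c< → inside {r} {c}
                         (<-≤-trans (<-trans ≤-refl (m<n∸1⇒1+m<n c<)) (dec r))
                         (≤-trans (diagonalStrict T {r} {suc r} {c} {suc c} (+-suc r c) ≤-refl (m<n∸1⇒1+m<n c<))
                           (s≤s⁻¹ (e<n (m<n∸1⇒1+m<n c<)))))
        ; decreasing = λ r → <-ext λ c c< → inside (<-≤-trans c< (≤-trans (ns⊆ls (suc r)) (dec r)))
                         (≤-<-trans (columnWeak T (n≤1+n r) (<-≤-trans c< (ns⊆ls (suc r)))) (small c<)) }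
        where
        ≤-pred-suc : ∀ {m n} → pred m ≤ n → m ≤ suc n
        ≤-pred-suc {zero}  p = z≤n
        ≤-pred-suc {suc m} p = s≤s p
        m<n∸1⇒1+m<n : ∀ {m n} → m < pred n → suc m < n
        m<n∸1⇒1+m<n {n = suc n} p = s≤s p
      rest : ∃ λ ch → IsChain ns ch × (∀ {r c} → c < at ns r → fill ch r c ≡ e r c)
      rest = chain-of n ns e (decreasing ns◁ls) (record
        { rowWeak        = λ {r} p q → rowWeak T p (<-≤-trans q (ns⊆ls r))
        ; columnWeak     = λ {_} {r′} p q → columnWeak T p (<-≤-trans q (ns⊆ls r′))
        ; diagonalStrict = λ {_} {r′} p q s → diagonalStrict T p q (<-≤-trans s (ns⊆ls r′)) }) small
      agree : ∀ ch → (∀ {r c} → c < at ns r → fill ch r c ≡ e r c) → ∀ {r c} → c < at ls r →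
            fill (ns ∷ ch) r c ≡ e r c
      agree ch agrees {r} {c} c< with at ns r ≤? c
      ... | yes ≤c = trans (fill-outer ns ch ≤c) (≤-antisym (≮⇒≥ (λ p → <⇒≱ (inside c< p) ≤c)) (s≤s⁻¹ (e<n c<)))
      ... | no ≰c  = trans (fill-inner ns ch (≰⇒> ≰c)) (agrees (≰⇒> ≰c))

    -- The largest proper shape is recovered from the filling as the set of boxes whose entry is
    -- below the top value, by `fill-bound` and `fill-outer`; the inner shapes follow by induction.
    fill-injective : ∀ {n ls} {ch ch′ : Vec (Vec ℕ N) n} → IsChain ls ch → IsChain ls ch′ →
                     (∀ {r c} → c < at ls r → fill ch r c ≡ fill ch′ r c) → ch ≡ ch′
    fill-injective (empty _) (empty _) _ = refl
    fill-injective {ls = ls} (step {ns = ns} {ch} p q) (step {ns = ns′} {ch′} p′ q′) agrees = cong-step same q′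
      where
      ⊆-by : ∀ {ns : Vec ℕ N} ns′ {n} {ch : Vec (Vec ℕ N) n} ch′ → ns ◁ ls → IsChain ns ch →
        (∀ {r c} → c < at ls r → fill (ns ∷ ch) r c ≡ fill (ns′ ∷ ch′) r c) → ∀ r → at ns r ≤ at ns′ r
      ⊆-by {ns} ns′ {n} {ch} ch′ p q agrees r = <-ext λ c c< → ≰⇒> (λ ≤c → <-irrefl
        (trans (sym (fill-inner ns ch c<)) (trans (agrees (<-≤-trans c< (contained p r)))
            (fill-outer ns′ ch′ ≤c)))
        (fill-bound q c<))
      same : ns ≡ ns′
      same = at-injective ns ns′ (λ r → ≤-antisym (⊆-by ns′ ch′ p q agrees r)
          (⊆-by ns ch p′ q′ (λ c< → sym (agrees c<)) r))
      cong-step : ns ≡ ns′ → IsChain ns′ ch′ → ns ∷ ch ≡ ns′ ∷ ch′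
      cong-step refl q′ = cong (ns ∷_) (fill-injective q q′ (λ {r} c< →
        trans (sym (fill-inner ns ch c<)) (trans (agrees (<-≤-trans c< (contained p r)))
            (fill-inner ns ch′ c<))))

  -- The boxes with a given entry

  run-++ : ∀ s m n → run s (m + n) ≡ run s m ++ run (s + m) n
  run-++ s zero    n = cong (λ s → run s n) (sym (+-identityʳ s))
  run-++ s (suc m) n = cong (s ∷_) (trans (run-++ (suc s) m n)
      (cong (λ t → run (suc s) m ++ run t n) (sym (+-suc s m))))

  segment-split : ∀ r {l n} → n ≤ l → segment r 0 l ≡ segment r 0 n ++ segment r n (l ∸ n)
  segment-split r {l} {n} n≤l = trans
    (cong (segment r 0) (sym (m+[n∸m]≡n n≤l)))
    (trans (cong (map (r ,_)) (run-++ 0 n (l ∸ n))) (List.map-++ (r ,_) (run 0 n) (run n (l ∸ n))))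

  diagram : ∀ {k} → ℕ → Vec ℕ k → List Cell
  diagram r []       = []
  diagram r (l ∷ ls) = segment r 0 l ++ diagram (suc r) ls

  module _ {p} {P : Cell → Set p} (P? : Decidable P) where

    filter-skew : ∀ {k} r (ls ns : Vec ℕ k) → (∀ i → at ns i ≤ at ls i) →
      (∀ i {c} → c < at ns i → ¬ P (i + r , c)) →
      (∀ i {c} → at ns i ≤ c → c < at ls i → P (i + r , c)) →
      filter P? (diagram r ls) ≡ skew r ls ns
    filter-skew r [] [] _ _ _ = refl
    filter-skew r (l ∷ ls) (n ∷ ns) sub inside outside = begin
      filter P? (segment r 0 l ++ diagram (suc r) ls)
        ≡⟨ List.filter-++ P? (segment r 0 l) (diagram (suc r) ls) ⟩
      filter P? (segment r 0 l) ++ filter P? (diagram (suc r) ls)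
        ≡⟨ cong₂ _++_ first-row (filter-skew (suc r) ls ns (λ i → sub (suc i))
             (λ i {c} c< → subst (λ j → ¬ P (j , c)) (sym (+-suc i r)) (inside (suc i) c<))
             (λ i {c} ≤c c< → subst (λ j → P (j , c)) (sym (+-suc i r)) (outside (suc i) ≤c c<))) ⟩
      segment r n (l ∸ n) ++ skew (suc r) ls ns ∎
      where
      open ≡-Reasoning
      first-row : filter P? (segment r 0 l) ≡ segment r n (l ∸ n)
      first-row = begin
        filter P? (segment r 0 l)
          ≡⟨ cong (filter P?) (segment-split r (sub 0)) ⟩
        filter P? (segment r 0 n ++ segment r n (l ∸ n))
          ≡⟨ List.filter-++ P? (segment r 0 n) _ ⟩
        filter P? (segment r 0 n) ++ filter P? (segment r n (l ∸ n))
          ≡⟨ cong₂ _++_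
               (List.filter-none P? (All.tabulate λ { x∈ → let (eq , _ , c<) = ∈-segment⁻ r 0 n x∈ in
                 λ Px → inside 0 c< (subst (λ j → P (j , _)) eq Px) }))
               (List.filter-all P? (All.tabulate λ { x∈ → let (eq , ≤c , c<) = ∈-segment⁻ r n (l ∸ n) x∈ in
                 subst (λ j → P (j , _)) (sym eq) (outside 0 ≤c
                     (≤-trans c< (≤-reflexive (m+[n∸m]≡n (sub 0))))) })) ⟩
        segment r n (l ∸ n) ∎

    filter-inner : ∀ {q} {Q : Cell → Set q} (Q? : Decidable Q) {k} r (ls ns : Vec ℕ k) →
        (∀ i → at ns i ≤ at ls i) →
      (∀ i {c} → c < at ns i → (P (i + r , c) → Q (i + r , c)) × (Q (i + r , c) → P (i + r , c))) →
      (∀ i {c} → at ns i ≤ c → c < at ls i → ¬ P (i + r , c)) →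
      filter P? (diagram r ls) ≡ filter Q? (diagram r ns)
    filter-inner Q? r [] [] _ _ _ = refl
    filter-inner {Q = Q} Q? r (l ∷ ls) (n ∷ ns) sub inside outside = begin
      filter P? (segment r 0 l ++ diagram (suc r) ls)
        ≡⟨ List.filter-++ P? (segment r 0 l) (diagram (suc r) ls) ⟩
      filter P? (segment r 0 l) ++ filter P? (diagram (suc r) ls)
        ≡⟨ cong₂ _++_ first-row (filter-inner Q? (suc r) ls ns (λ i → sub (suc i))
             (λ i {c} c< → subst (λ j → (P (j , c) → Q (j , c)) × (Q (j , c) → P (j , c)))
                 (sym (+-suc i r)) (inside (suc i) c<))
             (λ i {c} ≤c c< → subst (λ j → ¬ P (j , c)) (sym (+-suc i r)) (outside (suc i) ≤c c<))) ⟩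
      filter Q? (segment r 0 n) ++ filter Q? (diagram (suc r) ns)
        ≡⟨ List.filter-++ Q? (segment r 0 n) (diagram (suc r) ns) ⟨
      filter Q? (segment r 0 n ++ diagram (suc r) ns) ∎
      where
      open ≡-Reasoning
      first-row : filter P? (segment r 0 l) ≡ filter Q? (segment r 0 n)
      first-row = begin
        filter P? (segment r 0 l)
          ≡⟨ cong (filter P?) (segment-split r (sub 0)) ⟩
        filter P? (segment r 0 n ++ segment r n (l ∸ n))
          ≡⟨ List.filter-++ P? (segment r 0 n) _ ⟩
        filter P? (segment r 0 n) ++ filter P? (segment r n (l ∸ n))
          ≡⟨ cong₂ _++_
               (filter-cong P? Q? (All.tabulate λ { x∈ → let (eq , _ , c<) = ∈-segment⁻ r 0 n x∈ in
                 subst (λ j → (P (j , _) → Q (j , _)) × (Q (j , _) → P (j , _))) (sym eq) (inside 0 c<) }))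
               (List.filter-none P? (All.tabulate λ { x∈ → let (eq , ≤c , c<) = ∈-segment⁻ r n (l ∸ n) x∈ in
                 λ Px → outside 0 ≤c (≤-trans c< (≤-reflexive (m+[n∸m]≡n (sub 0))))
                     (subst (λ j → P (j , _)) eq Px) })) ⟩
        filter Q? (segment r 0 n) ++ []
          ≡⟨ List.++-identityʳ _ ⟩
        filter Q? (segment r 0 n) ∎

  level : ∀ {k} → (ℕ → ℕ → ℕ) → ℕ → Vec ℕ k → List Cell
  level e k ls = filter (λ x → e (proj₁ x) (proj₂ x) ≟ k) (diagram 0 ls)

  module _ {N n} {ls ns : Vec ℕ N} {ch : Vec (Vec ℕ N) n} (p : ns ◁ ls) (q : IsChain ns ch) where

    level-outer : level (fill (ns ∷ ch)) n ls ≡ skew 0 ls ns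
    level-outer = filter-skew (λ x → fill (ns ∷ ch) (proj₁ x) (proj₂ x) ≟ n) 0 ls ns (contained p)
      (λ i {c} c< eq → <-irrefl (trans (sym (fill-inner ns ch (at+0 c<))) eq) (fill-bound q (at+0 c<)))
      (λ i {c} ≤c _ → fill-outer ns ch (≤-trans (≤-reflexive (cong (at ns) (+-identityʳ i))) ≤c))
      where
      at+0 : ∀ {i c} → c < at ns i → c < at ns (i + 0)
      at+0 {i} c< = ≤-trans c< (≤-reflexive (cong (at ns) (sym (+-identityʳ i))))

    level-inner : ∀ {k} → k < n → level (fill (ns ∷ ch)) k ls ≡ level (fill ch) k ns
    level-inner {k} k<n = filter-inner (λ x → fill (ns ∷ ch) (proj₁ x) (proj₂ x) ≟ k)
      (λ x → fill ch (proj₁ x) (proj₂ x) ≟ k) 0 ls ns (contained p)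
      (λ i {c} c< → (λ eq → trans (sym (fill-inner ns ch (at+0 c<))) eq) ,
          (λ eq → trans (fill-inner ns ch (at+0 c<)) eq))
      (λ i {c} ≤c _ eq → <-irrefl (trans (sym eq) (fill-outer ns ch
          (≤-trans (≤-reflexive (cong (at ns) (+-identityʳ i))) ≤c))) k<n)
      where
      at+0 : ∀ {i c} → c < at ns i → c < at ns (i + 0)
      at+0 {i} c< = ≤-trans c< (≤-reflexive (cong (at ns) (sym (+-identityʳ i))))

open Chains

-- Summation over tableaux

filter-map : ∀ {a b p q} {A : Set a} {B : Set b} {P : A → Set p} {Q : B → Set q}
  (P? : Decidable P) (Q? : Decidable Q) (f : A → B) →
  (∀ x → (P x → Q (f x)) × (Q (f x) → P x)) → ∀ xs → map f (filter P? xs) ≡ filter Q? (map f xs)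
filter-map P? Q? f iff []       = ≡.refl
filter-map P? Q? f iff (x ∷ xs) with P? x | Q? (f x)
... | yes _ | yes _ = ≡.cong (f x ∷_) (filter-map P? Q? f iff xs)
... | no _  | no _  = filter-map P? Q? f iff xs
... | yes p | no ¬q = ⊥-elim (¬q (proj₁ (iff x) p))
... | no ¬p | yes q = ⊥-elim (¬p (proj₂ (iff x) q))

tabulate-run : ∀ n s (f : Fin n → ℕ) → (∀ i → f i ≡ toℕ i ℕ.+ s) → tabulate f ≡ run s n
tabulate-run zero    s f p = ≡.refl
tabulate-run (suc n) s f p = ≡.cong₂ _∷_ (p fzero)
  (tabulate-run n (suc s) (f ∘ fsuc) (λ i → ≡.trans (p (fsuc i)) (≡.sym (ℕ.+-suc (toℕ i) s))))

row-segment : ∀ {n} {A : Set} (f : Fin n → A) (g : A → Cell) r → (∀ c → g (f c) ≡ (r , toℕ c)) →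
              map g (map f (allFin n)) ≡ segment r 0 n
row-segment {n} f g r p = ≡.trans (≡.sym (List.map-∘ (allFin n)))
  (≡.trans (List.map-cong p (allFin n))
    (≡.trans (List.map-∘ (allFin n)) (≡.cong (map (r ,_))
      (≡.trans (List.map-tabulate {n = n} (λ c → c) toℕ)
          (tabulate-run n 0 toℕ (λ i → ≡.sym (ℕ.+-identityʳ (toℕ i))))))))

diagram-pad-[] : ∀ o N → diagram o (pad N []) ≡ []
diagram-pad-[] o zero    = ≡.refl
diagram-pad-[] o (suc N) = diagram-pad-[] (suc o) N

concat-segments : ∀ ms N o → length ms ≤ N → (f : Fin (length ms) → List Cell) →
  (∀ i → f i ≡ segment (toℕ i ℕ.+ o) 0 (partOf ms (toℕ i))) → concat (tabulate f) ≡ diagram o (pad N ms)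
concat-segments []       N       o _ f p = ≡.sym (diagram-pad-[] o N)
concat-segments (m ∷ ms) (suc N) o q f p = ≡.cong₂ _++_ (p fzero)
  (concat-segments ms N (suc o) (ℕ.s≤s⁻¹ q) (f ∘ fsuc) (λ i → ≡.trans (p (fsuc i))
    (≡.cong (λ r → segment r 0 (partOf ms (toℕ i))) (≡.sym (ℕ.+-suc (toℕ i) o)))))

partOf-decreasing : ∀ {ms} → Linked _≥_ ms → ∀ r → partOf ms (suc r) ≤ partOf ms r
partOf-decreasing []        r       = z≤n
partOf-decreasing [-]       r       = z≤n
partOf-decreasing (p ∷ ps)  zero    = p
partOf-decreasing (p ∷ ps)  (suc r) = partOf-decreasing ps r

box-at : ∀ ms r c → c < partOf ms r →
  Σ[ b ∈ (Σ[ i ∈ Fin (length ms) ] Fin (partOf ms (toℕ i))) ] (toℕ (proj₁ b) ≡ r × toℕ (proj₂ b) ≡ c)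
box-at (m ∷ ms) zero    c c< = (fzero , fromℕ< c<) , ≡.refl , Fin.toℕ-fromℕ< c<
box-at (m ∷ ms) (suc r) c c< with box-at ms r c c<
... | (i , j) , p , q = (fsuc i , j) , ≡.cong suc p , q

module _ {a b p ℓ} {A : Set a} {P : A → Set p} (S : Setoid b ℓ)
  (f : ∀ {x} → P x → Setoid.Carrier S) where
  open Setoid S using (_≈_)
  open Membership S using () renaming (_∈_ to _∈ˢ_)

  reduce-unique : (∀ {x y} (p : P x) (q : P y) → f p ≈ f q → x ≡ y) →
                  ∀ {xs} → Unique xs → (ps : All P xs) → UniqueSetoid.Unique S (All.reduce f ps)
  reduce-unique inj []       []       = []
  reduce-unique inj (x∉ ∷ u) (p ∷ ps) = distinct x∉ ps ∷ reduce-unique inj u ps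
    where
    distinct : ∀ {xs} → All (λ y → _ ≢ y) xs → (ps : All P xs) → All (λ t → ¬ (f p ≈ t)) (All.reduce f ps)
    distinct []       []       = []
    distinct (n ∷ ns) (q ∷ qs) = (λ eq → n (inj p q eq)) ∷ distinct ns qs

  ∈-reduce : ∀ {t x xs} (ps : All P xs) → x ∈ xs → (∀ (p : P x) → t ≈ f p) → t ∈ˢ All.reduce f ps
  ∈-reduce (p ∷ ps) (here ≡.refl) t≈ = here (t≈ p)
  ∈-reduce (p ∷ ps) (there x∈)    t≈ = there (∈-reduce ps x∈ t≈)

-- Tableaux on the boxes of μ versus chains

module _ (μ : YoungDiagram) {N : ℕ} (rows≤N : rows μ ≤ N) where
  open YoungDiagram μ using (parts)
  open DiagonalStrictTableau

  shape : Vec ℕ N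
  shape = pad N parts

  at-shape : ∀ r → at shape r ≡ part μ r
  at-shape = at-pad N parts rows≤N

  shape-decreasing : Decreasing shape
  shape-decreasing r = ≡.subst₂ _≤_ (≡.sym (at-shape (suc r))) (≡.sym (at-shape r))
      (partOf-decreasing (YoungDiagram.decreasing μ) r)

  col<at : ∀ b → col μ b < at shape (row μ b)
  col<at (r , c) = ℕ.≤-trans (Fin.toℕ<n c) (ℕ.≤-reflexive (≡.sym (at-shape (toℕ r))))

  cells≡diagram : map (cell μ) (boxes μ) ≡ diagram 0 shape
  cells≡diagram = begin
    map (cell μ) (concatMap (λ r → map (r ,_) (allFin (part μ (toℕ r)))) (allFin (rows μ)))
      ≡⟨ List.map-concatMap (cell μ) (λ r → map (r ,_) (allFin (part μ (toℕ r)))) (allFin (rows μ)) ⟩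
    concatMap (λ r → map (cell μ) (map (r ,_) (allFin (part μ (toℕ r))))) (allFin (rows μ))
      ≡⟨ ≡.cong concat (List.map-tabulate {n = rows μ} (λ r → r)
          (λ r → map (cell μ) (map (r ,_) (allFin (part μ (toℕ r)))))) ⟩
    concat (tabulate (λ r → map (cell μ) (map (r ,_) (allFin (part μ (toℕ r))))))
      ≡⟨ concat-segments parts N 0 rows≤N _ (λ r → ≡.trans
           (row-segment (r ,_) (cell μ) (toℕ r) (λ _ → ≡.refl))
           (≡.cong (λ i → segment i 0 (part μ (toℕ r))) (≡.sym (ℕ.+-identityʳ (toℕ r))))) ⟩
    diagram 0 shape ∎
    where open ≡.≡-Reasoning

  preimage≡level : ∀ (T : DiagonalStrictTableau μ) e → (∀ b → entry T b ≡ e (row μ b) (col μ b)) → ∀ k →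
      preimage T k ≡ level e k shape
  preimage≡level T e p k = ≡.trans
    (filter-map (λ b → entry T b ℕ.≟ k) (λ x → e (proj₁ x) (proj₂ x) ℕ.≟ k) (cell μ)
      (λ b → (λ eq → ≡.trans (≡.sym (p b)) eq) , (λ eq → ≡.trans (p b) eq)) (boxes μ))
    (≡.cong (filter (λ x → e (proj₁ x) (proj₂ x) ℕ.≟ k)) cells≡diagram)

  box∈boxes : ∀ b → b ∈ boxes μ
  box∈boxes (r , c) = ∈-concatMap⁺ (λ r → map (r ,_) (allFin (part μ (toℕ r))))
    (lose (∈-allFin r) (∈-map⁺ (r ,_) (∈-allFin c)))

  toTableau : ∀ {n} {ch : Vec (Vec ℕ N) n} → IsChain shape ch → DiagonalStrictTableau μ
  toTableau {ch = ch} isChain = record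
    { entry          = λ b → fill ch (row μ b) (col μ b)
    ; rowWeak        = λ b b′ p q → ℕ.≤-trans (rowWeak T q
        (≡.subst (λ r → col μ b′ < at shape r) (≡.sym p) (col<at b′)))
                         (ℕ.≤-reflexive (≡.cong (λ r → fill ch r (col μ b′)) p))
    ; columnWeak     = λ b b′ p q → ℕ.≤-trans (columnWeak T q
        (≡.subst (_< at shape (row μ b′)) (≡.sym p) (col<at b′)))
                         (ℕ.≤-reflexive (≡.cong (fill ch (row μ b′)) p))
    ; diagonalStrict = λ b b′ p q → diagonalStrict T p q (col<at b′)
    }
    where
    open IsTableau using (rowWeak; columnWeak; diagonalStrict)
    T : IsTableau shape (fill ch)
    T = fill-isTableau shape-decreasing isChain

  box : ∀ {r c} → c < at shape r → Σ[ b ∈ Box μ ] (row μ b ≡ r × col μ b ≡ c)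
  box {r} {c} c< = box-at parts r c (ℕ.≤-trans c< (ℕ.≤-reflexive (at-shape r)))

  toTableau-injective : ∀ {n} {ch ch′ : Vec (Vec ℕ N) n} (p : IsChain shape ch) (q : IsChain shape ch′) →
    (∀ b → entry (toTableau p) b ≡ entry (toTableau q) b) → ch ≡ ch′
  toTableau-injective {ch = ch} {ch′} p q eq = fill-injective p q (λ {r} {c} c< → agree (box c<))
    where
    agree : ∀ {r c} → Σ[ b ∈ Box μ ] (row μ b ≡ r × col μ b ≡ c) → fill ch r c ≡ fill ch′ r c
    agree (b , ≡.refl , ≡.refl) = eq b

  module _ (T : DiagonalStrictTableau μ) where

    -- Turns a function on boxes into one on all pairs of numbers, the form that `chain-of` takes; 0
    -- is a mere default outside the shape.
    extended : ℕ → ℕ → ℕ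
    extended r c with c ℕ.<? at shape r
    ... | yes p = entry T (proj₁ (box p))
    ... | no  _ = 0

    extended-box : ∀ {r c} → c < at shape r →
                   Σ[ b ∈ Box μ ] (row μ b ≡ r × col μ b ≡ c × extended r c ≡ entry T b)
    extended-box {r} {c} c< with c ℕ.<? at shape r
    ... | yes p = proj₁ (box p) , proj₁ (proj₂ (box p)) , proj₂ (proj₂ (box p)) , ≡.refl
    ... | no ¬p = ⊥-elim (¬p c<)

    -- The box found by `box` is known only to share row and column with `b`. Row weakness in both
    -- directions makes the entries equal without identifying the boxes themselves.
    extended-entry : ∀ b → entry T b ≡ extended (row μ b) (col μ b)
    extended-entry b with extended-box (col<at b)
    ... | b′ , p , q , eq = ≡.trans (ℕ.≤-antisym
      (rowWeak T b b′ (≡.sym p) (ℕ.≤-reflexive (≡.sym q))) (rowWeak T b′ b p (ℕ.≤-reflexive q))) (≡.sym eq)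

    extended-isTableau : IsTableau shape extended
    extended-isTableau = record
      { rowWeak = λ c≤c′ c′< → row-weak c≤c′ (extended-box (ℕ.≤-<-trans c≤c′ c′<)) (extended-box c′<)
      ; columnWeak = λ r≤r′ c< → column-weak r≤r′
          (extended-box (ℕ.<-≤-trans c< (antitone shape shape-decreasing r≤r′))) (extended-box c<)
      ; diagonalStrict = λ {r} {r′} eq r<r′ c′< → diagonal-strict eq r<r′
          (extended-box (ℕ.<-≤-trans (ℕ.<-trans (diagonal-< {r} {r′} eq r<r′) c′<)
              (antitone shape shape-decreasing (ℕ.<⇒≤ r<r′))))
          (extended-box c′<)
      }
      where
      BoxAt : ℕ → ℕ → Set
      BoxAt r c = Σ[ b ∈ Box μ ] (row μ b ≡ r × col μ b ≡ c × extended r c ≡ entry T b)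
      row-weak : ∀ {r c c′} → c ≤ c′ → BoxAt r c → BoxAt r c′ → extended r c ≤ extended r c′
      row-weak c≤c′ (b , p , ≡.refl , e) (b′ , p′ , ≡.refl , e′) =
        ≡.subst₂ _≤_ (≡.sym e) (≡.sym e′) (rowWeak T b b′ (≡.trans p (≡.sym p′)) c≤c′)
      column-weak : ∀ {r r′ c} → r ≤ r′ → BoxAt r c → BoxAt r′ c → extended r c ≤ extended r′ c
      column-weak r≤r′ (b , ≡.refl , p , e) (b′ , ≡.refl , p′ , e′) =
        ≡.subst₂ _≤_ (≡.sym e) (≡.sym e′) (columnWeak T b b′ (≡.trans p (≡.sym p′)) r≤r′)
      diagonal-strict : ∀ {r r′ c c′} → r ℕ.+ c′ ≡ r′ ℕ.+ c → r < r′ → BoxAt r c → BoxAt r′ c′ →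
          extended r c < extended r′ c′
      diagonal-strict eq r<r′ (b , ≡.refl , ≡.refl , e) (b′ , ≡.refl , ≡.refl , e′) =
        ≡.subst₂ _<_ (≡.sym e) (≡.sym e′) (diagonalStrict T b b′ eq r<r′)

    tableau-chain : ∀ n → (∀ b → entry T b < n) →
      ∃ λ (ch : Vec (Vec ℕ N) n) → IsChain shape ch × (∀ b → entry T b ≡ fill ch (row μ b) (col μ b))
    tableau-chain n entry<n with chain-of n shape extended shape-decreasing extended-isTableau
      (λ c< → let (b , _ , _ , eq) = extended-box c< in ℕ.≤-<-trans (ℕ.≤-reflexive eq) (entry<n b))
    ... | ch , isChain , agrees = ch , isChain , λ b → ≡.trans (extended-entry b) (≡.sym (agrees (col<at b)))

  entry≤maxEntry : ∀ (T : DiagonalStrictTableau μ) b → entry T b ≤ maxEntry T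
  entry≤maxEntry T b = ≤-foldr (∈-map⁺ (entry T) (box∈boxes b))
    where
    ≤-foldr : ∀ {m ms} → m ∈ ms → m ≤ foldr ℕ._⊔_ 0 ms
    ≤-foldr (here ≡.refl) = ℕ.m≤m⊔n _ _
    ≤-foldr (there m∈)    = ℕ.≤-trans (≤-foldr m∈) (ℕ.m≤n⊔m _ _)

  preimage-[] : ∀ (T : DiagonalStrictTableau μ) k → (∀ b → entry T b ≢ k) → preimage T k ≡ []
  preimage-[] T k p = ≡.cong (map (cell μ)) (List.filter-none (λ b → entry T b ℕ.≟ k)
      (All.universal p (boxes μ)))

  preimage-∷ : ∀ (T : DiagonalStrictTableau μ) b → ∃ λ x → ∃ λ xs → preimage T (entry T b) ≡ x ∷ xs
  preimage-∷ T b = nonempty (∈-map⁺ (cell μ) (∈-filter⁺ (λ b′ → entry T b′ ℕ.≟ entry T b) (box∈boxes b) ≡.refl))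
    where
    nonempty : ∀ {x : Cell} {xs} → x ∈ xs → ∃ λ y → ∃ λ ys → xs ≡ y ∷ ys
    nonempty {xs = y ∷ ys} _ = y , ys , ≡.refl

-- Summation of weights over chains and over tableaux

module Summation {c ℓ} (K : CommutativeRing c ℓ) (isℚAlgebra : IsℚAlgebra K)
  (a : ℤ → CommutativeRing.Carrier K) (N : ℕ) (x y : SymmetricFunctions.FiniteSequence K isℚAlgebra) where
  open CommutativeRing K
  open RingOps K
  open RingSums K
  open Forms K using (sign)
  open SymmetricFunctions K isℚAlgebra
  open FiniteSequence
  open Specialisations K isℚAlgebra
  open Determinants K isℚAlgebra a N
  open HookPolynomials K isℚAlgebra a N using (polynomial-skew; prodList-++)
  open SetoidReasoning setoid

  -- The power sums of the first `n` pairs of variables, built by `extend` so that `s-branching`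
  -- removes the pair with the largest index, matching the largest entry of a tableau.
  π : ℕ → ℕ → Carrier
  π zero    = λ _ → 0#
  π (suc n) = extend (π n) (coord x n) (coord y n)

  sum-snoc : ∀ n (f : ℕ → Carrier) → ∑[ i < suc n ] f (toℕ i) ≈ ∑[ i < n ] f (toℕ i) + f n
  sum-snoc zero    f = +-comm _ _
  sum-snoc (suc n) f = trans (+-congˡ (sum-snoc n (λ i → f (suc i)))) (sym (+-assoc _ _ _))

  sum-truncate : ∀ b d (f : ℕ → Carrier) → (∀ i → b ≤ i → f i ≈ 0#) → ∑[ i < d ℕ.+ b ] f
      (toℕ i) ≈ ∑[ i < b ] f (toℕ i)
  sum-truncate b zero    f p = refl
  sum-truncate b (suc d) f p = trans (sum-snoc (d ℕ.+ b) f)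
    (trans (+-cong (sum-truncate b d f p) (p (d ℕ.+ b) (ℕ.m≤n+m b d))) (+-identityʳ _))

  powerSum-truncate : ∀ m z n → bound z ≤ n → ∑[ i < n ] (coord z (toℕ i) ^ suc m) ≈ powerSum (suc m) z
  powerSum-truncate m z n b≤n = trans
    (reflexive (≡.cong (λ n → ∑[ i < n ] (coord z (toℕ i) ^ suc m)) (≡.sym (ℕ.m∸n+n≡m b≤n))))
    (sum-truncate (bound z) (n ∸ bound z) (λ i → coord z i ^ suc m)
      (λ i b≤i → trans (*-congʳ (vanish z i b≤i)) (zeroˡ _)))

  π-sum : ∀ n m → π n m ≈ ∑[ i < n ] (coord x (toℕ i) ^ suc m) + sign m * ∑[ i < n ] (coord y (toℕ i) ^ suc m)
  π-sum zero    m = sym (trans (+-identityˡ _) (zeroʳ _))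
  π-sum (suc n) m = trans (+-congʳ (π-sum n m)) (trans
    (solve 5 (λ p s q u v → (p :+ s :* q) :+ (u :+ s :* v) := (p :+ u) :+ s :* (q :+ v)) refl
      (∑[ i < n ] (coord x (toℕ i) ^ suc m)) (sign m) (∑[ i < n ] (coord y (toℕ i) ^ suc m))
      (coord x n ^ suc m) (coord y n ^ suc m))
    (sym (+-cong (sum-snoc n (λ i → coord x i ^ suc m)) (*-congˡ (sum-snoc n (λ i → coord y i ^ suc m))))))

  π-powerSum : ∀ n → bound x ≤ n → bound y ≤ n → ∀ m → powerSum (suc m) x + sign m * powerSum (suc m) y ≈ π n m
  π-powerSum n p q m = sym (trans (π-sum n m)
    (+-cong (powerSum-truncate m x n p) (*-congˡ (powerSum-truncate m y n q))))

  levelWeight : ℕ → List Cell → Carrier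
  levelWeight k = polynomial a (coord x k) (coord y k)

  chainWeight : ∀ {n} → Vec ℕ N → Vec (Vec ℕ N) n → Carrier
  chainWeight ls []                   = 1#
  chainWeight ls (_∷_ {n = n} ns ch) = levelWeight n (skew 0 ls ns) * chainWeight ns ch

  s-det-chains : ∀ n ls → Decreasing ls → s-det (π n) ls ≈ ∑ˡ (chains n ls) (chainWeight ls)
  s-det-chains zero ls dec with at ls 0 in eq
  ... | zero  = trans (s-det-empty (λ _ → refl) ls
                  (λ r → ℕ.n≤0⇒n≡0 (ℕ.≤-trans (antitone ls dec z≤n) (ℕ.≤-reflexive eq)))) (sym (+-identityʳ _))
  ... | suc _ = s-det-nonempty (λ _ → refl) ls (ℕ.≤-trans ℕ.z<s (ℕ.≤-reflexive (≡.sym eq)))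
  s-det-chains (suc n) ls dec = begin
    s-det (π (suc n)) ls
      ≈⟨ s-branching (coord x n) (coord y n) (π n) ls dec ⟩
    ∑ˡ (choices ls) (λ ns → _ * s-det (π n) ns)
      ≈⟨ ∑ˡ-cong (choices ls) (All.tabulate (λ {ns} ns∈ → let ns◁ls = choices-sound dec ns∈ in
           trans (*-cong (sym (polynomial-skew (coord x n) (coord y n) ls ns dec ns◁ls))
                         (s-det-chains n ns (decreasing ns◁ls)))
           (trans (∑ˡ-distribˡ _ (chains n ns) (chainWeight ns))
             (reflexive (≡.sym (∑ˡ-map (ns ∷_) (chains n ns) (chainWeight ls))))))) ⟩
    ∑ˡ (choices ls) (λ ns → ∑ˡ (map (ns ∷_) (chains n ns)) (chainWeight ls))
      ≈⟨ ∑ˡ-concatMap (λ ns → map (ns ∷_) (chains n ns)) (choices ls) (chainWeight ls) ⟨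
    ∑ˡ (chains (suc n) ls) (chainWeight ls) ∎

  ∏< : ℕ → (ℕ → Carrier) → Carrier
  ∏< n f = prodList (map f (upTo n))

  -- `upTo` lists the small entries first, whereas a chain gives up its largest entry first.
  ∏<-snoc : ∀ n f → ∏< (suc n) f ≈ ∏< n f * f n
  ∏<-snoc n f = begin
    prodList (map f (upTo (suc n)))              ≈⟨ reflexive
        (≡.cong (λ ks → prodList (map f ks)) (≡.sym (List.upTo-∷ʳ n))) ⟩
    prodList (map f (upTo n ++ [ n ]))           ≈⟨ reflexive (≡.cong prodList (List.map-++ f (upTo n) [ n ])) ⟩
    prodList (map f (upTo n) ++ [ f n ])         ≈⟨ prodList-++′ (map f (upTo n)) ⟩
    ∏< n f * (f n * 1#)                          ≈⟨ *-congˡ (*-identityʳ _) ⟩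
    ∏< n f * f n                                 ∎
    where
    prodList-++′ : ∀ zs → prodList (zs ++ [ f n ]) ≈ prodList zs * (f n * 1#)
    -- The two zeros instantiate the parameters `u` and `v` of the module that `prodList-++` comes
    -- from.
    prodList-++′ zs = prodList-++ 0# 0# zs [ f n ]

  ∏<-cong : ∀ n {f g} → (∀ k → k < n → f k ≈ g k) → ∏< n f ≈ ∏< n g
  ∏<-cong zero    p = refl
  ∏<-cong (suc n) {f} {g} p = trans (∏<-snoc n f) (trans
    (*-cong (∏<-cong n (λ k k<n → p k (ℕ.m<n⇒m<1+n k<n))) (p n ℕ.≤-refl)) (sym (∏<-snoc n g)))

  ∏<-extend : ∀ n d {f} → (∀ k → n ≤ k → f k ≈ 1#) → ∏< (d ℕ.+ n) f ≈ ∏< n f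
  ∏<-extend n zero    p = refl
  ∏<-extend n (suc d) {f} p = trans (∏<-snoc (d ℕ.+ n) f)
    (trans (*-cong (∏<-extend n d p) (p (d ℕ.+ n) (ℕ.m≤n+m n d))) (*-identityʳ _))

  ∏<-zero : ∀ n {f k} → k < n → f k ≈ 0# → ∏< n f ≈ 0#
  ∏<-zero (suc n) {f} k<1+n fk≈0 with ℕ.m≤n⇒m<n∨m≡n (ℕ.s≤s⁻¹ k<1+n)
  ... | inj₁ k<n    = trans (∏<-snoc n f) (trans (*-congʳ (∏<-zero n k<n fk≈0)) (zeroˡ _))
  ... | inj₂ ≡.refl = trans (∏<-snoc n f) (trans (*-congˡ fk≈0) (zeroʳ _))

  chain-levels : ∀ {n ls} {ch : Vec (Vec ℕ N) n} → IsChain ls ch →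
                 ∏< n (λ k → levelWeight k (level (fill ch) k ls)) ≈ chainWeight ls ch
  chain-levels (empty _) = refl
  chain-levels (step {n} {ls} {ns} {ch} p q) = begin
    ∏< (suc n) (λ k → levelWeight k (level (fill (ns ∷ ch)) k ls))
      ≈⟨ ∏<-snoc n (λ k → levelWeight k (level (fill (ns ∷ ch)) k ls)) ⟩
    ∏< n (λ k → levelWeight k (level (fill (ns ∷ ch)) k ls)) * levelWeight n (level (fill (ns ∷ ch)) n ls)
      ≈⟨ *-cong (∏<-cong n (λ k k<n → reflexive (≡.cong (levelWeight k) (level-inner p q k<n))))
                (reflexive (≡.cong (levelWeight n) (level-outer p q))) ⟩
    ∏< n (λ k → levelWeight k (level (fill ch) k ns)) * levelWeight n (skew 0 ls ns)
      ≈⟨ *-congʳ (chain-levels q) ⟩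
    chainWeight ns ch * levelWeight n (skew 0 ls ns)
      ≈⟨ *-comm _ _ ⟩
    levelWeight n (skew 0 ls ns) * chainWeight ns ch ∎

  ∑ˡ-reduce : ∀ {i p s} {A : Set i} {P : A → Set p} {B : Set s} (f : ∀ {x} → P x → B) (w : B → Carrier)
      (w′ : A → Carrier) →
    (∀ {x} (p : P x) → w (f p) ≈ w′ x) → ∀ {xs} (ps : All P xs) → ∑ˡ (All.reduce f ps) w ≈ ∑ˡ xs w′
  ∑ˡ-reduce f w w′ eq []       = refl
  ∑ˡ-reduce f w w′ eq (p ∷ ps) = +-cong (eq p) (∑ˡ-reduce f w w′ eq ps)

  module _ (μ : YoungDiagram) (rows≤N : rows μ ≤ N) where
    open DiagonalStrictTableau

    factorAt : DiagonalStrictTableau μ → ℕ → Carrier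
    factorAt T k = levelWeight k (preimage T k)

    factorAt-1 : ∀ (T : DiagonalStrictTableau μ) k → (∀ b → entry T b ≢ k) → factorAt T k ≈ 1#
    factorAt-1 T k p = reflexive (≡.cong (levelWeight k) (preimage-[] μ rows≤N T k p))

    -- The range up to `n` and the one up to `suc (maxEntry T)` are both compared with a range as
    -- long as the two together; every surplus factor belongs to an empty preimage and is 1.
    weight-upTo : ∀ (T : DiagonalStrictTableau μ) n → (∀ b → entry T b < n) → weight a μ x y T ≈ ∏< n
        (factorAt T)
    weight-upTo T n entry<n = begin
      ∏< M (factorAt T)
        ≈⟨ ∏<-extend M n (λ k M≤k → factorAt-1 T k (λ b eq →
             ℕ.<⇒≱ (ℕ.s≤s (entry≤maxEntry μ rows≤N T b)) (ℕ.≤-trans M≤k (ℕ.≤-reflexive (≡.sym eq))))) ⟨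
      ∏< (n ℕ.+ M) (factorAt T)
        ≈⟨ reflexive (≡.cong (λ m → ∏< m (factorAt T)) (ℕ.+-comm n M)) ⟩
      ∏< (M ℕ.+ n) (factorAt T)
        ≈⟨ ∏<-extend n M (λ k n≤k → factorAt-1 T k (λ b eq →
             ℕ.<⇒≱ (entry<n b) (ℕ.≤-trans n≤k (ℕ.≤-reflexive (≡.sym eq))))) ⟩
      ∏< n (factorAt T) ∎
      where M = suc (maxEntry T)

    weight-toTableau : ∀ {n} {ch : Vec (Vec ℕ N) n} (p : IsChain (shape μ rows≤N) ch) →
                       weight a μ x y (toTableau μ rows≤N p) ≈ chainWeight (shape μ rows≤N) ch
    weight-toTableau {n} {ch} p = begin
      weight a μ x y T
        ≈⟨ weight-upTo T n (λ b → fill-bound p (col<at μ rows≤N b)) ⟩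
      ∏< n (factorAt T)
        ≈⟨ ∏<-cong n (λ k _ → reflexive (≡.cong (levelWeight k)
             (preimage≡level μ rows≤N T (fill ch) (λ _ → ≡.refl) k))) ⟩
      ∏< n (λ k → levelWeight k (level (fill ch) k (shape μ rows≤N)))
        ≈⟨ chain-levels p ⟩
      chainWeight (shape μ rows≤N) ch ∎
      where T = toTableau μ rows≤N p

    -- A nonempty list of cells has a first component by the definition of `components`, and the
    -- hook polynomial of that component contains the factor `u + v`.
    levelWeight-0 : ∀ k → coord x k ≈ 0# → coord y k ≈ 0# → ∀ b bs → levelWeight k (b ∷ bs) ≈ 0#
    levelWeight-0 k x≈0 y≈0 b bs = trans (*-congʳ (trans
        (*-congʳ (trans (+-cong x≈0 y≈0) (+-identityˡ 0#))) (zeroˡ _))) (zeroˡ _)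

    weight-0 : ∀ (T : DiagonalStrictTableau μ) b → bound x ≤ entry T b → bound y ≤ entry T b →
        weight a μ x y T ≈ 0#
    weight-0 T b p q with preimage-∷ μ rows≤N T b
    ... | z , zs , eq = ∏<-zero (suc (maxEntry T)) {factorAt T} (ℕ.s≤s (entry≤maxEntry μ rows≤N T b))
      (trans (reflexive (≡.cong (levelWeight (entry T b)) eq))
        (levelWeight-0 (entry T b) (vanish x _ p) (vanish y _ q) z zs))

    combinatorial-formula : HasSum (tableaux μ) (weight a μ x y) (s⟨ a ⟩ μ N ⟨ x ∣ y ⟩)
    combinatorial-formula = L
      , reduce-unique (tableaux μ) (toTableau μ rows≤N) (toTableau-injective μ rows≤N)
          (chains-unique n λ′) valid
      , outside
      , (begin
          ∑ˡ L (weight a μ x y)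
            ≈⟨ ∑ˡ-reduce (toTableau μ rows≤N) (weight a μ x y) (chainWeight λ′) weight-toTableau valid ⟩
          ∑ˡ (chains n λ′) (chainWeight λ′)
            ≈⟨ s-det-chains n λ′ (shape-decreasing μ rows≤N) ⟨
          s-det (π n) λ′
            ≈⟨ s-specialised (π n) μ rows≤N ⟨
          specialise (π n) (s⟨ a ⟩ μ N)
            ≈⟨ specialise-congˡ (π-powerSum n (ℕ.m≤m⊔n _ _) (ℕ.m≤n⊔m _ _)) (s⟨ a ⟩ μ N) ⟨
          s⟨ a ⟩ μ N ⟨ x ∣ y ⟩ ∎)
      where
      n : ℕ
      -- From this index on both coordinates vanish. So the first `n` pairs already give the full
      -- power sums, and a tableau with an entry at least `n` has weight 0.
      n = bound x ℕ.⊔ bound y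
      λ′ : Vec ℕ N
      λ′ = shape μ rows≤N
      valid : All (IsChain λ′) (chains n λ′)
      valid = All.tabulate (chains-sound n (shape-decreasing μ rows≤N))
      L : List (DiagonalStrictTableau μ)
      -- `toTableau` consumes the proof that a vector is a chain, hence a reduction of `valid`
      -- rather than a map over `chains`.
      L = All.reduce (toTableau μ rows≤N) valid
      open Membership (tableaux μ) using () renaming (_∈_ to _∈ᵗ_)
      outside : ∀ T → ¬ (T ∈ᵗ L) → weight a μ x y T ≈ 0#
      outside T T∉L with any? (λ b → n ℕ.≤? entry T b) (boxes μ)
      ... | yes large = let (b , _ , n≤) = find large in
        weight-0 T b (ℕ.≤-trans (ℕ.m≤m⊔n _ _) n≤) (ℕ.≤-trans (ℕ.m≤n⊔m _ _) n≤)
      ... | no ¬large with tableau-chain μ rows≤N T n (λ b → ℕ.≰⇒>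
          (λ n≤ → ¬large (lose (box∈boxes μ rows≤N b) n≤)))
      ... | ch , isChain , agrees = ⊥-elim (T∉L
        (∈-reduce (tableaux μ) (toTableau μ rows≤N) {t = T} valid (chains-complete isChain) (λ _ → agrees)))

theorem14 : ∀ {c ℓ} (K : CommutativeRing c ℓ) (isℚAlgebra : IsℚAlgebra K) →
  let open CommutativeRing K using (Carrier)
      open RingOps K using (HasSum)
      open SymmetricFunctions K isℚAlgebra
  in (a : ℤ → Carrier) (μ : YoungDiagram) (N : ℕ) → rows μ ≤ N →
     (x y : FiniteSequence) →
     HasSum (tableaux μ) (weight a μ x y) (s⟨ a ⟩ μ N ⟨ x ∣ y ⟩)
theorem14 K isℚAlgebra a μ N rows≤N x y = Summation.combinatorial-formula K isℚAlgebra a N x y μ rows≤N
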